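{- There exists a constant $C>0$ such that for all integers $d \ge 2$ and $n,r \ge 1$, \[ |\mathcal{C}^d_{n,r}| \le 2^{\frac{n}{2d} \left(1 + \frac{Cr \log^{3/2} d}{\sqrt{d}} \right)} ,\] where $\mathcal{C}^d_{n,r}$ is the collection of odd $r$-cutsets $S\subset\mathbb{Z}^d$ with $|\partial S|=n$ and $\mathrm{dist}(\mathbf{0},S) \le r$.
   Context: $\mathbb{Z}^d$ is viewed as a graph with nearest-neighbor adjacency; $\mathbf 0$ is the origin and $\mathrm{dist}$ is graph distance (distance from a point to a set is the minimum over the set). A vertex is odd (even) if its distance from the origin is odd (even). $\partial S$ is the set of edges with exactly one endpoint in $S$. A set $S$ is odd if every vertex of $S$ adjacent to a vertex outside $S$ is odd. A set is regular if neither it nor its complement contains a vertex all of whose neighbors lie outside the set (i.e. neither induces a subgraph with isolated vertices). For a positive integer $r$, $(\mathbb{Z}^d)^{\otimes r}$ is the graph on $\mathbb{Z}^d$ in which two vertices are adjacent if their distance in $\mathbb{Z}^d$ is at most $r$. An $r$-cutset is a finite regular subset of $\mathbb{Z}^d$ such that both it and its complement are connected in $(\mathbb{Z}^d)^{\otimes r}$. -}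

module Defs where

open import Data.Nat as ℕ using (ℕ; zero; suc; _+_; _*_; _≤_; _≤?_)
open import Data.Nat.ListAction using (sum)
open import Data.Integer as ℤ using (ℤ; ∣_∣)
open import Data.Fin using (Fin)
open import Data.Vec as Vec using (Vec; updateAt; replicate; zipWith)
open import Data.Vec.Properties using (≡-dec)
open import Data.List as List using (List; []; _∷_; length; filter; concatMap; allFin; upTo)
open import Data.List.Membership.Propositional using (_∈_; _∉_)
open import Data.List.Membership.DecPropositional using () renaming (_∈?_ to _∈?ᵍ_)
open import Data.List.Relation.Unary.Unique.Propositional using (Unique)
open import Data.Product using (Σ; ∃; _×_; _,_)
open import Relation.Binary.PropositionalEquality using (_≡_)
open import Relation.Nullary using (¬_)
open import Relation.Unary using (Pred; ∁)
open import Function.Bundles using (_⇔_)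

Point : ℕ → Set
Point d = Vec ℤ d

origin : ∀ {d} → Point d
origin = replicate _ (ℤ.+ 0)

-- graph distance in the nearest-neighbour lattice ℤ^d (= ℓ¹ distance)
dist : ∀ {d} → Point d → Point d → ℕ
dist x y = Vec.foldr _ _+_ 0 (zipWith (λ a b → ∣ a ℤ.- b ∣) x y)

Adj : ∀ {d} → Point d → Point d → Set
Adj x y = dist x y ≡ 1

IsOdd : ℕ → Set
IsOdd n = ∃ λ k → n ≡ suc (2 * k)

OddVertex : ∀ {d} → Point d → Set
OddVertex x = IsOdd (dist origin x)

-- Finite subsets of ℤ^d are represented by duplicate-free lists;
-- membership is list membership.
FinSet : ℕ → Set
FinSet d = List (Point d)

InS : ∀ {d} → FinSet d → Pred (Point d) _
InS S x = x ∈ S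

_≈S_ : ∀ {d} → FinSet d → FinSet d → Set
S ≈S T = ∀ x → (x ∈ S) ⇔ (x ∈ T)

OddSet : ∀ {d} → FinSet d → Set
OddSet {d} S = ∀ x → x ∈ S → (∃ λ (y : Point d) → Adj x y × y ∉ S) → OddVertex x

NoIsolated : ∀ {d} → Pred (Point d) _ → Set
NoIsolated {d} P = ∀ x → P x → ∃ λ (y : Point d) → Adj x y × P y

Regular : ∀ {d} → FinSet d → Set
Regular S = NoIsolated (InS S) × NoIsolated (∁ (InS S))

data PathIn {d} (r : ℕ) (P : Pred (Point d) _) : Point d → Point d → Set where
  here : ∀ {x} → P x → PathIn r P x x
  step : ∀ {x z y} → P x → dist x z ≤ r → PathIn r P z y → PathIn r P x y

ConnectedR : ∀ {d} → ℕ → Pred (Point d) _ → Set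
ConnectedR {d} r P = ∀ (x y : Point d) → P x → P y → PathIn r P x y

Cutset : ∀ {d} → ℕ → FinSet d → Set
Cutset r S = Unique S × Regular S × ConnectedR r (InS S) × ConnectedR r (∁ (InS S))

neighbours : ∀ {d} → Point d → List (Point d)
neighbours {d} x = concatMap (λ i → updateAt x i (ℤ._+ ℤ.+ 1) ∷ updateAt x i (ℤ._- ℤ.+ 1) ∷ []) (allFin d)

-- |∂S|: number of edges with exactly one endpoint in S
-- (each such edge is counted once, from its endpoint in S; S is duplicate-free)
boundarySize : ∀ {d} → FinSet d → ℕ
boundarySize {d} S =
  sum (List.map (λ x → length (filter (λ y → Relation.Nullary.¬? (_∈?ᵍ_ (≡-dec ℤ._≟_) y S)) (neighbours x))) S)
  where import Relation.Nullary

DistOriginLe : ∀ {d} → FinSet d → ℕ → Set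
DistOriginLe S r = ∃ λ x → x ∈ S × dist origin x ≤ r

InC : (d n r : ℕ) → FinSet d → Set
InC d n r S = OddSet S × Cutset r S × boundarySize S ≡ n × DistOriginLe S r

isqrt : ℕ → ℕ
isqrt d = length (filter (λ k → k * k ≤? d) (List.map suc (upTo d)))

{-# OPTIONS --safe #-}
module Submission where

-- Let T be the set of odd points of S and even points outside S.  The complement of T is independent, every point of T
-- has a neighbour outside T, and the boundary edges of S are the edges inside T; so S is encoded by a minimal vertex
-- cover of ℤ^d with n internal edges.
--
-- Some U with |U| = O(n √(log d) / d^{3/2}) has a point next to an endpoint of every boundary edge: greedy covering takes
-- care of the vertices with many neighbours of boundary degree at least √(d log d), and the remaining ones are next to a
-- point outside T at least half of whose neighbours have boundary degree close to 2d.  Since S and its complement are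
-- r-connected, U is connected at scale O(r), so it lies on a walk of length L = O(r |U|), and the walks can be enumerated.
--
-- Given the walk, the cutsets compatible with it are counted by branching, calling a vertex mixed when the remaining
-- candidates disagree there.  Away from the neighbours of the walk S is constant on components, whose edge boundary is
-- at least d² unless all their vertices mostly touch the walk; this costs O(L) bits and leaves O(dL) mixed vertices.
-- Revealing vertices with more than d, and then more than √d, mixed neighbours costs O(L log d + n log d / d^{3/2}) bits.
-- What remains is a minimal vertex cover of a graph of maximal degree √d, each of whose vertices accounts for
-- 2d - √d boundary edges: there are at most 2^{n / (2d - √d)} of these.

open import Defs renaming (here to stay; step to jump)
open import Algebra.Bundles using (AbelianGroup)
open import Data.Bool using (Bool; true; false; not; _∧_; _xor_) renaming (_≟_ to _≟ᵇ_)
import Data.Bool.Properties as Bool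
open import Data.Bool.Solver using (module xor-∧-Solver)
open import Data.Empty using (⊥; ⊥-elim)
open import Data.Fin using (Fin; fromℕ<) renaming (zero to fzero; suc to fsuc)
import Data.Fin.Properties as Fin
open import Data.Integer as ℤ using (ℤ; -[1+_]; ∣_∣) renaming (+_ to pos)
import Data.Integer.Properties as ℤ
open import Data.List using (List; []; _∷_; _++_; length; filter; map; concatMap; upTo; allFin; replicate; deduplicate; cartesianProduct; cartesianProductWith)
open import Data.List.Properties using (length-map; length-upTo; length-++; length-tabulate; length-replicate; upTo-∷ʳ; map-++; ≡-dec)
open import Data.List.Membership.DecPropositional using () renaming (_∈?_ to _∈?ᵍ_)
open import Data.List.Membership.Propositional using (_∈_; _∉_)
open import Data.List.Membership.Propositional.Properties
  using (∈-∃++; ∈-map⁻; ∈-upTo⁻; ∈-upTo⁺; ∈-++⁻; ∈-++⁺ˡ; ∈-++⁺ʳ; ∈-filter⁺; ∈-filter⁻; ∈-allFin; ∈-concatMap⁺; ∈-deduplicate⁺;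
         ∈-cartesianProduct⁺; ∈-cartesianProduct⁻; ∈-cartesianProductWith⁺)
open import Data.List.Relation.Unary.All as All using (All; []; _∷_)
open import Data.List.Relation.Unary.AllPairs using (AllPairs; []; _∷_)
import Data.List.Relation.Unary.AllPairs.Properties as AllPairs
open import Data.List.Relation.Unary.Any as Any using (here; there)
open import Data.List.Relation.Unary.Unique.DecPropositional.Properties using (deduplicate-!)
open import Data.List.Relation.Unary.Unique.Propositional using (Unique)
import Data.List.Relation.Unary.Unique.Propositional.Properties as Unique
open import Data.Nat hiding (∣_-_∣)
open import Data.Nat.DivMod using (m≡m%n+[m/n]*n; m%n<n; m/n*n≤m)
open import Data.Nat.ListAction using (sum)
open import Data.Nat.Logarithm using (⌊log₂_⌋; ⌊log₂⌋-mono-≤; ⌊log₂[2^n]⌋≡n)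
open import Data.Nat.Properties
open import Data.Nat.Solver using (module +-*-Solver)
open import Data.Product using (Σ; ∃; _×_; _,_; proj₁; proj₂)
import Data.Product.Properties as Prod
open import Data.Sum using (_⊎_; inj₁; inj₂)
open import Data.Vec using ([]; _∷_; updateAt; lookup)
open import Data.Vec.Properties using (updateAt-updateAt; updateAt-id-local; updateAt-commutes; updateAt-cong; lookup∘updateAt; lookup∘updateAt′)
  renaming (≡-dec to Vec-≡-dec)
open import Function using (_∘_; id)
open import Function.Bundles using (mk⇔)
open import Relation.Binary.Definitions using (DecidableEquality)
open import Relation.Binary.PropositionalEquality
open import Relation.Nullary using (¬_; Dec; yes; no; does; ¬?)
open import Relation.Unary using (Decidable)
open import Algebra.Properties.Group (AbelianGroup.group ℤ.+-0-abelianGroup) using (x∙y⁻¹≈ε⇒x≈y) renaming (∙-cancelˡ to ℤ+-cancelˡ)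

-- Finite sums and counting

-- The final stage alone yields the main term n / (2d), so everything else must fit into O(n r (log
-- d)^(3/2) / d^(3/2)) bits. A walk costs log d bits per step, which dictates the size allowed to U.
-- Points of boundary degree at least t number O(n / t); dominating the points with many such
-- neighbours takes O(n log d / (d t)) of them, while the hubs outside T number O(n t / d²). The two
-- balance at t = √(d log d).
--
-- The O(dL) mixed vertices left near the walk are too many to be read off singly. Revealing works
-- because the two answers are unequal: a positive one is almost free, O(dL) of them costing a
-- factor 4^O(L), and a negative one forces a whole neighbourhood into the cover. Negative answers
-- number at most (unknown cover vertices) / (threshold). At threshold d this is O(dL) / d = O(L).
-- The degree bound d so gained limits the unknown cover vertices to n / d, and only then is the
-- threshold √d affordable, with n / d^(3/2) negative answers.

ind : Bool → ℕ
ind true  = 1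
ind false = 0

∑ : {A : Set} → List A → (A → ℕ) → ℕ
∑ []       f = 0
∑ (x ∷ xs) f = f x + ∑ xs f

count : {A : Set} → (A → Bool) → List A → ℕ
count p xs = ∑ xs (ind ∘ p)

sel : {A : Set} → (A → Bool) → List A → List A
sel p = filter (λ x → p x ≟ᵇ true)

∑-mono : {A : Set} (xs : List A) {f g : A → ℕ} → (∀ {x} → x ∈ xs → f x ≤ g x) → ∑ xs f ≤ ∑ xs g
∑-mono []       h = z≤n
∑-mono (x ∷ xs) h = +-mono-≤ (h (here refl)) (∑-mono xs (h ∘ there))

∑-cong : {A : Set} (xs : List A) {f g : A → ℕ} → (∀ x → f x ≡ g x) → ∑ xs f ≡ ∑ xs g
∑-cong []       h = refl
∑-cong (x ∷ xs) h = cong₂ _+_ (h x) (∑-cong xs h)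

+-interchange : ∀ a b c e → (a + b) + (c + e) ≡ (a + c) + (b + e)
+-interchange a b c e = begin
  (a + b) + (c + e) ≡⟨ +-assoc a b (c + e) ⟩
  a + (b + (c + e)) ≡⟨ cong (a +_) (sym (+-assoc b c e)) ⟩
  a + ((b + c) + e) ≡⟨ cong (λ z → a + (z + e)) (+-comm b c) ⟩
  a + ((c + b) + e) ≡⟨ cong (a +_) (+-assoc c b e) ⟩
  a + (c + (b + e)) ≡⟨ sym (+-assoc a c (b + e)) ⟩
  (a + c) + (b + e) ∎ where open ≡-Reasoning

∑-+ : {A : Set} (xs : List A) (f g : A → ℕ) → ∑ xs (λ x → f x + g x) ≡ ∑ xs f + ∑ xs g
∑-+ []       f g = refl
∑-+ (x ∷ xs) f g = trans (cong (f x + g x +_) (∑-+ xs f g)) (+-interchange (f x) (g x) _ _)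

∑-* : {A : Set} (k : ℕ) (xs : List A) (f : A → ℕ) → ∑ xs (λ x → k * f x) ≡ k * ∑ xs f
∑-* k []       f = sym (*-zeroʳ k)
∑-* k (x ∷ xs) f = trans (cong (k * f x +_) (∑-* k xs f)) (sym (*-distribˡ-+ k (f x) _))

∑-const : {A : Set} (xs : List A) (k : ℕ) → ∑ xs (λ _ → k) ≡ length xs * k
∑-const []       k = refl
∑-const (x ∷ xs) k = cong (k +_) (∑-const xs k)

∑-≤-const : {A : Set} (xs : List A) {f : A → ℕ} {k : ℕ} → (∀ {x} → x ∈ xs → f x ≤ k) → ∑ xs f ≤ length xs * k
∑-≤-const xs {k = k} h = ≤-trans (∑-mono xs h) (≤-reflexive (∑-const xs k))

∑-≥-const : {A : Set} (xs : List A) {f : A → ℕ} {k : ℕ} → (∀ {x} → x ∈ xs → k ≤ f x) → length xs * k ≤ ∑ xs f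
∑-≥-const xs {k = k} h = ≤-trans (≤-reflexive (sym (∑-const xs k))) (∑-mono xs h)

∑-swap : {A B : Set} (xs : List A) (ys : List B) (f : A → B → ℕ) →
  ∑ xs (λ x → ∑ ys (f x)) ≡ ∑ ys (λ y → ∑ xs (λ x → f x y))
∑-swap []       ys f = sym (trans (∑-const ys 0) (*-zeroʳ (length ys)))
∑-swap (x ∷ xs) ys f = trans (cong (∑ ys (f x) +_) (∑-swap xs ys f)) (sym (∑-+ ys (f x) _))

∑-++ : {A : Set} (xs ys : List A) (f : A → ℕ) → ∑ (xs ++ ys) f ≡ ∑ xs f + ∑ ys f
∑-++ []       ys f = refl
∑-++ (x ∷ xs) ys f = trans (cong (f x +_) (∑-++ xs ys f)) (sym (+-assoc (f x) _ _))

∑-map : {A B : Set} (g : A → B) (xs : List A) (f : B → ℕ) → ∑ (map g xs) f ≡ ∑ xs (f ∘ g)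
∑-map g []       f = refl
∑-map g (x ∷ xs) f = cong (f (g x) +_) (∑-map g xs f)

term≤∑ : {A : Set} {xs : List A} {x : A} (f : A → ℕ) → x ∈ xs → f x ≤ ∑ xs f
term≤∑ f (here refl) = m≤m+n _ _
term≤∑ f (there m)   = ≤-trans (term≤∑ f m) (m≤n+m _ _)

count-true : {A : Set} (xs : List A) → count (λ _ → true) xs ≡ length xs
count-true xs = trans (∑-const xs 1) (*-identityʳ (length xs))

count≤length : {A : Set} (p : A → Bool) (xs : List A) → count p xs ≤ length xs
count≤length p xs = ≤-trans (∑-mono xs (λ {x} _ → ind≤1 (p x))) (≤-reflexive (count-true xs))
  where
  ind≤1 : ∀ b → ind b ≤ 1
  ind≤1 true  = ≤-refl
  ind≤1 false = z≤n

count-complement : {A : Set} (p : A → Bool) (xs : List A) → count p xs + count (not ∘ p) xs ≡ length xs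
count-complement p xs = trans (sym (∑-+ xs _ _)) (trans (∑-cong xs (λ x → one (p x))) (count-true xs))
  where
  one : ∀ b → ind b + ind (not b) ≡ 1
  one true  = refl
  one false = refl

ind-mono : ∀ {a b} → (a ≡ true → b ≡ true) → ind a ≤ ind b
ind-mono {false}        h = z≤n
ind-mono {true} {true}  h = ≤-refl
ind-mono {true} {false} h with () ← h refl

count-mono : {A : Set} (xs : List A) {p q : A → Bool} → (∀ {x} → x ∈ xs → p x ≡ true → q x ≡ true) → count p xs ≤ count q xs
count-mono xs h = ∑-mono xs (λ m → ind-mono (h m))

count-++ : {A : Set} (p : A → Bool) (xs ys : List A) → count p (xs ++ ys) ≡ count p xs + count p ys
count-++ p xs ys = ∑-++ xs ys (ind ∘ p)

length-sel : {A : Set} (p : A → Bool) (xs : List A) → length (sel p xs) ≡ count p xs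
length-sel p []       = refl
length-sel p (x ∷ xs) with p x
... | true  = cong suc (length-sel p xs)
... | false = length-sel p xs

sel⁺ : {A : Set} (p : A → Bool) (xs : List A) {x : A} → x ∈ xs → p x ≡ true → x ∈ sel p xs
sel⁺ p xs = ∈-filter⁺ (λ x → p x ≟ᵇ true)

sel⁻ : {A : Set} (p : A → Bool) (xs : List A) {x : A} → x ∈ sel p xs → x ∈ xs × p x ≡ true
sel⁻ p xs = ∈-filter⁻ (λ x → p x ≟ᵇ true)

sel-unique : {A : Set} (p : A → Bool) {xs : List A} → Unique xs → Unique (sel p xs)
sel-unique p = Unique.filter⁺ (λ x → p x ≟ᵇ true)

count-split : {A : Set} (p q : A → Bool) (xs : List A) →
  count p xs ≡ count (λ x → p x ∧ q x) xs + count (λ x → p x ∧ not (q x)) xs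
count-split p q xs = trans (∑-cong xs (λ x → one (p x) (q x))) (∑-+ xs _ _)
  where
  one : ∀ a b → ind a ≡ ind (a ∧ b) + ind (a ∧ not b)
  one true  true  = refl
  one true  false = refl
  one false b     = refl

count⇒∃ : {A : Set} (p : A → Bool) (xs : List A) → 0 < count p xs → ∃ λ x → x ∈ xs × p x ≡ true
count⇒∃ p (x ∷ xs) h with p x in eq
... | true  = x , here refl , eq
... | false with count⇒∃ p xs h
... | y , m , e = y , there m , e

∃⇒count : {A : Set} (p : A → Bool) {xs : List A} {x : A} → x ∈ xs → p x ≡ true → 0 < count p xs
∃⇒count p {xs} {x} m e = ≤-trans (subst (λ b → 1 ≤ ind b) (sym e) ≤-refl) (term≤∑ (ind ∘ p) m)

any? : {A : Set} (p : A → Bool) (xs : List A) → (∃ λ x → x ∈ xs × p x ≡ true) ⊎ (∀ {x} → x ∈ xs → p x ≡ false)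
any? p []       = inj₂ λ ()
any? p (x ∷ xs) with p x in eq
... | true = inj₁ (x , here refl , eq)
... | false with any? p xs
... | inj₁ (y , m , e) = inj₁ (y , there m , e)
... | inj₂ h = inj₂ λ { (here refl) → eq ; (there m) → h m }

-- An injection given as a relation. The occurrence of the witness is deleted from Y, and
-- injectivity keeps the witnesses of later points in the remainder; Y may therefore contain
-- repetitions.
count-rel : {A B : Set} {X : List A} {Y : List B} (R : A → B → Set) {b : A → Bool} {c : B → Bool} → Unique X →
  (∀ {x} → x ∈ X → b x ≡ true → ∃ λ y → y ∈ Y × c y ≡ true × R x y) →
  (∀ {x x' y} → R x y → R x' y → x ≡ x') → count b X ≤ count c Y
count-rel {X = []} R u w inj = z≤n
count-rel {X = x ∷ X} R {b} {c} (nx ∷ u) w inj with b x in eq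
... | false = count-rel R u (w ∘ there) inj
... | true with w (here refl) eq
... | y , y∈ , cy , rxy with ∈-∃++ y∈
... | Y₁ , Y₂ , refl = begin
  suc (count b X)                    ≤⟨ s≤s (count-rel R u w' inj) ⟩
  suc (count c (Y₁ ++ Y₂))           ≡⟨ cong suc (count-++ c Y₁ Y₂) ⟩
  suc (count c Y₁ + count c Y₂)      ≡⟨ sym (+-suc (count c Y₁) (count c Y₂)) ⟩
  count c Y₁ + suc (count c Y₂)      ≡⟨ cong (λ z → count c Y₁ + (ind z + count c Y₂)) (sym cy) ⟩
  count c Y₁ + count c (y ∷ Y₂)      ≡⟨ sym (count-++ c Y₁ (y ∷ Y₂)) ⟩
  count c (Y₁ ++ y ∷ Y₂)             ∎
  where
  open ≤-Reasoning
  w' : ∀ {x'} → x' ∈ X → b x' ≡ true → ∃ λ z → z ∈ Y₁ ++ Y₂ × c z ≡ true × R x' z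
  w' x'∈ bx' with w (there x'∈) bx'
  ... | z , z∈ , cz , rz with ∈-++⁻ Y₁ z∈
  ... | inj₁ m = z , ∈-++⁺ˡ m , cz , rz
  ... | inj₂ (there m) = z , ∈-++⁺ʳ Y₁ m , cz , rz
  ... | inj₂ (here refl) = ⊥-elim (All.lookup nx x'∈ (inj rxy rz))

unique-⊆-length : {A : Set} {X Y : List A} → Unique X → (∀ {x} → x ∈ X → x ∈ Y) → length X ≤ length Y
unique-⊆-length {X = X} {Y} u h = subst₂ _≤_ (count-true X) (count-true Y)
  (count-rel _≡_ u (λ m _ → _ , h m , refl , refl) (λ p q → trans p (sym q)))

-- The lattice ℤ^d

Dir : ℕ → Set
Dir d = Fin d × Bool

off : Bool → ℤ
off true  = pos 1
off false = -[1+ 0 ]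

mv : ∀ {d} → Dir d → Point d → Point d
mv (i , b) x = updateAt x i (ℤ._+ off b)

opp : ∀ {d} → Dir d → Dir d
opp (i , b) = i , not b

abstract
  dirs : ∀ d → List (Dir d)
  dirs d = cartesianProduct (allFin d) (true ∷ false ∷ [])

  neighbours-dirs : ∀ {d} (x : Point d) → neighbours x ≡ map (λ δ → mv δ x) (dirs d)
  neighbours-dirs {d} x = go (allFin d)
    where
    go : ∀ is → concatMap (λ i → updateAt x i (ℤ._+ ℤ.+ 1) ∷ updateAt x i (ℤ._- ℤ.+ 1) ∷ []) is
              ≡ map (λ δ → mv δ x) (cartesianProduct is (true ∷ false ∷ []))
    go []       = refl
    go (i ∷ is) = cong (λ z → mv (i , true) x ∷ mv (i , false) x ∷ z) (go is)

  ∈-dirs : ∀ {d} (δ : Dir d) → δ ∈ (dirs d)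
  ∈-dirs (i , true)  = ∈-cartesianProduct⁺ (∈-allFin i) (here refl)
  ∈-dirs (i , false) = ∈-cartesianProduct⁺ (∈-allFin i) (there (here refl))

  dirs-unique : ∀ {d} → Unique (dirs d)
  dirs-unique {d} = Unique.cartesianProduct⁺ (Unique.allFin⁺ d) (((λ ()) ∷ []) ∷ [] ∷ [])

  length-dirs : ∀ d → length (dirs d) ≡ 2 * d
  length-dirs d = trans (go (allFin d)) (cong (2 *_) (length-tabulate (id {A = Fin d})))
    where
    go : ∀ (is : List (Fin d)) → length (cartesianProduct is (true ∷ false ∷ [])) ≡ 2 * length is
    go []       = refl
    go (i ∷ is) = trans (cong (2 +_) (go is)) (sym (*-suc 2 (length is)))

opp-opp : ∀ {d} (δ : Dir d) → opp (opp δ) ≡ δ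
opp-opp (i , b) = cong (i ,_) (Bool.not-involutive b)

+off-off : ∀ b a → a ℤ.+ off b ℤ.+ off (not b) ≡ a
+off-off b a = trans (ℤ.+-assoc a (off b) (off (not b))) (trans (cong (λ z → a ℤ.+ z) (cancel b)) (ℤ.+-identityʳ a))
  where
  cancel : ∀ b → off b ℤ.+ off (not b) ≡ pos 0
  cancel true  = refl
  cancel false = refl

mv-opp : ∀ {d} (δ : Dir d) (x : Point d) → mv (opp δ) (mv δ x) ≡ x
mv-opp (i , b) x = trans (updateAt-updateAt i x) (updateAt-id-local i x (+off-off b (lookup x i)))

mv-injective : ∀ {d} (δ : Dir d) {x y : Point d} → mv δ x ≡ mv δ y → x ≡ y
mv-injective δ {x} {y} e = trans (sym (mv-opp δ x)) (trans (cong (mv (opp δ)) e) (mv-opp δ y))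

mv-comm : ∀ {d} (δ ε : Dir d) (x : Point d) → mv δ (mv ε x) ≡ mv ε (mv δ x)
mv-comm (i , b) (j , c) x with i Fin.≟ j
... | no i≢j = updateAt-commutes i j i≢j x
... | yes refl = trans (updateAt-updateAt i x)
      (trans (updateAt-cong i (λ a → trans (ℤ.+-assoc a (off c) (off b)) (trans (cong (λ z → a ℤ.+ z) (ℤ.+-comm (off c) (off b))) (sym (ℤ.+-assoc a (off b) (off c))))) x)
      (sym (updateAt-updateAt i x)))

_≟ᴾ_ : ∀ {d} → DecidableEquality (Point d)
_≟ᴾ_ = Vec-≡-dec ℤ._≟_

shift : ∀ {d} → ℕ → Dir d → Point d → Point d
shift zero    δ x = x
shift (suc k) δ x = shift k δ (mv δ x)

mv-shift : ∀ {d} k (δ ε : Dir d) (x : Point d) → mv ε (shift k δ x) ≡ shift k δ (mv ε x)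
mv-shift zero    δ ε x = refl
mv-shift (suc k) δ ε x = trans (mv-shift k δ ε (mv δ x)) (cong (shift k δ) (mv-comm ε δ x))

unit : ∀ {d} → Dir d → Fin d → ℤ
unit (i , b) j with i Fin.≟ j
... | yes _ = off b
... | no  _ = pos 0

unit-axis : ∀ {d} (i : Fin d) b → unit (i , b) i ≡ off b
unit-axis i b with i Fin.≟ i
... | yes _  = refl
... | no i≢i = ⊥-elim (i≢i refl)

unit-off-axis : ∀ {d} (i j : Fin d) b → i ≢ j → unit (i , b) j ≡ pos 0
unit-off-axis i j b i≢j with i Fin.≟ j
... | yes e = ⊥-elim (i≢j e)
... | no _  = refl

lookup-mv : ∀ {d} (δ : Dir d) x j → lookup (mv δ x) j ≡ lookup x j ℤ.+ unit δ j
lookup-mv (i , b) x j with i Fin.≟ j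
... | yes refl = lookup∘updateAt i x
... | no i≢j   = trans (lookup∘updateAt′ j i (i≢j ∘ sym) x) (sym (ℤ.+-identityʳ _))

lookup-shift : ∀ {d} k (δ : Dir d) x j → lookup (shift k δ x) j ≡ lookup x j ℤ.+ (pos k) ℤ.* unit δ j
lookup-shift zero    δ x j = sym (trans (cong (λ z → lookup x j ℤ.+ z) (ℤ.*-zeroˡ (unit δ j))) (ℤ.+-identityʳ _))
lookup-shift (suc k) δ x j = begin
  lookup (shift k δ (mv δ x)) j                       ≡⟨ lookup-shift k δ (mv δ x) j ⟩
  lookup (mv δ x) j ℤ.+ (pos k) ℤ.* unit δ j            ≡⟨ cong (ℤ._+ (pos k) ℤ.* unit δ j) (lookup-mv δ x j) ⟩
  lookup x j ℤ.+ unit δ j ℤ.+ (pos k) ℤ.* unit δ j      ≡⟨ ℤ.+-assoc (lookup x j) _ _ ⟩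
  lookup x j ℤ.+ (unit δ j ℤ.+ (pos k) ℤ.* unit δ j)    ≡⟨ cong (λ z → lookup x j ℤ.+ z) (sym (ℤ.suc-* (pos k) (unit δ j))) ⟩
  lookup x j ℤ.+ pos (suc k) ℤ.* unit δ j               ∎
  where open ≡-Reasoning

off-injective : ∀ {b c} → off b ≡ off c → b ≡ c
off-injective {true}  {true}  e = refl
off-injective {false} {false} e = refl

*off-injective : ∀ {j k} b → (pos j) ℤ.* off b ≡ (pos k) ℤ.* off b → j ≡ k
*off-injective {j} {k} true  e = ℤ.+-injective (ℤ.*-cancelʳ-≡ (pos j) (pos k) (pos 1) e)
*off-injective {j} {k} false e = ℤ.+-injective (ℤ.*-cancelʳ-≡ (pos j) (pos k) -[1+ 0 ] e)

shift-injective : ∀ {d} (δ : Dir d) {j k} x → shift j δ x ≡ shift k δ x → j ≡ k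
shift-injective (i , b) {j} {k} x e = *off-injective b
  (subst (λ u → (pos j) ℤ.* u ≡ (pos k) ℤ.* u) (unit-axis i b)
    (ℤ+-cancelˡ (lookup x i) _ _ (trans (sym (lookup-shift j (i , b) x i))
      (trans (cong (λ z → lookup z i) e) (lookup-shift k (i , b) x i)))))

unit-injective : ∀ {d} {m m' : Fin d} {s s'} → unit (m , s) m ≡ unit (m' , s') m → (m , s) ≡ (m' , s')
unit-injective {m = m} {m'} {s} {s'} h with m' Fin.≟ m
... | no ne    = ⊥-elim (off≢0 s (trans (sym (unit-axis m s)) h))
  where
  off≢0 : ∀ b → off b ≢ pos 0
  off≢0 true ()
  off≢0 false ()
... | yes refl = cong (m ,_) (off-injective (trans (sym (unit-axis m s)) h))

mv-dir-injective : ∀ {d} (ε ε' : Dir d) x → mv ε x ≡ mv ε' x → ε ≡ ε'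
mv-dir-injective ε@(m , s) ε' x e = unit-injective (ℤ+-cancelˡ (lookup x m) _ _
  (trans (sym (lookup-mv ε x m)) (trans (cong (λ z → lookup z m) e) (lookup-mv ε' x m))))

-- Moving along δ changes only the coordinate on its axis, so an off-axis ε can be read off from any
-- point of its line. On the axis, x + δ and x - δ share a line; excluding δ leaves only `opp δ`.
lines-disjoint : ∀ {d} (δ ε ε' : Dir d) {j k} x → ε ≢ δ → ε' ≢ δ →
  shift j δ (mv ε x) ≡ shift k δ (mv ε' x) → ε ≡ ε'
lines-disjoint δ@(i , b) ε@(a , c) ε'@(a' , c') {j} {k} x ε≢ ε'≢ e = main
  where
  coord : ∀ m → unit ε m ℤ.+ (pos j) ℤ.* unit δ m ≡ unit ε' m ℤ.+ (pos k) ℤ.* unit δ m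
  coord m = ℤ+-cancelˡ (lookup x m) _ _ (trans (sym (ℤ.+-assoc (lookup x m) _ _)) (trans (trans (sym (one ε j)) (trans (cong (λ z → lookup z m) e) (one ε' k))) (ℤ.+-assoc (lookup x m) _ _)))
    where
    one : ∀ η n → lookup (shift n δ (mv η x)) m ≡ lookup x m ℤ.+ unit η m ℤ.+ (pos n) ℤ.* unit δ m
    one η n = trans (lookup-shift n δ (mv η x) m) (cong (ℤ._+ (pos n) ℤ.* unit δ m) (lookup-mv η x m))
  coord′ : ∀ m → i ≢ m → unit ε m ≡ unit ε' m
  coord′ m i≢m = trans (sym (kill j (unit ε m))) (trans (coord m) (kill k (unit ε' m)))
    where
    kill : ∀ n u → u ℤ.+ (pos n) ℤ.* unit δ m ≡ u
    kill n u = trans (cong (λ z → u ℤ.+ (pos n) ℤ.* z) (unit-off-axis i m b i≢m)) (trans (cong (λ z → u ℤ.+ z) (ℤ.*-zeroʳ (pos n))) (ℤ.+-identityʳ u))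
  main : ε ≡ ε'
  main with i Fin.≟ a | i Fin.≟ a'
  ... | no ne    | _        = unit-injective (coord′ a ne)
  ... | yes _    | no ne    = sym (unit-injective (sym (coord′ a' ne)))
  ... | yes refl | yes refl = cong (i ,_) (two b c c' (λ p → ε≢ (cong (i ,_) p)) (λ p → ε'≢ (cong (i ,_) p)))
    where
    two : ∀ b c c' → c ≢ b → c' ≢ b → c ≡ c'
    two true  true  c'    p q = ⊥-elim (p refl)
    two true  false true  p q = ⊥-elim (q refl)
    two true  false false p q = refl
    two false false c'    p q = ⊥-elim (p refl)
    two false true  false p q = ⊥-elim (q refl)
    two false true  true  p q = refl

parallel-lines-disjoint : ∀ {d} (i i' : Fin d) b b' {j j' k k'} x → i ≢ i' →
  shift k (i' , b') (shift j (i , b) x) ≡ shift k' (i' , b') (shift j' (i , b) x) → j ≡ j'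
parallel-lines-disjoint i i' b b' {j} {j'} {k} {k'} x i≢ e = *off-injective b
  (subst (λ u → (pos j) ℤ.* u ≡ (pos j') ℤ.* u) (unit-axis i b)
    (ℤ+-cancelˡ (lookup x i) _ _ (trans (sym (one j k)) (trans (cong (λ z → lookup z i) e) (one j' k')))))
  where
  one : ∀ j k → lookup (shift k (i' , b') (shift j (i , b) x)) i ≡ lookup x i ℤ.+ (pos j) ℤ.* unit (i , b) i
  one j k = trans (lookup-shift k (i' , b') (shift j (i , b) x) i)
    (trans (cong (λ z → lookup (shift j (i , b) x) i ℤ.+ (pos k) ℤ.* z) (unit-off-axis i' i b' (i≢ ∘ sym)))
    (trans (cong (λ z → lookup (shift j (i , b) x) i ℤ.+ z) (ℤ.*-zeroʳ (pos k))) (trans (ℤ.+-identityʳ _) (lookup-shift j (i , b) x i))))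

dist-sym : ∀ {d} (x y : Point d) → dist x y ≡ dist y x
dist-sym []      []      = refl
dist-sym (a ∷ x) (b ∷ y) = cong₂ _+_ (ℤ.∣i-j∣≡∣j-i∣ a b) (dist-sym x y)

dist-refl : ∀ {d} (x : Point d) → dist x x ≡ 0
dist-refl []      = refl
dist-refl (a ∷ x) = cong₂ _+_ (cong ∣_∣ (ℤ.+-inverseʳ a)) (dist-refl x)

dist-triangle : ∀ {d} (x y z : Point d) → dist x z ≤ dist x y + dist y z
dist-triangle []      []      []      = z≤n
dist-triangle (a ∷ x) (b ∷ y) (c ∷ z) = begin
  ∣ a ℤ.- c ∣ + dist x z                                     ≤⟨ +-mono-≤ (abs a b c) (dist-triangle x y z) ⟩
  (∣ a ℤ.- b ∣ + ∣ b ℤ.- c ∣) + (dist x y + dist y z)        ≡⟨ +-interchange ∣ a ℤ.- b ∣ _ _ _ ⟩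
  (∣ a ℤ.- b ∣ + dist x y) + (∣ b ℤ.- c ∣ + dist y z)        ∎
  where
  open ≤-Reasoning
  abs : ∀ a b c → ∣ a ℤ.- c ∣ ≤ ∣ a ℤ.- b ∣ + ∣ b ℤ.- c ∣
  abs a b c = subst (λ w → ∣ w ∣ ≤ ∣ a ℤ.- b ∣ + ∣ b ℤ.- c ∣) (ℤ.+-minus-telescope a b c) (ℤ.∣i+j∣≤∣i∣+∣j∣ (a ℤ.- b) (b ℤ.- c))

dist-zero : ∀ {d} (x y : Point d) → dist x y ≡ 0 → x ≡ y
dist-zero []      []      e = refl
dist-zero (a ∷ x) (b ∷ y) e = cong₂ _∷_ (x∙y⁻¹≈ε⇒x≈y a b (ℤ.∣i∣≡0⇒i≡0 (m+n≡0⇒m≡0 _ e))) (dist-zero x y (m+n≡0⇒n≡0 ∣ a ℤ.- b ∣ e))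

dist-mv : ∀ {d} (δ : Dir d) x → dist x (mv δ x) ≡ 1
dist-mv (fzero  , b) (a ∷ x) = cong₂ _+_ (one b) (dist-refl x)
  where
  lem : ∀ u → a ℤ.- (a ℤ.+ u) ≡ ℤ.- u
  lem u = trans (cong (λ z → a ℤ.+ z) (ℤ.neg-distrib-+ a u)) (trans (sym (ℤ.+-assoc a _ _)) (trans (cong (ℤ._+ ℤ.- u) (ℤ.+-inverseʳ a)) (ℤ.+-identityˡ _)))
  one : ∀ b → ∣ a ℤ.- (a ℤ.+ off b) ∣ ≡ 1
  one true  = cong ∣_∣ (lem (pos 1))
  one false = cong ∣_∣ (lem -[1+ 0 ])
dist-mv (fsuc i , b) (a ∷ x) = cong₂ _+_ (cong ∣_∣ (ℤ.+-inverseʳ a)) (dist-mv (i , b) x)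

toward : ∀ {d k} (x y : Point d) → dist x y ≡ suc k → ∃ λ δ → dist (mv δ x) y ≡ k
toward [] [] ()
toward {suc d} {k} (a ∷ x) (b ∷ y) e with ∣ a ℤ.- b ∣ in eq
... | zero with toward x y e
... | (i , s) , h = (fsuc i , s) , trans (cong (_+ dist (mv (i , s) x) y) eq) h
toward {suc d} {k} (a ∷ x) (b ∷ y) e | suc m = (fzero , proj₁ (nearer (a ℤ.- b) eq)) ,
  trans (cong (λ z → ∣ z ∣ + dist x y) (trans (ℤ.+-assoc a _ _) (trans (cong (λ z → a ℤ.+ z) (ℤ.+-comm _ (ℤ.- b))) (sym (ℤ.+-assoc a _ _)))))
    (trans (cong (_+ dist x y) (proj₂ (nearer (a ℤ.- b) eq))) (suc-injective e))
  where
  nearer : ∀ c {m} → ∣ c ∣ ≡ suc m → ∃ λ s → ∣ c ℤ.+ off s ∣ ≡ m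
  nearer (pos (suc m))       refl = false , refl
  nearer -[1+ zero ]     refl = true , refl
  nearer -[1+ suc m ]    refl = true , refl

adj⇒mv : ∀ {d} (x y : Point d) → Adj x y → ∃ λ δ → y ≡ mv δ x
adj⇒mv x y e with toward x y e
... | δ , h = δ , sym (dist-zero (mv δ x) y h)

-- Parity of lattice points

oddᵇ : ℕ → Bool
oddᵇ zero    = false
oddᵇ (suc n) = not (oddᵇ n)

oddᵇ-+ : ∀ m n → oddᵇ (m + n) ≡ oddᵇ m xor oddᵇ n
oddᵇ-+ zero    n = refl
oddᵇ-+ (suc m) n = trans (cong not (oddᵇ-+ m n)) (Bool.not-distribˡ-xor (oddᵇ m) (oddᵇ n))

abstract
  par : ∀ {d} → Point d → Bool
  par x = oddᵇ (dist origin x)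

  odd⇒par : ∀ {d} (x : Point d) → OddVertex x → par x ≡ true
  odd⇒par x (k , e) = trans (cong oddᵇ e) (cong not (trans (oddᵇ-+ k (k + 0)) (trans (cong (λ z → oddᵇ k xor oddᵇ z) (+-identityʳ k)) (Bool.xor-same (oddᵇ k)))))

  par-mv : ∀ {d} (δ : Dir d) x → par (mv δ x) ≡ not (par x)
  par-mv (fzero , b) (a ∷ x) = trans (oddᵇ-+ ∣ pos 0 ℤ.- (a ℤ.+ off b) ∣ (dist origin x)) (trans (cong (_xor par x) (trans (flip a b) (cong (not ∘ oddᵇ) (sym (zero- a)))))
     (trans (sym (Bool.not-distribˡ-xor (oddᵇ ∣ pos 0 ℤ.- a ∣) (par x))) (cong not (sym (oddᵇ-+ ∣ pos 0 ℤ.- a ∣ (dist origin x))))))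
    where
    zero- : ∀ a → ∣ pos 0 ℤ.- a ∣ ≡ ∣ a ∣
    zero- a = trans (cong ∣_∣ (ℤ.+-identityˡ (ℤ.- a))) (ℤ.∣-i∣≡∣i∣ a)
    abs : ∀ a b → oddᵇ ∣ a ℤ.+ off b ∣ ≡ not (oddᵇ ∣ a ∣)
    abs (pos n) true = cong oddᵇ (+-comm n 1)
    abs (pos zero) false = refl
    abs (pos (suc n)) false = sym (Bool.not-involutive _)
    abs -[1+ zero ] true = refl
    abs -[1+ suc n ] true = sym (Bool.not-involutive _)
    abs -[1+ n ] false = cong (λ z → not (not (oddᵇ z))) (+-identityʳ n)
    flip : ∀ a b → oddᵇ ∣ pos 0 ℤ.- (a ℤ.+ off b) ∣ ≡ not (oddᵇ ∣ a ∣)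
    flip a b = trans (cong oddᵇ (zero- (a ℤ.+ off b))) (abs a b)
  par-mv (fsuc i , b) (a ∷ x) = trans (oddᵇ-+ ∣ pos 0 ℤ.- a ∣ _) (trans (cong (oddᵇ ∣ pos 0 ℤ.- a ∣ xor_) (par-mv (i , b) x))
    (trans (sym (Bool.not-distribʳ-xor (oddᵇ ∣ pos 0 ℤ.- a ∣) (par x))) (cong not (sym (oddᵇ-+ ∣ pos 0 ℤ.- a ∣ _)))))

∧-true : ∀ {a b} → a ∧ b ≡ true → a ≡ true × b ≡ true
∧-true {true} e = refl , e

∧-true⁺ : ∀ {a b} → a ≡ true → b ≡ true → a ∧ b ≡ true
∧-true⁺ refl e = e

not-true : ∀ {a} → not a ≡ true → a ≡ false
not-true {false} e = refl

true≢false : ∀ {A : Set} {b} → b ≡ true → b ≡ false → A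
true≢false refl ()

_≟ᴰ_ : ∀ {d} → DecidableEquality (Dir d)
_≟ᴰ_ = Prod.≡-dec Fin._≟_ _≟ᵇ_

count-opp : ∀ {d} (p : Dir d → Bool) → count (p ∘ opp) (dirs d) ≤ count p (dirs d)
count-opp {d} p = count-rel {Y = dirs d} (λ δ ε → ε ≡ opp δ) {p ∘ opp} {p} dirs-unique
  (λ {δ} _ e → opp δ , ∈-dirs _ , e , refl)
  (λ {δ} {δ'} e e' → trans (sym (opp-opp δ)) (trans (cong opp (trans (sym e) e')) (opp-opp δ')))

-- Directed edges are reversed: for a fixed δ the translation is injective, and `opp` permutes the
-- directions.
double-count : ∀ {d} {X Y : List (Point d)} (b c : Point d → Dir d → Bool) → Unique X →
  (∀ {x} δ → x ∈ X → b x δ ≡ true → mv δ x ∈ Y × c (mv δ x) (opp δ) ≡ true) →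
  ∑ X (λ x → count (b x) (dirs d)) ≤ ∑ Y (λ y → count (c y) (dirs d))
double-count {d} {X} {Y} b c uX h = begin
  ∑ X (λ x → count (b x) (dirs d))                    ≡⟨ ∑-swap X (dirs d) (λ x δ → ind (b x δ)) ⟩
  ∑ (dirs d) (λ δ → count (λ x → b x δ) X)            ≤⟨ ∑-mono (dirs d) (λ {δ} _ → per δ) ⟩
  ∑ (dirs d) (λ δ → count (λ y → c y (opp δ)) Y)      ≡⟨ ∑-swap (dirs d) Y (λ δ y → ind (c y (opp δ))) ⟩
  ∑ Y (λ y → count (c y ∘ opp) (dirs d))              ≤⟨ ∑-mono Y (λ {y} _ → count-opp {d} (c y)) ⟩
  ∑ Y (λ y → count (c y) (dirs d))                    ∎
  where
  open ≤-Reasoning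
  per : ∀ δ → count (λ x → b x δ) X ≤ count (λ y → c y (opp δ)) Y
  per δ = count-rel (λ x y → y ≡ mv δ x) uX
    (λ x∈ e → _ , proj₁ (h δ x∈ e) , proj₂ (h δ x∈ e) , refl)
    (λ e e' → mv-injective δ (trans (sym e) e'))

-- Edge boundaries of finite regions, by shooting rays

module Region {d : ℕ} (p : Point d → Bool) (P : List (Point d)) (p⇒P : ∀ {x} → p x ≡ true → x ∈ P) where

  -- A ray that stayed in the region would put `length P + 1` distinct points into P.
  leave : ∀ δ z → p z ≡ true →
    ∃ λ j → (∀ {i} → i ≤ j → p (shift i δ z) ≡ true) × p (mv δ (shift j δ z)) ≡ false
  leave δ z pz with run (length P)
    where
    run : ∀ K → (∃ λ j → (∀ {i} → i ≤ j → p (shift i δ z) ≡ true) × p (mv δ (shift j δ z)) ≡ false)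
              ⊎ (∀ {i} → i ≤ K → p (shift i δ z) ≡ true)
    run zero = inj₂ λ { z≤n → pz }
    run (suc K) with run K
    ... | inj₁ r = inj₁ r
    ... | inj₂ h with p (mv δ (shift K δ z)) in eq
    ... | false = inj₁ (K , h , eq)
    ... | true  = inj₂ h'
      where
      h' : ∀ {i} → i ≤ suc K → p (shift i δ z) ≡ true
      h' {i} i≤ with m≤n⇒m<n∨m≡n i≤
      ... | inj₁ (s≤s i≤K) = h i≤K
      ... | inj₂ refl      = trans (cong p (sym (mv-shift K δ δ z))) eq
  ... | inj₁ r = r
  ... | inj₂ h = ⊥-elim (<-irrefl refl (subst (_≤ length P)
        (trans (length-map _ (upTo (suc (length P)))) (length-upTo (suc (length P))))
        (unique-⊆-length (Unique.map⁺ (λ {j} {k} → shift-injective δ {j} {k} z) (Unique.upTo⁺ (suc (length P)))) mem)))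
    where
    mem : ∀ {y} → y ∈ map (λ i → shift i δ z) (upTo (suc (length P))) → y ∈ P
    mem m with ∈-map⁻ _ m
    ... | i , i∈ , refl with ∈-upTo⁻ i∈
    ... | s≤s i≤ = p⇒P (h i≤)

  -- Each point of Z shoots a ray in direction δ, and the ray exits through a boundary edge. The
  -- points lie on different lines, so their exits are different.
  rays : ∀ δ (Z : List (Point d)) → Unique Z → (∀ {z} → z ∈ Z → p z ≡ true) →
    (∀ {z z'} j k → z ∈ Z → z' ∈ Z → shift j δ z ≡ shift k δ z' → z ≡ z') →
    length Z ≤ count (λ y → p y ∧ not (p (mv δ y))) P
  rays δ Z uZ pZ lines = subst (_≤ _) (count-true Z)
    (count-rel (λ z y → z ∈ Z × ∃ λ j → y ≡ shift j δ z) uZ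
      (λ {z} z∈ _ → let (j , in-p , out) = leave δ z (pZ z∈) in
        shift j δ z , p⇒P (in-p ≤-refl) , ∧-true⁺ (in-p ≤-refl) (cong not out) , z∈ , j , refl)
      (λ { (z∈ , j , e) (z'∈ , k , e') → lines j k z∈ z'∈ (trans (sym e) e') }))

  boundary : ℕ
  boundary = ∑ P (λ y → count (λ δ → p y ∧ not (p (mv δ y))) (dirs d))

  boundary-dirs : boundary ≡ ∑ (dirs d) (λ δ → count (λ y → p y ∧ not (p (mv δ y))) P)
  boundary-dirs = ∑-swap P (dirs d) (λ y δ → ind (p y ∧ not (p (mv δ y))))

  -- For each of the 2d directions δ, the neighbours of x in the region other than x + δ lie on
  -- different lines parallel to δ. There are at least d - 1 of them, and 2d (d - 1) ≥ d².
  isoperimetry : ∀ x → 2 ≤ d → d ≤ count (λ ε → p (mv ε x)) (dirs d) → d * d ≤ boundary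
  isoperimetry x d≥2 many = begin
    d * d                 ≤⟨ *-monoʳ-≤ d (arith d d≥2) ⟩
    d * (2 * (d ∸ 1))     ≡⟨ sym (*-assoc d 2 (d ∸ 1)) ⟩
    d * 2 * (d ∸ 1)       ≡⟨ cong (_* (d ∸ 1)) (trans (*-comm d 2) (sym (length-dirs d))) ⟩
    length (dirs d) * (d ∸ 1) ≤⟨ ∑-≥-const (dirs d) (λ {δ} _ → ≤-trans (enough δ) (perδ δ)) ⟩
    ∑ (dirs d) (λ δ → count (λ y → p y ∧ not (p (mv δ y))) P) ≡⟨ sym boundary-dirs ⟩
    boundary ∎
    where
    open ≤-Reasoning
    arith : ∀ d → 2 ≤ d → d ≤ 2 * (d ∸ 1)
    arith (suc (suc e)) (s≤s (s≤s z≤n)) = s≤s (≤-trans (≤-reflexive (sym (+-identityʳ (suc e)))) (m≤n+m (suc e + 0) e))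
    q : Dir d → Dir d → Bool
    q δ ε = p (mv ε x) ∧ not (does (ε ≟ᴰ δ))
    Z : Dir d → List (Point d)
    Z δ = map (λ ε → mv ε x) (sel (q δ) (dirs d))
    q⇒≢ : ∀ δ ε → q δ ε ≡ true → ε ≢ δ
    q⇒≢ δ ε e with ε ≟ᴰ δ
    ... | no ne = ne
    ... | yes _ = true≢false (proj₂ (∧-true {p (mv ε x)} e)) refl
    one : ∀ δ → count (λ ε → p (mv ε x) ∧ does (ε ≟ᴰ δ)) (dirs d) ≤ 1
    one δ = count-rel {Y = δ ∷ []} (λ ε η → ε ≡ η) {c = λ _ → true} dirs-unique
      (λ {ε} _ e → δ , here refl , refl , eq ε (proj₂ (∧-true {p (mv ε x)} e))) (λ a b → trans a (sym b))
      where
      eq : ∀ ε → does (ε ≟ᴰ δ) ≡ true → ε ≡ δ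
      eq ε e with ε ≟ᴰ δ
      ... | yes r = r
    enough : ∀ δ → d ∸ 1 ≤ length (Z δ)
    enough δ = begin
      d ∸ 1                                     ≤⟨ ∸-monoˡ-≤ 1 many ⟩
      count (λ ε → p (mv ε x)) (dirs d) ∸ 1         ≡⟨ cong (_∸ 1) (count-split (λ ε → p (mv ε x)) (λ ε → does (ε ≟ᴰ δ)) (dirs d)) ⟩
      count (λ ε → p (mv ε x) ∧ does (ε ≟ᴰ δ)) (dirs d) + count (q δ) (dirs d) ∸ 1 ≤⟨ ∸-monoˡ-≤ 1 (+-monoˡ-≤ _ (one δ)) ⟩
      count (q δ) (dirs d)                          ≡⟨ sym (length-sel (q δ) (dirs d)) ⟩
      length (sel (q δ) (dirs d))                   ≡⟨ sym (length-map _ (sel (q δ) (dirs d))) ⟩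
      length (Z δ) ∎
    perδ : ∀ δ → length (Z δ) ≤ count (λ y → p y ∧ not (p (mv δ y))) P
    perδ δ = rays δ (Z δ) (Unique.map⁺ (λ {ε} {η} → mv-dir-injective ε η x) (sel-unique (q δ) dirs-unique)) inp lines
      where
      inp : ∀ {z} → z ∈ Z δ → p z ≡ true
      inp m with ∈-map⁻ _ m
      ... | ε , ε∈ , refl = proj₁ (∧-true {p (mv ε x)} (proj₂ (sel⁻ (q δ) (dirs d) ε∈)))
      lines : ∀ {z z'} j k → z ∈ Z δ → z' ∈ Z δ → shift j δ z ≡ shift k δ z' → z ≡ z'
      lines j k m m' e with ∈-map⁻ _ m | ∈-map⁻ _ m'
      ... | ε , ε∈ , refl | ε' , ε'∈ , refl = cong (λ η → mv η x)
        (lines-disjoint δ ε ε' {j} {k} x (q⇒≢ δ ε (proj₂ (sel⁻ (q δ) (dirs d) ε∈))) (q⇒≢ δ ε' (proj₂ (sel⁻ (q δ) (dirs d) ε'∈))) e)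

  -- At least 2d - 2 ≥ d directions leave the axis of the segment, and in each of them its D + 1
  -- points lie on different lines.
  straight-run : ∀ (i : Fin d) b x D → 2 ≤ d → (∀ {j} → j ≤ D → p (shift j (i , b) x) ≡ true) →
    suc D * d ≤ boundary
  straight-run i b x D d≥2 inp = begin
    suc D * d                             ≤⟨ *-monoʳ-≤ (suc D) enough ⟩
    suc D * count off-axis (dirs d)           ≡⟨ sym (∑-* (suc D) (dirs d) (ind ∘ off-axis)) ⟩
    ∑ (dirs d) (λ δ → suc D * ind (off-axis δ)) ≤⟨ ∑-mono (dirs d) (λ {δ} _ → perδ δ) ⟩
    ∑ (dirs d) (λ δ → count (λ y → p y ∧ not (p (mv δ y))) P) ≡⟨ sym boundary-dirs ⟩
    boundary ∎
    where
    open ≤-Reasoning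
    on-axis off-axis : Dir d → Bool
    on-axis (j , _) = does (i Fin.≟ j)
    off-axis δ = not (on-axis δ)
    two : count on-axis (dirs d) ≤ 2
    two = count-rel {Y = (i , true) ∷ (i , false) ∷ []} _≡_ {c = λ _ → true} dirs-unique
      (λ {δ} _ e → δ , on δ e , refl , refl) (λ a b → trans a (sym b))
      where
      on : ∀ δ → on-axis δ ≡ true → δ ∈ (i , true) ∷ (i , false) ∷ []
      on (j , s) e with i Fin.≟ j
      on (j , true)  e | yes refl = here refl
      on (j , false) e | yes refl = there (here refl)
    enough : d ≤ count off-axis (dirs d)
    enough = +-cancelˡ-≤ 2 d _ (begin
      2 + d     ≤⟨ +-monoˡ-≤ d d≥2 ⟩
      d + d     ≡⟨ cong (d +_) (sym (+-identityʳ d)) ⟩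
      2 * d     ≡⟨ sym (length-dirs d) ⟩
      length (dirs d) ≡⟨ sym (count-complement on-axis (dirs d)) ⟩
      count on-axis (dirs d) + count off-axis (dirs d) ≤⟨ +-monoˡ-≤ _ two ⟩
      2 + count off-axis (dirs d) ∎)
    Z : List (Point d)
    Z = map (λ j → shift j (i , b) x) (upTo (suc D))
    perδ : ∀ δ → suc D * ind (off-axis δ) ≤ count (λ y → p y ∧ not (p (mv δ y))) P
    perδ (i' , b') with i Fin.≟ i'
    ... | yes _   = ≤-trans (≤-reflexive (*-zeroʳ (suc D))) z≤n
    ... | no i≢i' = begin
      suc D * 1   ≡⟨ *-identityʳ (suc D) ⟩
      suc D       ≡⟨ sym (trans (length-map _ (upTo (suc D))) (length-upTo (suc D))) ⟩
      length Z    ≤⟨ rays (i' , b') Z (Unique.map⁺ (λ {j} {k} → shift-injective (i , b) {j} {k} x) (Unique.upTo⁺ (suc D))) inZ lines ⟩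
      count (λ y → p y ∧ not (p (mv (i' , b') y))) P ∎
      where
      inZ : ∀ {z} → z ∈ Z → p z ≡ true
      inZ m with ∈-map⁻ _ m
      ... | j , j∈ , refl with ∈-upTo⁻ j∈
      ... | s≤s j≤ = inp j≤
      lines : ∀ {z z'} j k → z ∈ Z → z' ∈ Z → shift j (i' , b') z ≡ shift k (i' , b') z' → z ≡ z'
      lines j k m m' e with ∈-map⁻ (λ n → shift n (i , b) x) {xs = upTo (suc D)} m | ∈-map⁻ (λ n → shift n (i , b) x) {xs = upTo (suc D)} m'
      ... | t , _ , refl | t' , _ , refl = cong (λ n → shift n (i , b) x) (parallel-lines-disjoint i i' b b' {t} {t'} {j} {k} x i≢i' e)

walk : ∀ {d} → List (Dir d) → Point d → Point d
walk []      x = x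
walk (δ ∷ w) x = walk w (mv δ x)

visits : ∀ {d} → Point d → List (Dir d) → List (Point d)
visits x []      = x ∷ []
visits x (δ ∷ w) = x ∷ visits (mv δ x) w

length-visits : ∀ {d} (x : Point d) w → length (visits x w) ≡ suc (length w)
length-visits x []      = refl
length-visits x (δ ∷ w) = cong suc (length-visits (mv δ x) w)

geodesic : ∀ {d} k (x y : Point d) → dist x y ≡ k → ∃ λ w → length w ≡ k × walk w x ≡ y
geodesic zero    x y e = [] , refl , dist-zero x y e
geodesic (suc k) x y e with toward x y e
... | δ , h with geodesic k (mv δ x) y h
... | w , l , r = δ ∷ w , cong suc l , r

-- Logarithmic covers and the separating set

count-sel : {A : Set} (p q : A → Bool) (xs : List A) → count p (sel q xs) ≡ count (λ x → q x ∧ p x) xs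
count-sel p q []       = refl
count-sel p q (x ∷ xs) with q x
... | true  = cong (ind (p x) +_) (count-sel p q xs)
... | false = count-sel p q xs

does-true : {P : Set} (P? : Dec P) → does P? ≡ true → P
does-true (yes p) e = p

does-false : {P : Set} (P? : Dec P) → does P? ≡ false → ¬ P
does-false (no ¬p) e = ¬p

choose : {A B : Set} (P : A → B → Set) (xs : List A) → (∀ {x} → x ∈ xs → ∃ (P x)) →
  ∃ λ ys → length ys ≡ length xs × (∀ {y} → y ∈ ys → ∃ λ x → x ∈ xs × P x y) × (∀ {x} → x ∈ xs → ∃ λ y → y ∈ ys × P x y)
choose P []       h = [] , refl , (λ ()) , λ ()
choose P (x ∷ xs) h with choose P xs (h ∘ there) | h (here refl)
... | ys , l , src , tgt | y , p = y ∷ ys , cong suc l , src' , tgt'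
  where
  src' : ∀ {z} → z ∈ y ∷ ys → ∃ λ x' → x' ∈ x ∷ xs × P x' z
  src' (here refl) = x , here refl , p
  src' (there m) with src m
  ... | x' , m' , p' = x' , there m' , p'
  tgt' : ∀ {x'} → x' ∈ x ∷ xs → ∃ λ z → z ∈ y ∷ ys × P x' z
  tgt' (here refl) = y , here refl , p
  tgt' (there m) with tgt m
  ... | z , m' , p' = z , there m' , p'

module Covering {A B : Set} (E : A → B → Bool) (Y : List B) (w : ℕ) (w≥1 : 1 ≤ w) where

  Heavy : A → Set
  Heavy x = w ≤ 2 * count (E x) Y

  uncovered : List B → A → Bool
  uncovered []      x = true
  uncovered (y ∷ U) x = not (E x y) ∧ uncovered U x

  uncovered-++ : ∀ U V x → uncovered (U ++ V) x ≡ uncovered V x ∧ uncovered U x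
  uncovered-++ []      V x = sym (Bool.∧-identityʳ _)
  uncovered-++ (y ∷ U) V x = trans (cong (not (E x y) ∧_) (uncovered-++ U V x))
    (trans (sym (Bool.∧-assoc (not (E x y)) (uncovered V x) (uncovered U x)))
    (trans (cong (_∧ uncovered U x) (Bool.∧-comm (not (E x y)) (uncovered V x)))
    (Bool.∧-assoc (uncovered V x) (not (E x y)) (uncovered U x))))

  covered : ∀ U x → uncovered U x ≡ false → ∃ λ y → y ∈ U × E x y ≡ true
  covered (y ∷ U) x e with E x y in eq
  ... | true  = y , here refl , eq
  ... | false with covered U x e
  ... | z , m , h = z , there m , h

  degrees : ∀ X → ∑ Y (λ y → count (λ x → E x y) X) ≡ ∑ X (λ x → count (E x) Y)
  degrees X = ∑-swap Y X (λ y x → ind (E x y))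

  heavy-degrees : ∀ X → (∀ {x} → x ∈ X → Heavy x) → length X * w ≤ 2 * ∑ Y (λ y → count (λ x → E x y) X)
  heavy-degrees X h = ≤-trans (∑-≥-const X h) (≤-reflexive (trans (∑-* 2 X _) (cong (2 *_) (sym (degrees X)))))

  -- By averaging, while more than m / 2 points of X are uncovered, some y covers at least w m / (4 |Y|) of them.
  greedy : ∀ m → 1 ≤ m → ∀ k X → length X ≤ k → (∀ {x} → x ∈ X → Heavy x) →
    ∃ λ U → (∀ {y} → y ∈ U → y ∈ Y) × length U * (w * m) ≤ 4 * length Y * length X × 2 * count (uncovered U) X ≤ m
  greedy m m≥1 k X X≤k heavy with 2 * length X ≤? m
  ... | yes le = [] , (λ ()) , z≤n , ≤-trans (*-monoʳ-≤ 2 (count≤length _ X)) le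
  ... | no ¬le with any? (λ y → does (w * m ≤? 4 * length Y * count (λ x → E x y) X)) Y
  -- If every y fails, adding up the strict inequalities gives |Y| + 4|Y|C ≤ |Y| w m, whereas
  -- heaviness gives |Y| w m ≤ 4|Y|C. So Y is empty, which no heavy x permits.
  ... | inj₂ none = ⊥-elim (contra (≰⇒> ¬le) Y≡0)
    where
    C = ∑ Y (λ y → count (λ x → E x y) X)
    upper : length Y * suc (4 * length Y * 0) + 4 * length Y * C ≤ length Y * (w * m)
    upper = begin
      length Y * suc (4 * length Y * 0) + 4 * length Y * C
        ≡⟨ cong₂ _+_ (cong (λ z → length Y * suc z) (*-zeroʳ (4 * length Y))) (sym (∑-* (4 * length Y) Y _)) ⟩
      length Y * 1 + ∑ Y (λ y → 4 * length Y * count (λ x → E x y) X)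
        ≡⟨ cong (_+ ∑ Y (λ y → 4 * length Y * count (λ x → E x y) X)) (sym (∑-const Y 1)) ⟩
      ∑ Y (λ _ → 1) + ∑ Y (λ y → 4 * length Y * count (λ x → E x y) X)
        ≡⟨ sym (∑-+ Y (λ _ → 1) _) ⟩
      ∑ Y (λ y → suc (4 * length Y * count (λ x → E x y) X))
        ≤⟨ ∑-≤-const Y (λ {y} y∈ → ≰⇒> (does-false (w * m ≤? _) (none y∈))) ⟩
      length Y * (w * m) ∎ where open ≤-Reasoning
    lower : length Y * (w * m) ≤ 4 * length Y * C
    lower = begin
      length Y * (w * m)               ≤⟨ *-monoʳ-≤ (length Y) (*-monoʳ-≤ w (<⇒≤ (≰⇒> ¬le))) ⟩
      length Y * (w * (2 * length X))  ≡⟨ solve 3 (λ y w x → y :* (w :* (con 2 :* x)) := con 2 :* y :* (x :* w)) refl (length Y) w (length X) ⟩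
      2 * length Y * (length X * w)    ≤⟨ *-monoʳ-≤ (2 * length Y) (heavy-degrees X heavy) ⟩
      2 * length Y * (2 * C)           ≡⟨ solve 2 (λ y c → con 2 :* y :* (con 2 :* c) := con 4 :* y :* c) refl (length Y) C ⟩
      4 * length Y * C                 ∎
      where open ≤-Reasoning
            open +-*-Solver
    Y≡0 : length Y ≡ 0
    Y≡0 = n≤0⇒n≡0 (≤-trans (m≤m*n (length Y) (suc (4 * length Y * 0)))
      (+-cancelʳ-≤ (4 * length Y * C) _ 0 (≤-trans upper lower)))
    contra : suc m ≤ 2 * length X → length Y ≡ 0 → ⊥
    contra lt y0 = <-irrefl refl (≤-trans w≥1 (≤-trans (w≤ X heavy lt) (≤-reflexive zero-degree)))
      where
      w≤ : ∀ X → (∀ {x} → x ∈ X → Heavy x) → suc m ≤ 2 * length X → w ≤ length X * w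
      w≤ (x ∷ X) h lt = m≤m+n w _
      C≡0 : C ≡ 0
      C≡0 = go Y y0
        where
        go : ∀ Z → length Z ≡ 0 → ∑ Z (λ y → count (λ x → E x y) X) ≡ 0
        go [] e = refl
      zero-degree : length X * w ≡ 0
      zero-degree = n≤0⇒n≡0 (≤-trans (heavy-degrees X heavy) (≤-reflexive (cong (2 *_) C≡0)))
  ... | inj₁ (y , y∈ , big) = next k X≤k
    where
    c = count (λ x → E x y) X
    gain : w * m ≤ 4 * length Y * c
    gain = does-true (w * m ≤? _) big
    X' = sel (λ x → not (E x y)) X
    size : c + length X' ≡ length X
    size = trans (cong (c +_) (length-sel (λ x → not (E x y)) X)) (count-complement (λ x → E x y) X)
    c≥1 : 1 ≤ c
    c≥1 = positive c gain
      where
      positive : ∀ c → w * m ≤ 4 * length Y * c → 1 ≤ c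
      positive zero    g = ⊥-elim (<-irrefl refl (≤-trans (*-mono-≤ w≥1 m≥1) (≤-trans g (≤-reflexive (*-zeroʳ (4 * length Y))))))
      positive (suc c) g = s≤s z≤n
    next : ∀ k → length X ≤ k →
      ∃ λ U → (∀ {y} → y ∈ U → y ∈ Y) × length U * (w * m) ≤ 4 * length Y * length X × 2 * count (uncovered U) X ≤ m
    next zero    le = ⊥-elim (<-irrefl refl (≤-trans c≥1 (≤-trans (m≤m+n c _) (≤-trans (≤-reflexive size) le))))
    next (suc k) le with greedy m m≥1 k X' (≤-pred (≤-trans (+-monoˡ-≤ (length X') c≥1) (≤-trans (≤-reflexive size) le)))
                           (λ x∈ → heavy (proj₁ (sel⁻ (λ x → not (E x y)) X x∈)))
    ... | U , U⊆Y , small , half = y ∷ U , (λ { (here refl) → y∈ ; (there m) → U⊆Y m }) , small' ,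
        ≤-trans (≤-reflexive (cong (2 *_) (sym (count-sel (uncovered U) (λ x → not (E x y)) X)))) half
      where
      small' : w * m + length U * (w * m) ≤ 4 * length Y * length X
      small' = ≤-trans (+-mono-≤ gain small) (≤-reflexive (trans (sym (*-distribˡ-+ (4 * length Y) c (length X'))) (cong (4 * length Y *_) size)))

  halve : ∀ X → (∀ {x} → x ∈ X → Heavy x) →
    ∃ λ U → (∀ {y} → y ∈ U → y ∈ Y) × length U * w ≤ 4 * length Y × 2 * count (uncovered U) X ≤ length X
  halve []      h = [] , (λ ()) , z≤n , z≤n
  halve X@(x ∷ xs) h with greedy (length X) (s≤s z≤n) (length X) X ≤-refl h
  ... | U , U⊆Y , small , half = U , U⊆Y ,
    *-cancelʳ-≤ (length U * w) (4 * length Y) (length X) (≤-trans (≤-reflexive (*-assoc (length U) w (length X))) small) , half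

  rounds : ∀ J X → (∀ {x} → x ∈ X → Heavy x) →
    ∃ λ U → (∀ {y} → y ∈ U → y ∈ Y) × length U * w ≤ J * (4 * length Y) × 2 ^ J * count (uncovered U) X ≤ length X
  rounds zero    X h = [] , (λ ()) , z≤n , ≤-trans (≤-reflexive (+-identityʳ _)) (count≤length _ X)
  rounds (suc J) X h with rounds J X h
  ... | U , U⊆Y , small , few with halve (sel (uncovered U) X) (λ x∈ → h (proj₁ (sel⁻ (uncovered U) X x∈)))
  ... | V , V⊆Y , small' , half = V ++ U , sub , small'' , few'
    where
    open ≤-Reasoning
    sub : ∀ {y} → y ∈ V ++ U → y ∈ Y
    sub m with ∈-++⁻ V m
    ... | inj₁ v = V⊆Y v
    ... | inj₂ u = U⊆Y u
    small'' : length (V ++ U) * w ≤ 4 * length Y + J * (4 * length Y)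
    small'' = ≤-trans (≤-reflexive (trans (cong (_* w) (length-++ V)) (*-distribʳ-+ w (length V) (length U)))) (+-mono-≤ small' small)
    few' : 2 * 2 ^ J * count (uncovered (V ++ U)) X ≤ length X
    few' = begin
      2 * 2 ^ J * count (uncovered (V ++ U)) X                      ≡⟨ cong (2 * 2 ^ J *_) (∑-cong X (λ x → cong ind (uncovered-++ V U x))) ⟩
      2 * 2 ^ J * count (λ x → uncovered U x ∧ uncovered V x) X     ≡⟨ cong (2 * 2 ^ J *_) (sym (count-sel (uncovered V) (uncovered U) X)) ⟩
      2 * 2 ^ J * count (uncovered V) (sel (uncovered U) X)         ≡⟨ trans (cong (_* count (uncovered V) (sel (uncovered U) X)) (*-comm 2 (2 ^ J))) (*-assoc (2 ^ J) 2 _) ⟩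
      2 ^ J * (2 * count (uncovered V) (sel (uncovered U) X))       ≤⟨ *-monoʳ-≤ (2 ^ J) half ⟩
      2 ^ J * length (sel (uncovered U) X)                          ≡⟨ cong (2 ^ J *_) (length-sel (uncovered U) X) ⟩
      2 ^ J * count (uncovered U) X                                 ≤⟨ few ⟩
      length X                                                      ∎

  -- J halvings leave at most |X| / w points uncovered, and these receive one neighbour each. Double
  -- counting against the degree bound 2w gives |X| ≤ 4|Y|, so the leftover costs no more than one
  -- further round.
  cover : ∀ J X → w ≤ 2 ^ J → (∀ {x} → x ∈ X → Heavy x) → (∀ {y} → y ∈ Y → count (λ x → E x y) X ≤ 2 * w) →
    ∃ λ U → (∀ {y} → y ∈ U → y ∈ Y) × (∀ {x} → x ∈ X → ∃ λ u → u ∈ U × E x u ≡ true) × length U * w ≤ suc J * (4 * length Y)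
  cover J X w≤ heavy light with rounds J X heavy
  ... | U , U⊆Y , small , few with choose (λ x y → y ∈ Y × E x y ≡ true) (sel (uncovered U) X) nbr
    where
    nbr : ∀ {x} → x ∈ sel (uncovered U) X → ∃ λ y → y ∈ Y × E x y ≡ true
    nbr {x} m = count⇒∃ (E x) Y (positive (count (E x) Y) (heavy (proj₁ (sel⁻ (uncovered U) X m))))
      where
      positive : ∀ c → w ≤ 2 * c → 0 < c
      positive zero    h = ⊥-elim (<-irrefl refl (≤-trans w≥1 h))
      positive (suc c) h = s≤s z≤n
  ... | V , V-length , V-src , V-tgt = V ++ U , sub , cov , small'
    where
    open ≤-Reasoning
    sub : ∀ {y} → y ∈ V ++ U → y ∈ Y
    sub m with ∈-++⁻ V m
    ... | inj₁ v = proj₁ (proj₂ (proj₂ (V-src v)))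
    ... | inj₂ u = U⊆Y u
    cov : ∀ {x} → x ∈ X → ∃ λ u → u ∈ V ++ U × E x u ≡ true
    cov {x} x∈ with uncovered U x in eq
    ... | false = let (y , y∈ , e) = covered U x eq in y , ∈-++⁺ʳ V y∈ , e
    ... | true  = let (y , y∈ , _ , e) = V-tgt (sel⁺ (uncovered U) X x∈ eq) in y , ∈-++⁺ˡ y∈ , e
    X≤ : length X ≤ 4 * length Y
    X≤ = *-cancelʳ-≤ (length X) (4 * length Y) w {{>-nonZero w≥1}} (begin
      length X * w ≤⟨ heavy-degrees X heavy ⟩
      2 * ∑ Y (λ y → count (λ x → E x y) X) ≤⟨ *-monoʳ-≤ 2 (∑-≤-const Y light) ⟩
      2 * (length Y * (2 * w)) ≡⟨ solve 2 (λ y w → con 2 :* (y :* (con 2 :* w)) := con 4 :* y :* w) refl (length Y) w ⟩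
      4 * length Y * w ∎)
      where open +-*-Solver
    V≤ : length V * w ≤ 4 * length Y
    V≤ = begin
      length V * w        ≡⟨ cong (_* w) (trans V-length (length-sel (uncovered U) X)) ⟩
      count (uncovered U) X * w     ≤⟨ *-monoʳ-≤ (count (uncovered U) X) w≤ ⟩
      count (uncovered U) X * 2 ^ J ≡⟨ *-comm _ (2 ^ J) ⟩
      2 ^ J * count (uncovered U) X ≤⟨ few ⟩
      length X            ≤⟨ X≤ ⟩
      4 * length Y        ∎
    small' : length (V ++ U) * w ≤ 4 * length Y + J * (4 * length Y)
    small' = ≤-trans (≤-reflexive (trans (cong (_* w) (length-++ V)) (*-distribʳ-+ w (length V) (length U)))) (+-mono-≤ V≤ small)

does-yes : {P : Set} (P? : Dec P) → P → does P? ≡ true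
does-yes (yes _) p = refl
does-yes (no ¬p) p = ⊥-elim (¬p p)

degree : ∀ {d} → (Point d → Bool) → Point d → ℕ
degree {d} τ x = count (λ δ → τ (mv δ x)) (dirs d)

-- All that the counting needs to know of a cutset. The cover is infinite, so the number of its
-- internal edges is tested on finite sets X; an edge is seen from both endpoints, hence 2n.
record MinimalCover (d n : ℕ) : Set where
  field
    τ           : Point d → Bool
    independent : ∀ x δ → τ x ≡ false → τ (mv δ x) ≡ true
    minimal     : ∀ x → τ x ≡ true → ∃ λ δ → τ (mv δ x) ≡ false
    edge-sum    : ∀ X → Unique X → (∀ {x} → x ∈ X → τ x ≡ true) → ∑ X (degree τ) ≤ 2 * n

  Edge : Point d → Dir d → Set
  Edge x δ = τ x ≡ true × τ (mv δ x) ≡ true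

  -- Each direction ε spans a 4-cycle with the edge; independence of the complement puts x + ε or x + δ + ε in the cover.
  degree-edge : ∀ x δ → 2 * d ≤ degree τ x + degree τ (mv δ x)
  degree-edge x δ = begin
    2 * d                    ≡⟨ sym (trans (count-true (dirs d)) (length-dirs d)) ⟩
    count (λ _ → true) (dirs d)    ≤⟨ ∑-mono (dirs d) (λ {ε} _ → one ε) ⟩
    ∑ (dirs d) (λ ε → ind (τ (mv ε x)) + ind (τ (mv ε (mv δ x)))) ≡⟨ ∑-+ (dirs d) _ _ ⟩
    degree τ x + degree τ (mv δ x) ∎
    where
    open ≤-Reasoning
    one : ∀ ε → 1 ≤ ind (τ (mv ε x)) + ind (τ (mv ε (mv δ x)))
    one ε with τ (mv ε x) in eq
    ... | true  = s≤s z≤n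
    ... | false = ≤-reflexive (cong ind (sym (trans (cong τ (mv-comm ε δ x)) (independent (mv ε x) δ eq))))

adjacent : ∀ {d} → Point d → Point d → Bool
adjacent x y = does (dist x y ≟ 1)

adjacent-mv : ∀ {d} (δ : Dir d) x → adjacent x (mv δ x) ≡ true
adjacent-mv δ x = does-yes (dist x (mv δ x) ≟ 1) (dist-mv δ x)

adjacent⇒dist : ∀ {d} {x y : Point d} → adjacent x y ≡ true → dist x y ≡ 1
adjacent⇒dist {x = x} {y} = does-true (dist x y ≟ 1)

count-adjacent : ∀ {d} (p : Point d → Bool) {X : List (Point d)} → Unique X → ∀ y → (∀ {x} → x ∈ X → p x ≡ true) →
  count (λ x → adjacent x y) X ≤ degree p y
count-adjacent {d} p {X} uX y hX = count-rel (λ x δ → x ≡ mv δ y) {λ x → adjacent x y} {λ δ → p (mv δ y)} uX w (λ a b → trans a (sym b))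
  where
  w : ∀ {x} → x ∈ X → adjacent x y ≡ true → ∃ λ δ → δ ∈ dirs d × p (mv δ y) ≡ true × x ≡ mv δ y
  w {x} x∈ e with adj⇒mv y x (trans (dist-sym y x) (adjacent⇒dist {x = x} {y} e))
  ... | δ , refl = δ , ∈-dirs δ , hX x∈ , refl

degree-∈ : ∀ {d} (p : Point d → Bool) {Y : List (Point d)} x → (∀ δ → p (mv δ x) ≡ true → mv δ x ∈ Y) →
  degree p x ≤ count (adjacent x) Y
degree-∈ {d} p {Y} x h = count-rel (λ δ y → y ≡ mv δ x) {λ δ → p (mv δ x)} {adjacent x} dirs-unique
  (λ {δ} _ e → mv δ x , h δ e , adjacent-mv δ x , refl)
  (λ {δ} {ε} a b → mv-dir-injective δ ε x (trans (sym a) b))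

module Separation {d n : ℕ} (C : MinimalCover d n)
  (Λ : List (Point d)) (Λ-unique : Unique Λ) (near : ∀ x δ → MinimalCover.Edge C x δ → x ∈ Λ × (∀ ε → mv ε x ∈ Λ))
  (t J : ℕ) (t≥1 : 1 ≤ t) (t≤d : t ≤ d) (d≤2^J : d ≤ 2 ^ J) where

  open MinimalCover C

  deg : Point d → ℕ
  deg = degree τ

  isY isX isB isW : Point d → Bool
  Y X B W : List (Point d)
  isY v = τ v ∧ does (t ≤? deg v)
  Y = sel isY Λ
  isX u = τ u ∧ does (d ≤? 2 * count (adjacent u) Y)
  X = sel isX Λ
  isB b = τ b ∧ does (2 * d <? deg b + t)
  B = sel isB Λ
  isW w = not (τ w) ∧ does (d ≤? 2 * count (adjacent w) B)
  W = sel isW Λ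

  d≥1 : 1 ≤ d
  d≥1 = ≤-trans t≥1 t≤d

  from-degree : ∀ x → τ x ≡ true → 0 < deg x → ∃ (Edge x)
  from-degree x τx deg>0 = let (δ , _ , e) = count⇒∃ (λ δ → τ (mv δ x)) (dirs d) deg>0 in δ , τx , e

  Y-true : ∀ {y} → y ∈ Y → τ y ≡ true × t ≤ deg y
  Y-true {y} m = let (a , b) = ∧-true {τ y} (proj₂ (sel⁻ isY Λ m)) in a , does-true (t ≤? deg y) b

  X-true : ∀ {x} → x ∈ X → τ x ≡ true × d ≤ 2 * count (adjacent x) Y
  X-true {x} m = let (a , b) = ∧-true {τ x} (proj₂ (sel⁻ isX Λ m)) in a , does-true (d ≤? _) b

  B-true : ∀ {b} → b ∈ B → τ b ≡ true × 2 * d < deg b + t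
  B-true {b} m = let (e , e') = ∧-true {τ b} (proj₂ (sel⁻ isB Λ m)) in e , does-true (2 * d <? deg b + t) e'

  W-true : ∀ {w} → w ∈ W → not (τ w) ≡ true × d ≤ 2 * count (adjacent w) B
  W-true {w} m = let (e , e') = ∧-true {not (τ w)} (proj₂ (sel⁻ isW Λ m)) in e , does-true (d ≤? _) e'

  B-degree : ∀ {b} → b ∈ B → d ≤ deg b
  B-degree {b} m = +-cancelʳ-≤ d d (deg b) (begin
    d + d     ≡⟨ cong (d +_) (sym (+-identityʳ d)) ⟩
    2 * d     ≤⟨ <⇒≤ (proj₂ (B-true m)) ⟩
    deg b + t ≤⟨ +-monoʳ-≤ (deg b) t≤d ⟩
    deg b + d ∎) where open ≤-Reasoning

  Y-size : length Y * t ≤ 2 * n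
  Y-size = ≤-trans (∑-≥-const Y (proj₂ ∘ Y-true)) (edge-sum Y (sel-unique isY Λ-unique) (proj₁ ∘ Y-true))

  B-size : length B * d ≤ 2 * n
  B-size = ≤-trans (∑-≥-const B B-degree) (edge-sum B (sel-unique isB Λ-unique) (proj₁ ∘ B-true))

  -- A point of B has degree above 2d - t, hence at most t neighbours outside the cover, and W lies
  -- outside the cover. Counting the edges between W and B gives |W| d / 2 ≤ |B| t, while |B| d ≤
  -- 2n.
  W-size : length W * d * d ≤ 4 * n * t
  W-size = begin
    length W * d * d       ≤⟨ *-monoˡ-≤ d W-B ⟩
    2 * (length B * t) * d ≡⟨ solve 3 (λ b t d → con 2 :* (b :* t) :* d := con 2 :* (b :* d) :* t) refl (length B) t d ⟩
    2 * (length B * d) * t ≤⟨ *-monoˡ-≤ t (*-monoʳ-≤ 2 B-size) ⟩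
    2 * (2 * n) * t        ≡⟨ cong (_* t) (sym (*-assoc 2 2 n)) ⟩
    4 * n * t ∎
    where
    open ≤-Reasoning
    open +-*-Solver
    few : ∀ {b} → b ∈ B → count (λ w → adjacent w b) W ≤ t
    few {b} m = ≤-trans (count-adjacent (not ∘ τ) (sel-unique isW Λ-unique) b (proj₁ ∘ W-true))
      (+-cancelˡ-≤ (deg b) _ t (begin
        deg b + degree (not ∘ τ) b ≡⟨ count-complement (λ δ → τ (mv δ b)) (dirs d) ⟩
        length (dirs d) ≡⟨ length-dirs d ⟩
        2 * d ≤⟨ <⇒≤ (proj₂ (B-true m)) ⟩
        deg b + t ∎))
    W-B : length W * d ≤ 2 * (length B * t)
    W-B = begin
      length W * d ≤⟨ ∑-≥-const W (proj₂ ∘ W-true) ⟩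
      ∑ W (λ w → 2 * count (adjacent w) B) ≡⟨ ∑-* 2 W _ ⟩
      2 * ∑ W (λ w → count (adjacent w) B) ≡⟨ cong (2 *_) (∑-swap W B (λ w b → ind (adjacent w b))) ⟩
      2 * ∑ B (λ b → count (λ w → adjacent w b) W) ≤⟨ *-monoʳ-≤ 2 (∑-≤-const B few) ⟩
      2 * (length B * t) ∎

  -- A vertex x ∈ T of degree ≥ d with few neighbours in Y has a neighbour w ∉ T; for most x + f ∈ T the degree of
  -- x + f is < t, so the degree of its neighbour w + f is > 2d - t.  Hence w ∈ W.
  hub : ∀ x e → τ x ≡ true → d ≤ deg x → 2 * count (adjacent x) Y < d → τ (mv e x) ≡ false → mv e x ∈ W
  hub x e τx big fewY τw = sel⁺ isW Λ (proj₂ (near x (proj₁ edge) (proj₂ edge)) e)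
    (∧-true⁺ (cong not τw) (does-yes (d ≤? _) many))
    where
    open ≤-Reasoning
    w = mv e x
    edge = from-degree x τx (≤-trans d≥1 big)
    high low : Dir d → Bool
    high f = τ (mv f x) ∧ does (t ≤? deg (mv f x))
    low  f = τ (mv f x) ∧ not (does (t ≤? deg (mv f x)))
    high≤ : count high (dirs d) ≤ count (adjacent x) Y
    high≤ = degree-∈ isY x (λ f h → sel⁺ isY Λ (proj₂ (near x (proj₁ edge) (proj₂ edge)) f) h)
    low≤ : count low (dirs d) ≤ count (adjacent w) B
    low≤ = count-rel (λ f b → b ≡ mv f w) {low} {adjacent w} dirs-unique
      (λ {f} _ h → mv f w , in-B f h , adjacent-mv f w , refl)
      (λ {f} {g} a b → mv-dir-injective f g w (trans (sym a) b))
      where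
      in-B : ∀ f → low f ≡ true → mv f w ∈ B
      in-B f h = sel⁺ isB Λ (proj₁ (near (mv f w) (opp e) (τfw , back)))
        (∧-true⁺ τfw (does-yes (2 * d <? deg (mv f w) + t) (begin-strict
           2 * d ≤⟨ degree-edge (mv f x) e ⟩
           deg (mv f x) + deg (mv e (mv f x)) ≡⟨ cong (λ z → deg (mv f x) + deg z) (mv-comm e f x) ⟩
           deg (mv f x) + deg (mv f w) <⟨ +-monoˡ-< (deg (mv f w)) (≰⇒> (does-false (t ≤? _) (not-true (proj₂ (∧-true {τ (mv f x)} h))))) ⟩
           t + deg (mv f w) ≡⟨ +-comm t _ ⟩
           deg (mv f w) + t ∎)))
        where
        τfw : τ (mv f w) ≡ true
        τfw = independent w f τw
        back : τ (mv (opp e) (mv f w)) ≡ true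
        back = trans (cong τ (trans (cong (mv (opp e)) (mv-comm f e x)) (mv-opp e (mv f x)))) (proj₁ (∧-true h))
    many : d ≤ 2 * count (adjacent w) B
    many = ≤-trans (<⇒≤ (+-cancelˡ-< d d (2 * count low (dirs d)) (begin-strict
      d + d        ≤⟨ +-mono-≤ big big ⟩
      deg x + deg x ≡⟨ cong (λ z → z + z) (count-split (λ f → τ (mv f x)) (λ f → does (t ≤? deg (mv f x))) (dirs d)) ⟩
      (count high (dirs d) + count low (dirs d)) + (count high (dirs d) + count low (dirs d))
        ≡⟨ solve 2 (λ h l → (h :+ l) :+ (h :+ l) := con 2 :* h :+ con 2 :* l) refl (count high (dirs d)) (count low (dirs d)) ⟩
      2 * count high (dirs d) + 2 * count low (dirs d) ≤⟨ +-monoˡ-≤ _ (*-monoʳ-≤ 2 high≤) ⟩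
      2 * count (adjacent x) Y + 2 * count low (dirs d) <⟨ +-monoˡ-< _ fewY ⟩
      d + 2 * count low (dirs d) ∎))) (*-monoʳ-≤ 2 low≤)
      where open +-*-Solver

  -- The degrees at the ends of an edge sum to at least 2d, so one endpoint has degree at least d.
  -- If it lies in X, the greedy cover U ⊆ Y reaches it; otherwise its neighbour outside the cover,
  -- given by `minimal`, belongs to W. The two size bounds stay separate because they depend on t in
  -- opposite ways.
  separator : ∃ λ U →
      (∀ {u} → u ∈ U → ∃ λ b → dist u b ≤ 1 × ∃ (Edge b))
    × (∀ x δ → Edge x δ → ∃ λ u → u ∈ U × (dist u x ≡ 1 ⊎ dist u (mv δ x) ≡ 1))
    × ∃ λ a → ∃ λ b → length U ≡ a + b × a * d * t ≤ suc J * (8 * n) × b * d * d ≤ 4 * n * t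
  separator with Covering.cover adjacent Y d d≥1 J X d≤2^J (proj₂ ∘ X-true)
                  (λ {y} _ → ≤-trans (count-adjacent (λ _ → true) (sel-unique isX Λ-unique) y (λ _ → refl))
                                     (≤-reflexive (trans (count-true (dirs d)) (length-dirs d))))
  ... | U , U⊆Y , covers , U-size = U ++ W , close , dominated , length U , length W , length-++ U , bound , W-size
    where
    close : ∀ {u} → u ∈ U ++ W → ∃ λ b → dist u b ≤ 1 × ∃ (Edge b)
    close {u} m with ∈-++⁻ U m
    ... | inj₁ m' = u , ≤-trans (≤-reflexive (dist-refl u)) z≤n , (let (τu , dg) = Y-true (U⊆Y m') in from-degree u τu (≤-trans t≥1 dg))
    ... | inj₂ m' with count⇒∃ (adjacent u) B (positive _ (≤-trans d≥1 (proj₂ (W-true m'))))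
      where
      positive : ∀ c → 1 ≤ 2 * c → 0 < c
      positive (suc c) _ = s≤s z≤n
    ... | b , b∈ , e = b , ≤-reflexive (adjacent⇒dist {x = u} {b} e) , from-degree b (proj₁ (B-true b∈)) (≤-trans d≥1 (B-degree b∈))
    dominate : ∀ x → τ x ≡ true → d ≤ deg x → ∃ λ u → u ∈ U ++ W × dist u x ≡ 1
    dominate x τx big with d ≤? 2 * count (adjacent x) Y
    ... | yes h = let (δ , ed) = from-degree x τx (≤-trans d≥1 big)
                      (u , u∈ , e) = covers (sel⁺ isX Λ (proj₁ (near x δ ed)) (∧-true⁺ τx (does-yes (d ≤? _) h)))
                  in u , ∈-++⁺ˡ u∈ , trans (dist-sym u x) (adjacent⇒dist {x = x} {u} e)
    ... | no h with minimal x τx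
    ... | e , τw = mv e x , ∈-++⁺ʳ U (hub x e τx big (≰⇒> h) τw) , trans (dist-sym (mv e x) x) (dist-mv e x)
    dominated : ∀ x δ → Edge x δ → ∃ λ u → u ∈ U ++ W × (dist u x ≡ 1 ⊎ dist u (mv δ x) ≡ 1)
    dominated x δ (τx , τy) with d ≤? deg x
    ... | yes h = let (u , m , e) = dominate x τx h in u , m , inj₁ e
    ... | no  h = let (u , m , e) = dominate (mv δ x) τy big in u , m , inj₂ e
      where
      open ≤-Reasoning
      big : d ≤ deg (mv δ x)
      big = +-cancelˡ-≤ d d _ (begin
        d + d                 ≡⟨ cong (d +_) (sym (+-identityʳ d)) ⟩
        2 * d                 ≤⟨ degree-edge x δ ⟩
        deg x + deg (mv δ x)  ≤⟨ +-monoˡ-≤ _ (<⇒≤ (≰⇒> h)) ⟩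
        d + deg (mv δ x)      ∎)
    bound : length U * d * t ≤ suc J * (8 * n)
    bound = begin
      length U * d * t             ≤⟨ *-monoˡ-≤ t U-size ⟩
      suc J * (4 * length Y) * t   ≡⟨ solve 3 (λ j y t → j :* (con 4 :* y) :* t := j :* (con 4 :* (y :* t))) refl (suc J) (length Y) t ⟩
      suc J * (4 * (length Y * t)) ≤⟨ *-monoʳ-≤ (suc J) (*-monoʳ-≤ 4 Y-size) ⟩
      suc J * (4 * (2 * n))        ≡⟨ cong (suc J *_) (sym (*-assoc 4 2 n)) ⟩
      suc J * (8 * n)              ∎
      where open ≤-Reasoning
            open +-*-Solver

-- Connectivity of the boundary

some : {A : Set} → (A → Bool) → List A → Bool
some p xs with any? p xs
... | inj₁ _ = true
... | inj₂ _ = false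

some⁺ : {A : Set} (p : A → Bool) {xs : List A} {x : A} → x ∈ xs → p x ≡ true → some p xs ≡ true
some⁺ p {xs} m e with any? p xs
... | inj₁ _ = refl
... | inj₂ h = true≢false e (h m)

some⁻ : {A : Set} (p : A → Bool) (xs : List A) → some p xs ≡ true → ∃ λ x → x ∈ xs × p x ≡ true
some⁻ p xs e with any? p xs
... | inj₁ r = r

Bool-ext : ∀ {a b} → (a ≡ true → b ≡ true) → (b ≡ true → a ≡ true) → a ≡ b
Bool-ext {true}         h k = sym (h refl)
Bool-ext {false} {true} h k = k refl
Bool-ext {false} {false} h k = refl

xor-false⇒≡ : ∀ a b → a xor b ≡ false → a ≡ b
xor-false⇒≡ true  true  e = refl
xor-false⇒≡ false false e = refl

≢⇒xor : ∀ a b → a ≢ b → a xor b ≡ true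
≢⇒xor true  true  h = ⊥-elim (h refl)
≢⇒xor true  false h = refl
≢⇒xor false true  h = refl
≢⇒xor false false h = ⊥-elim (h refl)

≢-≢⇒≡ : ∀ {a b c : Bool} → a ≢ b → b ≢ c → a ≡ c
≢-≢⇒≡ {true}  {true}          h k = ⊥-elim (h refl)
≢-≢⇒≡ {true}  {false} {true}  h k = refl
≢-≢⇒≡ {true}  {false} {false} h k = ⊥-elim (k refl)
≢-≢⇒≡ {false} {false}         h k = ⊥-elim (h refl)
≢-≢⇒≡ {false} {true}  {false} h k = refl
≢-≢⇒≡ {false} {true}  {true}  h k = ⊥-elim (k refl)

-- Stands in for infinite rays: crossings are counted on the first K steps only, and each argument
-- compares finitely many rays, so that one large K serves them all.
Eventually : (ℕ → Set) → Set
Eventually P = ∃ λ K₀ → ∀ K → K₀ ≤ K → P K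

eventually-zip : {P Q R : ℕ → Set} → (∀ K → P K → Q K → R K) → Eventually P → Eventually Q → Eventually R
eventually-zip h (K₁ , p) (K₂ , q) = K₁ ⊔ K₂ , λ K le → h K (p K (≤-trans (m≤m⊔n K₁ K₂) le)) (q K (≤-trans (m≤n⊔m K₁ K₂) le))

shift-leaves : ∀ {d} (δ : Dir d) x (S : List (Point d)) → Eventually (λ K → shift K δ x ∉ S)
shift-leaves δ x [] = 0 , λ _ _ ()
shift-leaves δ@(i , b) x (s ∷ S) = eventually-zip {P = λ K → shift K δ x ≢ s} (λ K → λ { p q (here e) → p e ; p q (there m) → q m })
  (suc ℤ.∣ lookup s i ℤ.- lookup x i ∣ , λ K lt e → <-irrefl (sym (trans (at K) (cong (λ z → ℤ.∣ lookup z i ℤ.- lookup x i ∣) e))) lt) (shift-leaves δ x S)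
  where
  at : ∀ K → K ≡ ℤ.∣ lookup (shift K δ x) i ℤ.- lookup x i ∣
  at K = sym (begin
    ℤ.∣ lookup (shift K δ x) i ℤ.- lookup x i ∣ ≡⟨ cong (λ z → ℤ.∣ z ℤ.- lookup x i ∣) (trans (lookup-shift K δ x i) (ℤ.+-comm (lookup x i) _)) ⟩
    ℤ.∣ (ℤ.+ K) ℤ.* unit δ i ℤ.+ lookup x i ℤ.- lookup x i ∣ ≡⟨ cong ℤ.∣_∣ (trans (ℤ.+-assoc ((ℤ.+ K) ℤ.* unit δ i) (lookup x i) (ℤ.- lookup x i)) (trans (cong (λ z → (ℤ.+ K) ℤ.* unit δ i ℤ.+ z) (ℤ.+-inverseʳ (lookup x i))) (ℤ.+-identityʳ ((ℤ.+ K) ℤ.* unit δ i)))) ⟩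
    ℤ.∣ (ℤ.+ K) ℤ.* unit δ i ∣ ≡⟨ ℤ.abs-* (ℤ.+ K) (unit δ i) ⟩
    K * ℤ.∣ unit δ i ∣ ≡⟨ cong (λ z → K * ℤ.∣ z ∣) (unit-axis i b) ⟩
    K * ℤ.∣ off b ∣ ≡⟨ cong (K *_) (abs-off b) ⟩
    K * 1 ≡⟨ *-identityʳ K ⟩
    K ∎)
    where
    open ≡-Reasoning
    abs-off : ∀ b → ℤ.∣ off b ∣ ≡ 1
    abs-off true  = refl
    abs-off false = refl

module Contour {d : ℕ} (σ : Point d → Bool) (S : List (Point d)) (σ⇒S : ∀ {x} → σ x ≡ true → x ∈ S)
  (e₀ : Dir d) (r : ℕ) (connected : ∀ s x y → σ x ≡ s → σ y ≡ s → PathIn r (λ z → σ z ≡ s) x y)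
  (U : List (Point d))
  (near : ∀ a δ → σ a ≢ σ (mv δ a) → ∃ λ u → u ∈ U × dist u a ≤ 2)
  (close : ∀ {u} → u ∈ U → ∃ λ b → dist u b ≤ 1 × ∃ λ δ → σ b ≢ σ (mv δ b)) where

  ρ R : ℕ
  ρ = suc r
  R = (2 + ρ) + (ρ + 2)

  -- If V and U ∖ V were far apart, the boundary edges near V would form the boundary of the set of points whose ray in
  -- direction e₀ crosses an odd number of them; that set would be a union of r-components of S and of its complement.
  module _ (V : Point d → Bool)
    (closed : ∀ {a b} → a ∈ U → b ∈ U → V a ≡ true → dist a b ≤ R → V b ≡ true) where

    coloured : ℕ → Point d → Bool
    coloured k x = some (λ v → V v ∧ does (dist v x ≤? k)) U

    coloured⁺ : ∀ k x {v} → v ∈ U → V v ≡ true → dist v x ≤ k → coloured k x ≡ true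
    coloured⁺ k x {v} v∈ e le = some⁺ (λ v → V v ∧ does (dist v x ≤? k)) v∈ (∧-true⁺ e (does-yes (dist v x ≤? k) le))

    coloured⁻ : ∀ k x → coloured k x ≡ true → ∃ λ v → v ∈ U × V v ≡ true × dist v x ≤ k
    coloured⁻ k x e = let (v , v∈ , h) = some⁻ (λ v → V v ∧ does (dist v x ≤? k)) U e
                          (a , b) = ∧-true {V v} h
                      in v , v∈ , a , does-true (dist v x ≤? k) b

    c : Point d → Point d → Bool
    c x y = (σ x xor σ y) ∧ coloured 2 x

    f : ℕ → Point d → Bool
    f zero    x = false
    f (suc K) x = c x (mv e₀ x) xor f K (mv e₀ x)

    g : Point d → Point d → Bool
    g x a = coloured (2 + ρ) x ∧ σ a

    -- R adds up the route from v to x (2 + ρ), from x to a (ρ) and from a to u (2). So all cut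
    -- edges based within ρ of x have the same colour, and there `c` is the mod 2 coboundary of
    -- `g x`, which is σ or zero.
    c-potential : ∀ x a δ → dist x a ≤ ρ → c a (mv δ a) ≡ g x a xor g x (mv δ a)
    c-potential x a δ le = trans main (Bool.∧-distribˡ-xor (coloured (2 + ρ) x) (σ a) (σ (mv δ a)))
      where
      same : σ a ≢ σ (mv δ a) → coloured 2 a ≡ coloured (2 + ρ) x
      same ne = Bool-ext
        (λ e → let (v , v∈ , Vv , dv) = coloured⁻ 2 a e in
          coloured⁺ (2 + ρ) x v∈ Vv (≤-trans (dist-triangle v a x) (+-mono-≤ dv (≤-trans (≤-reflexive (dist-sym a x)) le))))
        (λ e → let (v , v∈ , Vv , dv) = coloured⁻ (2 + ρ) x e
                   (u , u∈ , du) = near a δ ne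
               in coloured⁺ 2 a u∈ (closed v∈ u∈ Vv (≤-trans (dist-triangle v x u) (+-mono-≤ dv
                    (≤-trans (dist-triangle x a u) (+-mono-≤ le (≤-trans (≤-reflexive (dist-sym a u)) du)))))) du)
      main : (σ a xor σ (mv δ a)) ∧ coloured 2 a ≡ coloured (2 + ρ) x ∧ (σ a xor σ (mv δ a))
      main with σ a | σ (mv δ a) | same
      ... | true  | true  | _ = sym (Bool.∧-zeroʳ _)
      ... | false | false | _ = sym (Bool.∧-zeroʳ _)
      ... | true  | false | h = trans (h λ ()) (sym (Bool.∧-identityʳ _))
      ... | false | true  | h = trans (h λ ()) (sym (Bool.∧-identityʳ _))

    -- Being locally a coboundary, `c` sums to zero around every unit square. Adding the squares
    -- between the two parallel rays leaves only the near and the far edge; the far one vanishes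
    -- once the rays have left S.
    f-difference : ∀ K x δ → f K x xor f K (mv δ x) ≡ c x (mv δ x) xor c (shift K e₀ x) (mv δ (shift K e₀ x))
    f-difference zero    x δ = sym (Bool.xor-same (c x (mv δ x)))
    f-difference (suc K) x δ = begin
      (c x x₀ xor f K x₀) xor (c y (mv e₀ y) xor f K (mv e₀ y))
        ≡⟨ solve 4 (λ p q s t → (p :+ q) :+ (s :+ t) := (p :+ s) :+ (q :+ t)) refl (c x x₀) (f K x₀) (c y (mv e₀ y)) (f K (mv e₀ y)) ⟩
      (c x x₀ xor c y (mv e₀ y)) xor (f K x₀ xor f K (mv e₀ y))
        ≡⟨ cong (λ z → (c x x₀ xor c y (mv e₀ y)) xor (f K x₀ xor f K z)) (mv-comm e₀ δ x) ⟩
      (c x x₀ xor c y (mv e₀ y)) xor (f K x₀ xor f K (mv δ x₀))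
        ≡⟨ cong ((c x x₀ xor c y (mv e₀ y)) xor_) (f-difference K x₀ δ) ⟩
      (c x x₀ xor c y (mv e₀ y)) xor (c x₀ (mv δ x₀) xor rest)
        ≡⟨ cong₂ (λ u v → u xor (v xor rest)) (cong₂ _xor_ (c-potential x x e₀ here-x) (trans (c-potential x y e₀ (near-x δ)) (cong (λ z → g x y xor g x z) (mv-comm e₀ δ x)))) (c-potential x x₀ δ (near-x e₀)) ⟩
      ((g x x xor g x x₀) xor (g x y xor g x (mv δ x₀))) xor ((g x x₀ xor g x (mv δ x₀)) xor rest)
        ≡⟨ solve 5 (λ a b e h z → ((a :+ b) :+ (e :+ h)) :+ ((b :+ h) :+ z) := (a :+ e) :+ z) refl (g x x) (g x x₀) (g x y) (g x (mv δ x₀)) rest ⟩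
      (g x x xor g x y) xor rest ≡⟨ cong (_xor rest) (sym (c-potential x x δ here-x)) ⟩
      c x y xor rest ∎
      where
      open ≡-Reasoning
      open xor-∧-Solver
      x₀ = mv e₀ x
      y = mv δ x
      rest = c (shift K e₀ x₀) (mv δ (shift K e₀ x₀))
      here-x : dist x x ≤ ρ
      here-x = ≤-trans (≤-reflexive (dist-refl x)) z≤n
      near-x : ∀ ε → dist x (mv ε x) ≤ ρ
      near-x ε = ≤-trans (≤-reflexive (dist-mv ε x)) (s≤s z≤n)

    outside : ∀ x → Eventually (λ K → σ (shift K e₀ x) ≡ false)
    outside x = let (K₀ , h) = shift-leaves e₀ x S in K₀ , λ K le → Bool.¬-not (λ e → h K le (σ⇒S e))

    f-edge : ∀ x δ → Eventually (λ K → f K x xor f K (mv δ x) ≡ c x (mv δ x))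
    f-edge x δ = eventually-zip (λ K p q → trans (f-difference K x δ) (trans (cong (c x (mv δ x) xor_) (far K p q)) (Bool.xor-identityʳ _)))
      (outside x) (outside (mv δ x))
      where
      far : ∀ K → σ (shift K e₀ x) ≡ false → σ (shift K e₀ (mv δ x)) ≡ false → c (shift K e₀ x) (mv δ (shift K e₀ x)) ≡ false
      far K p q = cong₂ (λ a b → (a xor b) ∧ coloured 2 (shift K e₀ x)) p (trans (cong σ (mv-shift K e₀ δ x)) q)

    f-walk : ∀ x w y → dist x y + length w ≤ ρ → Eventually (λ K → f K y xor f K (walk w y) ≡ g x y xor g x (walk w y))
    f-walk x []      y le = 0 , λ K _ → trans (Bool.xor-same (f K y)) (sym (Bool.xor-same (g x y)))
    f-walk x (δ ∷ w) y le = eventually-zip combine (f-edge y δ) (f-walk x w (mv δ y) le')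
      where
      le' : dist x (mv δ y) + length w ≤ ρ
      le' = ≤-trans (+-monoˡ-≤ (length w) (≤-trans (dist-triangle x y (mv δ y)) (≤-reflexive (cong (dist x y +_) (dist-mv δ y)))))
             (≤-trans (≤-reflexive (+-assoc (dist x y) 1 (length w))) le)
      combine : ∀ K → f K y xor f K (mv δ y) ≡ c y (mv δ y) → f K (mv δ y) xor f K (walk w (mv δ y)) ≡ g x (mv δ y) xor g x (walk w (mv δ y)) →
        f K y xor f K (walk w (mv δ y)) ≡ g x y xor g x (walk w (mv δ y))
      combine K p q = begin
        f K y xor f K z ≡⟨ solve 3 (λ a b e → a :+ e := (a :+ b) :+ (b :+ e)) refl (f K y) (f K y') (f K z) ⟩
        (f K y xor f K y') xor (f K y' xor f K z) ≡⟨ cong₂ _xor_ (trans p (c-potential x y δ (≤-trans (m≤m+n (dist x y) _) le))) q ⟩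
        (g x y xor g x y') xor (g x y' xor g x z) ≡⟨ sym (solve 3 (λ a b e → a :+ e := (a :+ b) :+ (b :+ e)) refl (g x y) (g x y') (g x z)) ⟩
        g x y xor g x z ∎
        where
        open ≡-Reasoning
        open xor-∧-Solver
        y' = mv δ y
        z = walk w y'

    -- A geodesic from x to z stays within ρ of x, so f changes along it as `g x` does, and `g x`
    -- sees its argument only through σ.
    f-jump : ∀ x z → dist x z ≤ r → σ x ≡ σ z → Eventually (λ K → f K x ≡ f K z)
    f-jump x z le e with geodesic (dist x z) x z refl
    ... | w , l , refl = let (K₀ , h) = f-walk x w x (≤-trans (≤-reflexive (cong₂ _+_ (dist-refl x) l)) (≤-trans le (n≤1+n r)))
      in K₀ , λ K K≥ → xor-false⇒≡ _ _ (trans (h K K≥) (trans (cong (λ s → (coloured (2 + ρ) x ∧ s) xor g x (walk w x)) e) (Bool.xor-same (g x (walk w x)))))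

    f-path : ∀ s {x y} → PathIn r (λ z → σ z ≡ s) x y → Eventually (λ K → f K x ≡ f K y)
    f-path s (stay _) = 0 , λ _ _ → refl
    f-path s (jump p le path) = eventually-zip (λ _ → trans) (f-jump _ _ le (trans p (sym (first path)))) (f-path s path)
      where
      first : ∀ {x y} → PathIn r (λ z → σ z ≡ s) x y → σ x ≡ s
      first (stay p) = p
      first (jump p _ _) = p

    f-same : ∀ {x y} → σ x ≡ σ y → Eventually (λ K → f K x ≡ f K y)
    f-same {x} {y} e = f-path (σ y) (connected (σ y) x y e refl)

    -- By r-connectivity f is eventually constant on S and on its complement, so it changes by the
    -- same amount across every cut edge. That change is `c`, so either all cut edges are coloured
    -- or none is.
    uncut : ∀ {u₁ u₂} → u₁ ∈ U → u₂ ∈ U → V u₁ ≡ true → V u₂ ≡ true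
    uncut {u₁} {u₂} u₁∈ u₂∈ V₁ with close u₁∈ | close u₂∈
    ... | b₁ , d₁ , δ₁ , ne₁ | b₂ , d₂ , δ₂ , ne₂ = recolour (trans (sym c₂) (trans (sym c₁≡c₂) c₁))
      where
      c₁ : c b₁ (mv δ₁ b₁) ≡ true
      c₁ = ∧-true⁺ (≢⇒xor _ _ ne₁) (coloured⁺ 2 b₁ u₁∈ V₁ (≤-trans d₁ (n≤1+n 1)))
      c₂ : c b₂ (mv δ₂ b₂) ≡ coloured 2 b₂
      c₂ = cong (_∧ coloured 2 b₂) (≢⇒xor _ _ ne₂)
      ends : Eventually (λ K → f K b₁ xor f K (mv δ₁ b₁) ≡ f K b₂ xor f K (mv δ₂ b₂))
      ends with σ b₁ ≟ᵇ σ b₂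
      ... | yes e = eventually-zip (λ _ → cong₂ _xor_) (f-same e) (f-same (≢-≢⇒≡ (ne₁ ∘ sym) (λ h → ne₂ (trans (sym e) h))))
      -- The edges are based on opposite sides of S, so one of them is compared in reverse.
      ... | no ne = eventually-zip (λ K p q → trans (cong₂ _xor_ p q) (Bool.xor-comm (f K (mv δ₂ b₂)) (f K b₂)))
                      (f-same (≢-≢⇒≡ ne ne₂)) (f-same (≢-≢⇒≡ (ne₁ ∘ sym) ne))
      c₁≡c₂ : c b₁ (mv δ₁ b₁) ≡ c b₂ (mv δ₂ b₂)
      c₁≡c₂ = let (K , h) = eventually-zip (λ _ p q → trans (sym p) q) (f-edge b₁ δ₁) (eventually-zip (λ _ → trans) ends (f-edge b₂ δ₂))
              in h K ≤-refl
      recolour : coloured 2 b₂ ≡ true → V u₂ ≡ true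
      recolour e = let (v , v∈ , Vv , dv) = coloured⁻ 2 b₂ e in
        closed v∈ u₂∈ Vv (≤-trans (dist-triangle v b₂ u₂) (≤-trans (+-mono-≤ dv (≤-trans (≤-reflexive (dist-sym b₂ u₂)) d₂))
           (+-mono-≤ (m≤m+n 2 ρ) (s≤s z≤n))))

  cut : (V : Point d → Bool) → ∀ {u₁ u₂} → u₁ ∈ U → u₂ ∈ U → V u₁ ≡ true → V u₂ ≡ false →
    ∃ λ a → ∃ λ b → a ∈ U × b ∈ U × V a ≡ true × V b ≡ false × dist a b ≤ R
  cut V u₁∈ u₂∈ V₁ V₂ with any? (λ (a , b) → V a ∧ (not (V b) ∧ does (dist a b ≤? R))) (cartesianProduct U U)
  ... | inj₁ ((a , b) , m , h) =
      let (a∈ , b∈) = ∈-cartesianProduct⁻ U U m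
          (Va , h') = ∧-true {V a} h
          (Vb , h'') = ∧-true {not (V b)} h'
      in a , b , a∈ , b∈ , Va , not-true Vb , does-true (dist a b ≤? R) h''
  ... | inj₂ none = true≢false (uncut V closed u₁∈ u₂∈ V₁) V₂
    where
    closed : ∀ {a b} → a ∈ U → b ∈ U → V a ≡ true → dist a b ≤ R → V b ≡ true
    closed {a} {b} a∈ b∈ Va le with V b in eq
    ... | true  = refl
    ... | false = true≢false (∧-true⁺ Va (∧-true⁺ (cong not eq) (does-yes (dist a b ≤? R) le))) (none (∈-cartesianProduct⁺ a∈ b∈))

-- Tours through the separating set and their enumeration

infix 4 _∈ᵇ_

abstract
  _∈ᵇ_ : ∀ {d} → Point d → List (Point d) → Bool
  x ∈ᵇ S = does (_∈?ᵍ_ _≟ᴾ_ x S)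

  ∈ᵇ⁺ : ∀ {d} {x : Point d} {S} → x ∈ S → (x ∈ᵇ S) ≡ true
  ∈ᵇ⁺ {x = x} {S} = does-yes (_∈?ᵍ_ _≟ᴾ_ x S)

  ∈ᵇ⁻ : ∀ {d} {x : Point d} {S} → (x ∈ᵇ S) ≡ true → x ∈ S
  ∈ᵇ⁻ {x = x} {S} = does-true (_∈?ᵍ_ _≟ᴾ_ x S)

  ∉ᵇ⁻ : ∀ {d} {x : Point d} {S} → (x ∈ᵇ S) ≡ false → x ∉ S
  ∉ᵇ⁻ {x = x} {S} = does-false (_∈?ᵍ_ _≟ᴾ_ x S)

  ∈ᵇ-does : ∀ {d} (x : Point d) S → (x ∈ᵇ S) ≡ does (_∈?ᵍ_ _≟ᴾ_ x S)
  ∈ᵇ-does x S = refl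

count-strict : {A : Set} (p q : A → Bool) {xs : List A} {x : A} → (∀ {y} → y ∈ xs → p y ≡ true → q y ≡ true) →
  x ∈ xs → p x ≡ false → q x ≡ true → suc (count p xs) ≤ count q xs
count-strict p q {y ∷ xs} sub (here refl) px qx rewrite px | qx = s≤s (count-mono xs (sub ∘ there))
count-strict p q {y ∷ xs} sub (there m)   px qx =
  ≤-trans (≤-reflexive (sym (+-suc (ind (p y)) (count p xs)))) (+-mono-≤ (ind-mono (sub (here refl))) (count-strict p q (sub ∘ there) m px qx))

start∈visits : ∀ {d} (x : Point d) w → x ∈ visits x w
start∈visits x []      = here refl
start∈visits x (δ ∷ w) = here refl

visits-suffix : ∀ {d} u w {x y : Point d} → y ∈ visits (walk u x) w → y ∈ visits x (u ++ w)
visits-suffix []      w m = m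
visits-suffix (δ ∷ u) w m = there (visits-suffix u w m)

visits-prefix : ∀ {d} u w {x y : Point d} → y ∈ visits x u → y ∈ visits x (u ++ w)
visits-prefix []      w {x} (here refl) = start∈visits x w
visits-prefix (δ ∷ u) w (here refl) = here refl
visits-prefix (δ ∷ u) w (there m)   = there (visits-prefix u w m)

-- A return trip from a to b along geodesics is inserted at a visit of a, so no visited point is
-- lost.
detour : ∀ {d} R {a b : Point d} → dist a b ≤ R → ∀ x w → a ∈ visits x w →
  ∃ λ w' → length w' ≤ length w + 2 * R × (∀ {y} → y ∈ visits x w → y ∈ visits x w') × b ∈ visits x w'
detour R {a} {b} le x w a∈ = go x w a∈
  where
  at : ∀ w → ∃ λ w' → length w' ≤ length w + 2 * R × (∀ {y} → y ∈ visits a w → y ∈ visits a w') × b ∈ visits a w'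
  at w with geodesic (dist a b) a b refl | geodesic (dist a b) b a (dist-sym b a)
  ... | u , lu , refl | v , lv , back = u ++ (v ++ w) , len , (λ m → visits-suffix u (v ++ w) (visits-suffix v w (subst (λ z → _ ∈ visits z w) (sym back) m)))
        , visits-suffix u (v ++ w) (start∈visits b (v ++ w))
    where
    open ≤-Reasoning
    len : length (u ++ (v ++ w)) ≤ length w + 2 * R
    len = begin
      length (u ++ (v ++ w)) ≡⟨ trans (length-++ u) (cong (length u +_) (length-++ v)) ⟩
      length u + (length v + length w) ≡⟨ sym (+-assoc (length u) (length v) (length w)) ⟩
      length u + length v + length w ≤⟨ +-monoˡ-≤ (length w) (+-mono-≤ (≤-trans (≤-reflexive lu) le) (≤-trans (≤-reflexive lv) le)) ⟩
      R + R + length w ≡⟨ trans (+-comm (R + R) (length w)) (cong (λ z → length w + (R + z)) (sym (+-identityʳ R))) ⟩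
      length w + 2 * R ∎
  go : ∀ x w → a ∈ visits x w → ∃ λ w' → length w' ≤ length w + 2 * R × (∀ {y} → y ∈ visits x w → y ∈ visits x w') × b ∈ visits x w'
  go x []      (here refl) = at []
  go x (δ ∷ w) (here refl) = at (δ ∷ w)
  go x (δ ∷ w) (there m) with go (mv δ x) w m
  ... | w' , len , sub , b∈ = δ ∷ w' , s≤s len , (λ { (here e) → here e ; (there m) → there (sub m) }) , there b∈

module Tour {d : ℕ} (U : List (Point d)) (R : ℕ)
  (cut : (V : Point d → Bool) → ∀ {u₁ u₂} → u₁ ∈ U → u₂ ∈ U → V u₁ ≡ true → V u₂ ≡ false →
    ∃ λ a → ∃ λ b → a ∈ U × b ∈ U × V a ≡ true × V b ≡ false × dist a b ≤ R)
  (x : Point d) {u₀ : Point d} (u₀∈U : u₀ ∈ U) (x-u₀ : dist x u₀ ≤ R) where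

  missing : List (Dir d) → Point d → Bool
  missing w u = not (u ∈ᵇ visits x w)

  -- Growing a spanning tree: `cut`, applied to the visited points, finds an unvisited point of U
  -- within R of a visited one, at a price of 2R steps each.
  extend : ∀ k w → u₀ ∈ visits x w → count (missing w) U ≤ k →
    ∃ λ w' → length w' ≤ length w + k * (2 * R) × (∀ {u} → u ∈ U → u ∈ visits x w')
  extend k w u₀∈ le with any? (missing w) U
  ... | inj₂ none = w , m≤m+n (length w) _ , λ u∈ → ∈ᵇ⁻ (Bool.not-injective (none u∈))
  ... | inj₁ (u₂ , u₂∈ , miss) with k
  ... | zero  = ⊥-elim (<-irrefl refl (≤-trans (∃⇒count (missing w) u₂∈ miss) le))
  ... | suc k with cut (_∈ᵇ visits x w) u₀∈U u₂∈ (∈ᵇ⁺ u₀∈) (not-true miss)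
  ... | a , b , a∈ , b∈ , Va , Vb , close with detour R close x w (∈ᵇ⁻ Va)
  ... | w₁ , len , sub , b∈w₁ with extend k w₁ (sub u₀∈) (≤-pred (≤-trans fewer le))
    where
    fewer : suc (count (missing w₁) U) ≤ count (missing w) U
    fewer = count-strict (missing w₁) (missing w)
      (λ {y} _ h → cong not (Bool.¬-not (λ e → true≢false (∈ᵇ⁺ (sub (∈ᵇ⁻ e))) (not-true h)))) b∈
      (cong not (∈ᵇ⁺ b∈w₁)) (cong not Vb)
  ... | w₂ , len₂ , all = w₂ , ≤-trans len₂ (≤-trans (+-monoˡ-≤ _ len) (≤-reflexive (+-assoc (length w) (2 * R) _))) , all

  tour : ∃ λ w → length w ≤ length U * (2 * R) × (∀ {u} → u ∈ U → u ∈ visits x w)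
  tour with detour R x-u₀ x [] (here refl)
  ... | w , len , _ , u₀∈ = go (length U) refl
    where
    fewer : suc (count (missing w) U) ≤ length U
    fewer = subst (suc (count (missing w) U) ≤_) (count-true U)
      (count-strict (missing w) (λ _ → true) (λ _ _ → refl) u₀∈U (cong not (∈ᵇ⁺ u₀∈)) refl)
    -- The first detour, from x to u₀, uses the share 2R of u₀ itself; at most `length U - 1` points
    -- are then missing.
    go : ∀ k → length U ≡ k → ∃ λ w → length w ≤ k * (2 * R) × (∀ {u} → u ∈ U → u ∈ visits x w)
    go zero    e = ⊥-elim (<-irrefl refl (≤-trans (s≤s z≤n) (subst (suc (count (missing w) U) ≤_) e fewer)))
    go (suc k) e with extend k w u₀∈ (≤-pred (subst (suc (count (missing w) U) ≤_) e fewer))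
    ... | w' , len' , all = w' , ≤-trans len' (+-monoˡ-≤ _ len) , all

-- Walks of one common length L are words over the directions, so there are exactly (2d)^L
-- candidates.
pad : ∀ {d} (ε : Dir d) {L} (x : Point d) w → length w ≤ L → ∃ λ w' → length w' ≡ L × (∀ {y} → y ∈ visits x w → y ∈ visits x w')
pad ε {L} x w le = w ++ replicate (L ∸ length w) ε ,
  trans (length-++ w) (trans (cong (length w +_) (length-replicate (L ∸ length w))) (m+[n∸m]≡n le)) , visits-prefix w _

length-cartesianProductWith : {A B C : Set} (f : A → B → C) (xs : List A) (ys : List B) →
  length (cartesianProductWith f xs ys) ≡ length xs * length ys
length-cartesianProductWith f []       ys = refl
length-cartesianProductWith f (x ∷ xs) ys = trans (length-++ (map (f x) ys)) (cong₂ _+_ (length-map (f x) ys) (length-cartesianProductWith f xs ys))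

words : ∀ d → ℕ → List (List (Dir d))
words d zero    = [] ∷ []
words d (suc L) = cartesianProductWith _∷_ (dirs d) (words d L)

length-words : ∀ d L → length (words d L) ≡ (2 * d) ^ L
length-words d zero    = refl
length-words d (suc L) = trans (length-cartesianProductWith _∷_ (dirs d) (words d L)) (cong₂ _*_ (length-dirs d) (length-words d L))

∈-words : ∀ {d} (w : List (Dir d)) → w ∈ words d (length w)
∈-words []      = here refl
∈-words (δ ∷ w) = ∈-cartesianProductWith⁺ _∷_ (∈-dirs δ) (∈-words w)

-- Repetitions are harmless: a length of (2d + 1)^r amounts to O(r log d) bits.
ball : ∀ d → ℕ → List (Point d)
ball d zero    = origin ∷ []
ball d (suc r) = ball d r ++ cartesianProductWith mv (dirs d) (ball d r)

length-ball : ∀ d r → length (ball d r) ≡ suc (2 * d) ^ r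
length-ball d zero    = refl
length-ball d (suc r) = trans (length-++ (ball d r)) (cong₂ _+_ (length-ball d r)
  (trans (length-cartesianProductWith mv (dirs d) (ball d r)) (cong₂ _*_ (length-dirs d) (length-ball d r))))

∈-ball : ∀ {d} r (x : Point d) → dist origin x ≤ r → x ∈ ball d r
∈-ball zero x le = here (sym (dist-zero origin x (n≤0⇒n≡0 le)))
∈-ball {d} (suc r) x le with m≤n⇒m<n∨m≡n le
... | inj₁ (s≤s le') = ∈-++⁺ˡ (∈-ball r x le')
... | inj₂ e with toward x origin (trans (dist-sym x origin) e)
... | δ , h = ∈-++⁺ʳ (ball d r) (subst (_∈ cartesianProductWith mv (dirs d) (ball d r)) (mv-opp δ x)
  (∈-cartesianProductWith⁺ mv (∈-dirs (opp δ)) (∈-ball r (mv δ x) (≤-reflexive (trans (dist-sym origin (mv δ x)) h)))))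

-- Branching over families of covers

thicken : ∀ {d} → List (Point d) → List (Point d)
thicken {d} L = L ++ cartesianProductWith mv (dirs d) L

mv∈thicken : ∀ {d} {L} (δ : Dir d) {x} → x ∈ L → mv δ x ∈ thicken L
mv∈thicken {L = L} δ m = ∈-++⁺ʳ L (∈-cartesianProductWith⁺ mv (∈-dirs δ) m)

⊆thicken : ∀ {d} {L} {x : Point d} → x ∈ L → x ∈ thicken L
⊆thicken = ∈-++⁺ˡ

subset-sum : ∀ {d} {X Y : List (Point d)} (b c : Point d → Dir d → Bool) → Unique X →
  (∀ {x} δ → x ∈ X → b x δ ≡ true → x ∈ Y × c x δ ≡ true) →
  ∑ X (λ x → count (b x) (dirs d)) ≤ ∑ Y (λ y → count (c y) (dirs d))
subset-sum {d} {X} {Y} b c uX h = begin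
  ∑ X (λ x → count (b x) (dirs d))             ≡⟨ ∑-swap X (dirs d) (λ x δ → ind (b x δ)) ⟩
  ∑ (dirs d) (λ δ → count (λ x → b x δ) X)     ≤⟨ ∑-mono (dirs d) (λ {δ} _ → count-rel _≡_ {λ x → b x δ} {λ x → c x δ} uX
                                                   (λ {x} x∈ e → x , proj₁ (h δ x∈ e) , proj₂ (h δ x∈ e) , refl) (λ p q → trans p (sym q))) ⟩
  ∑ (dirs d) (λ δ → count (λ y → c y δ) Y)     ≡⟨ ∑-swap (dirs d) Y (λ δ y → ind (c y δ)) ⟩
  ∑ Y (λ y → count (c y) (dirs d))             ∎
  where open ≤-Reasoning

module Family {d n : ℕ} (d≥2 : 2 ≤ d) {A : Set} (C : A → MinimalCover d n) where

  τ : A → Point d → Bool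
  τ a = MinimalCover.τ (C a)

  independent : ∀ a x δ → τ a x ≡ false → τ a (mv δ x) ≡ true
  independent a = MinimalCover.independent (C a)

  abstract
    mixed : List A → Point d → Bool
    mixed 𝓕 x = some (λ a → τ a x) 𝓕 ∧ some (λ a → not (τ a x)) 𝓕

    mixed⁺ : ∀ {𝓕 x a b} → a ∈ 𝓕 → b ∈ 𝓕 → τ a x ≡ true → τ b x ≡ false → mixed 𝓕 x ≡ true
    mixed⁺ {x = x} a∈ b∈ p q = ∧-true⁺ (some⁺ (λ a → τ a x) a∈ p) (some⁺ (λ a → not (τ a x)) b∈ (cong not q))

    mixed⁻ : ∀ {𝓕 x} → mixed 𝓕 x ≡ true → (∃ λ a → a ∈ 𝓕 × τ a x ≡ true) × (∃ λ b → b ∈ 𝓕 × τ b x ≡ false)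
    mixed⁻ {𝓕} {x} e = some⁻ (λ a → τ a x) 𝓕 (proj₁ (∧-true e)) ,
      (let (b , b∈ , h) = some⁻ (λ a → not (τ a x)) 𝓕 (proj₂ (∧-true {some (λ a → τ a x) 𝓕} e)) in b , b∈ , not-true h)

  infix 4 _⊑_
  _⊑_ : List A → List A → Set
  𝓖 ⊑ 𝓕 = ∀ {a} → a ∈ 𝓖 → a ∈ 𝓕

  mixed-mono : ∀ {𝓖 𝓕} x → 𝓖 ⊑ 𝓕 → mixed 𝓖 x ≡ true → mixed 𝓕 x ≡ true
  mixed-mono x sub e = let ((_ , a∈ , p) , (_ , b∈ , q)) = mixed⁻ e in mixed⁺ (sub a∈) (sub b∈) p q

  constant⇒unmixed : ∀ {𝓕 x} b → (∀ {a} → a ∈ 𝓕 → τ a x ≡ b) → mixed 𝓕 x ≡ false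
  constant⇒unmixed b h = Bool.¬-not λ e → let ((_ , a∈ , p) , (_ , b∈ , q)) = mixed⁻ e in
    true≢false (trans (h b∈) (trans (sym (h a∈)) p)) q

  unmixed⇒equal : ∀ {𝓕 x a b} → mixed 𝓕 x ≡ false → a ∈ 𝓕 → b ∈ 𝓕 → τ a x ≡ τ b x
  unmixed⇒equal {𝓕} {x} {a} {b} e a∈ b∈ with τ a x in p | τ b x in q
  ... | true  | true  = refl
  ... | false | false = refl
  ... | true  | false = true≢false (mixed⁺ a∈ b∈ p q) e
  ... | false | true  = true≢false (mixed⁺ b∈ a∈ q p) e

  Distinct : List A → Set
  Distinct = AllPairs (λ a b → ¬ (∀ x → τ a x ≡ τ b x))

  with-τ without-τ : Point d → List A → List A
  with-τ    x = sel (λ a → τ a x)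
  without-τ x = sel (λ a → not (τ a x))

  sel⊑ : ∀ p 𝓕 → sel p 𝓕 ⊑ 𝓕
  sel⊑ p 𝓕 m = proj₁ (sel⁻ p 𝓕 m)

  sel-distinct : ∀ p {𝓕} → Distinct 𝓕 → Distinct (sel p 𝓕)
  sel-distinct p = AllPairs.filter⁺ (λ a → p a ≟ᵇ true)

  length-halves : ∀ x 𝓕 → length (with-τ x 𝓕) + length (without-τ x 𝓕) ≡ length 𝓕
  length-halves x 𝓕 = trans (cong₂ _+_ (length-sel (λ a → τ a x) 𝓕) (length-sel (λ a → not (τ a x)) 𝓕)) (count-complement (λ a → τ a x) 𝓕)

  with-τ-true : ∀ {x} 𝓕 {a} → a ∈ with-τ x 𝓕 → τ a x ≡ true
  with-τ-true {x} 𝓕 m = proj₂ (sel⁻ (λ a → τ a x) 𝓕 m)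

  without-τ-false : ∀ {x} 𝓕 {a} → a ∈ without-τ x 𝓕 → τ a x ≡ false
  without-τ-false {x} 𝓕 m = not-true (proj₂ (sel⁻ (λ a → not (τ a x)) 𝓕 m))

  with-τ-unmixed : ∀ x 𝓕 → mixed (with-τ x 𝓕) x ≡ false
  with-τ-unmixed x 𝓕 = constant⇒unmixed true (with-τ-true 𝓕)

  without-τ-unmixed : ∀ x 𝓕 → mixed (without-τ x 𝓕) x ≡ false
  without-τ-unmixed x 𝓕 = constant⇒unmixed false (without-τ-false 𝓕)

  without-τ-unmixed-mv : ∀ x δ 𝓕 → mixed (without-τ x 𝓕) (mv δ x) ≡ false
  without-τ-unmixed-mv x δ 𝓕 = constant⇒unmixed true (λ {a} m → independent a x δ (without-τ-false 𝓕 m))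

  module Branching (Λ : List (Point d)) (Λ-unique : Unique Λ) (𝓐 : List A)
    (mixed⇒Λ : ∀ x → mixed 𝓐 x ≡ true → x ∈ Λ) where

    mixed∈Λ : ∀ {𝓕} x → 𝓕 ⊑ 𝓐 → mixed 𝓕 x ≡ true → x ∈ Λ
    mixed∈Λ x sub e = mixed⇒Λ x (mixed-mono x sub e)

    -- The part of the cover `a` that the family does not yet determine; this is the budget spent by
    -- the branchings below.
    cost : List A → A → ℕ
    cost 𝓕 a = count (λ x → mixed 𝓕 x ∧ τ a x) Λ

    mixing : List A → ℕ
    mixing 𝓕 = count (mixed 𝓕) Λ

    cost≤mixing : ∀ 𝓕 a → cost 𝓕 a ≤ mixing 𝓕
    cost≤mixing 𝓕 a = count-mono Λ (λ {x} _ e → proj₁ (∧-true {mixed 𝓕 x} e))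

    cost-sub : ∀ {𝓖 𝓕} a → 𝓖 ⊑ 𝓕 → ∀ x → mixed 𝓖 x ∧ τ a x ≡ true → mixed 𝓕 x ∧ τ a x ≡ true
    cost-sub {𝓖} a sub x e = let (p , q) = ∧-true {mixed 𝓖 x} e in ∧-true⁺ (mixed-mono x sub p) q

    -- Every τ is a minimal vertex cover of the mixed graph, so branching on a mixed vertex x with a mixed neighbour y
    -- reveals a new element of the cover on either side: x itself, or y.
    minimal-covers : ∀ β 𝓕 → 𝓕 ⊑ 𝓐 → Distinct 𝓕 → (∀ {a} → a ∈ 𝓕 → cost 𝓕 a ≤ β) → length 𝓕 ≤ 2 ^ β
    minimal-covers β 𝓕 sub dist𝓕 h with any? (mixed 𝓕) Λ
    ... | inj₂ none = ≤-trans (atMostOne 𝓕 dist𝓕 agree) (m^n>0 2 β)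
      where
      agree : ∀ {a b} → a ∈ 𝓕 → b ∈ 𝓕 → ∀ x → τ a x ≡ τ b x
      agree a∈ b∈ x = unmixed⇒equal (Bool.¬-not (λ e → true≢false e (none (mixed∈Λ x sub e)))) a∈ b∈
      atMostOne : ∀ 𝓕 → Distinct 𝓕 → (∀ {a b} → a ∈ 𝓕 → b ∈ 𝓕 → ∀ x → τ a x ≡ τ b x) → length 𝓕 ≤ 1
      atMostOne []          _ _ = z≤n
      atMostOne (a ∷ [])    _ _ = s≤s z≤n
      atMostOne (a ∷ b ∷ _) ((ne ∷ _) ∷ _) h = ⊥-elim (ne (h (here refl) (there (here refl))))
    ... | inj₁ (x , x∈ , mx) with mixed⁻ mx
    ... | (a , a∈ , ax) , (b , b∈ , bx) with MinimalCover.minimal (C a) x ax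
    ... | δ , ay = go β h
      where
      y = mv δ x
      my : mixed 𝓕 y ≡ true
      my = mixed⁺ b∈ a∈ (independent b x δ bx) ay
      go : ∀ β → (∀ {a} → a ∈ 𝓕 → cost 𝓕 a ≤ β) → length 𝓕 ≤ 2 ^ β
      go zero    h = ⊥-elim (<-irrefl refl (≤-trans (∃⇒count (λ x → mixed 𝓕 x ∧ τ a x) x∈ (∧-true⁺ mx ax)) (h a∈)))
      go (suc β) h = begin
        length 𝓕                                       ≡⟨ sym (length-halves x 𝓕) ⟩
        length (with-τ x 𝓕) + length (without-τ x 𝓕)   ≤⟨ +-mono-≤ left right ⟩
        2 ^ β + 2 ^ β                                  ≡⟨ cong (2 ^ β +_) (sym (+-identityʳ (2 ^ β))) ⟩
        2 ^ suc β                                      ∎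
        where
        open ≤-Reasoning
        left : length (with-τ x 𝓕) ≤ 2 ^ β
        left = minimal-covers β (with-τ x 𝓕) (sub ∘ sel⊑ _ 𝓕) (sel-distinct _ dist𝓕) (λ {a} m → ≤-pred (≤-trans
          (count-strict (λ z → mixed (with-τ x 𝓕) z ∧ τ a z) (λ z → mixed 𝓕 z ∧ τ a z) (λ {z} _ → cost-sub a (sel⊑ _ 𝓕) z) x∈
            (cong (_∧ τ a x) (with-τ-unmixed x 𝓕)) (∧-true⁺ mx (with-τ-true 𝓕 m)))
          (h (sel⊑ _ 𝓕 m))))
        right : length (without-τ x 𝓕) ≤ 2 ^ β
        right = minimal-covers β (without-τ x 𝓕) (sub ∘ sel⊑ _ 𝓕) (sel-distinct _ dist𝓕) (λ {a} m → ≤-pred (≤-trans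
          (count-strict (λ z → mixed (without-τ x 𝓕) z ∧ τ a z) (λ z → mixed 𝓕 z ∧ τ a z) (λ {z} _ → cost-sub a (sel⊑ _ 𝓕) z) (mixed∈Λ y sub my)
            (cong (_∧ τ a y) (without-τ-unmixed-mv x δ 𝓕)) (∧-true⁺ my (independent a x δ (without-τ-false 𝓕 m))))
          (h (sel⊑ _ 𝓕 m))))

    Sparse : ℕ → List A → Set
    Sparse s 𝓕 = ∀ x → mixed 𝓕 x ≡ true → degree (mixed 𝓕) x ≤ s

    -- Deciding τ x at a mixed x with many mixed neighbours: the answer "true" unmixes x, the answer "false" forces all
    -- neighbours into the cover.  There are at most N answers of the first kind and b of the second.
    reveal : ∀ s M D N b 𝓕 → 𝓕 ⊑ 𝓐 → Distinct 𝓕 → mixing 𝓕 ≤ N → (∀ {a} → a ∈ 𝓕 → cost 𝓕 a ≤ b * s) →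
      (∀ 𝓖 → 𝓖 ⊑ 𝓕 → Distinct 𝓖 → Sparse s 𝓖 → length 𝓖 ≤ M) →
      length 𝓕 * D ^ N ≤ suc D ^ (N + b) * M
    reveal s M D N b 𝓕 sub dist𝓕 few cheap done with any? (λ x → mixed 𝓕 x ∧ does (s <? degree (mixed 𝓕) x)) Λ
    ... | inj₂ none = begin
      length 𝓕 * D ^ N      ≤⟨ *-mono-≤ (done 𝓕 id dist𝓕 sparse) (^-monoˡ-≤ N (n≤1+n D)) ⟩
      M * suc D ^ N         ≤⟨ *-monoʳ-≤ M (^-monoʳ-≤ (suc D) (m≤m+n N b)) ⟩
      M * suc D ^ (N + b)   ≡⟨ *-comm M _ ⟩
      suc D ^ (N + b) * M   ∎
      where
      open ≤-Reasoning
      sparse : Sparse s 𝓕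
      sparse x mx = ≮⇒≥ (does-false (s <? _) (trans (sym (cong (_∧ does (s <? degree (mixed 𝓕) x)) mx)) (none (mixed∈Λ x sub mx))))
    ... | inj₁ (x , x∈ , hx) = go N b few cheap
      where
      mx : mixed 𝓕 x ≡ true
      mx = proj₁ (∧-true hx)
      s≤ : s < degree (mixed 𝓕) x
      s≤ = does-true (s <? _) (proj₂ (∧-true {mixed 𝓕 x} hx))
      𝓕₁ = with-τ x 𝓕
      𝓕₀ = without-τ x 𝓕
      gain : ∀ {a} → a ∈ 𝓕₀ → cost 𝓕₀ a + degree (mixed 𝓕) x ≤ cost 𝓕 a
      gain {a} m = begin
        cost 𝓕₀ a + degree (mixed 𝓕) x
          ≤⟨ +-mono-≤ (count-mono Λ (λ {z} _ e → ∧-true⁺ (cost-sub a (sel⊑ _ 𝓕) z e) (proj₁ (∧-true e)))) new ⟩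
        count (λ z → (mixed 𝓕 z ∧ τ a z) ∧ mixed 𝓕₀ z) Λ + count (λ z → (mixed 𝓕 z ∧ τ a z) ∧ not (mixed 𝓕₀ z)) Λ
          ≡⟨ sym (count-split (λ z → mixed 𝓕 z ∧ τ a z) (mixed 𝓕₀) Λ) ⟩
        cost 𝓕 a ∎
        where
        open ≤-Reasoning
        new : degree (mixed 𝓕) x ≤ count (λ z → (mixed 𝓕 z ∧ τ a z) ∧ not (mixed 𝓕₀ z)) Λ
        new = count-rel (λ δ z → z ≡ mv δ x) {λ δ → mixed 𝓕 (mv δ x)} {λ z → (mixed 𝓕 z ∧ τ a z) ∧ not (mixed 𝓕₀ z)} dirs-unique
          (λ {δ} _ e → mv δ x , mixed∈Λ (mv δ x) sub e ,
            ∧-true⁺ (∧-true⁺ e (independent a x δ (without-τ-false 𝓕 m))) (cong not (without-τ-unmixed-mv x δ 𝓕)) , refl)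
          (λ {δ} {ε} p q → mv-dir-injective δ ε x (trans (sym p) q))
      go : ∀ N b → mixing 𝓕 ≤ N → (∀ {a} → a ∈ 𝓕 → cost 𝓕 a ≤ b * s) → length 𝓕 * D ^ N ≤ suc D ^ (N + b) * M
      go zero    b       few cheap = ⊥-elim (<-irrefl refl (≤-trans (∃⇒count (mixed 𝓕) x∈ mx) few))
      go (suc N) zero    few cheap with proj₂ (mixed⁻ mx)
      ... | b , b∈ , bx = ⊥-elim (<-irrefl refl (≤-trans (s≤s z≤n) (≤-trans s≤ (≤-trans (m≤n+m _ (cost 𝓕₀ b))
              (≤-trans (gain (sel⁺ (λ a → not (τ a x)) 𝓕 b∈ (cong not bx))) (cheap b∈))))))
      -- The recursion for the number of answer sequences is solved by weights: a positive answer
      -- weighs D / (D + 1), a negative one 1 / (D + 1), and the two add up to one. This replaces a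
      -- binomial coefficient.
      go (suc N) (suc b) few cheap = begin
        length 𝓕 * (D * D ^ N)                                     ≡⟨ cong (_* (D * D ^ N)) (sym (length-halves x 𝓕)) ⟩
        (length 𝓕₁ + length 𝓕₀) * (D * D ^ N)                      ≡⟨ solve 4 (λ u v w e → (u :+ v) :* (w :* e) := w :* (u :* e) :+ v :* (w :* e)) refl (length 𝓕₁) (length 𝓕₀) D (D ^ N) ⟩
        D * (length 𝓕₁ * D ^ N) + length 𝓕₀ * (D * D ^ N)          ≤⟨ +-mono-≤ (*-monoʳ-≤ D left) right ⟩
        D * (suc D ^ (N + suc b) * M) + suc D ^ (suc N + b) * M    ≡⟨ cong (λ k → D * (suc D ^ (N + suc b) * M) + suc D ^ k * M) (sym (+-suc N b)) ⟩
        D * (suc D ^ (N + suc b) * M) + suc D ^ (N + suc b) * M    ≡⟨ solve 3 (λ w p m → w :* (p :* m) :+ p :* m := (con 1 :+ w) :* p :* m) refl D (suc D ^ (N + suc b)) M ⟩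
        suc D * suc D ^ (N + suc b) * M                            ∎
        where
        open ≤-Reasoning
        open +-*-Solver
        left : length 𝓕₁ * D ^ N ≤ suc D ^ (N + suc b) * M
        left = reveal s M D N (suc b) 𝓕₁ (sub ∘ sel⊑ _ 𝓕) (sel-distinct _ dist𝓕)
          (≤-pred (≤-trans (count-strict (mixed 𝓕₁) (mixed 𝓕) (λ {z} _ → mixed-mono z (sel⊑ _ 𝓕)) x∈ (with-τ-unmixed x 𝓕) mx) few))
          (λ {a} m → ≤-trans (count-mono Λ (λ {z} _ → cost-sub a (sel⊑ _ 𝓕) z)) (cheap (sel⊑ _ 𝓕 m)))
          (λ 𝓖 sub' → done 𝓖 (sel⊑ _ 𝓕 ∘ sub'))
        right : length 𝓕₀ * (D * D ^ N) ≤ suc D ^ (suc N + b) * M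
        right = reveal s M D (suc N) b 𝓕₀ (sub ∘ sel⊑ _ 𝓕) (sel-distinct _ dist𝓕)
          (≤-trans (count-mono Λ (λ {z} _ → mixed-mono z (sel⊑ _ 𝓕))) few)
          (λ {a} m → +-cancelʳ-≤ s (cost 𝓕₀ a) (b * s) (≤-trans (+-monoʳ-≤ (cost 𝓕₀ a) (<⇒≤ s≤))
            (≤-trans (gain m) (≤-trans (cheap (sel⊑ _ 𝓕 m)) (≤-reflexive (+-comm s (b * s)))))))
          (λ 𝓖 sub' → done 𝓖 (sel⊑ _ 𝓕 ∘ sub'))

    -- A mixed vertex of the cover τ a has all its unmixed neighbours in the cover, so it lies on at least 2d - s edges
    -- leading to unmixed vertices; the factor 2 in edge-sum cancels against the two orientations.
    sparse-cost : ∀ s {𝓕 a} → 𝓕 ⊑ 𝓐 → a ∈ 𝓕 → Sparse s 𝓕 → cost 𝓕 a * (2 * d ∸ s) ≤ n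
    sparse-cost s {𝓕} {a} sub a∈ sparse = *-cancelˡ-≤ 2 (begin
      2 * (cost 𝓕 a * (2 * d ∸ s))       ≡⟨ cong (λ k → 2 * (k * (2 * d ∸ s))) (sym (length-sel inZ Λ)) ⟩
      2 * (length Z * (2 * d ∸ s))       ≤⟨ *-monoʳ-≤ 2 (∑-≥-const Z many) ⟩
      2 * E₁                             ≡⟨ cong (E₁ +_) (+-identityʳ E₁) ⟩
      E₁ + E₁                            ≤⟨ +-mono-≤ out inn ⟩
      ∑ X (λ x → count (b₁ x) (dirs d)) + ∑ X (λ x → count (b₂ x) (dirs d)) ≡⟨ sym (∑-+ X _ _) ⟩
      ∑ X (λ x → count (b₁ x) (dirs d) + count (b₂ x) (dirs d)) ≤⟨ ∑-mono X (λ {x} m → ≤-trans (≤-reflexive (sym (∑-+ (dirs d) _ _))) (∑-mono (dirs d) (λ {δ} _ → both x δ))) ⟩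
      ∑ X (degree (τ a))                 ≤⟨ MinimalCover.edge-sum (C a) X (sel-unique (τ a) (deduplicate-! _≟ᴾ_ (thicken Λ))) (λ m → proj₂ (sel⁻ (τ a) Λ⁺ m)) ⟩
      2 * n                              ∎)
      where
      open ≤-Reasoning
      inZ : Point d → Bool
      inZ x = mixed 𝓕 x ∧ τ a x
      Z = sel inZ Λ
      Λ⁺ = deduplicate _≟ᴾ_ (thicken Λ)
      X = sel (τ a) Λ⁺
      b₁ b₂ : Point d → Dir d → Bool
      b₁ x δ = mixed 𝓕 x ∧ (not (mixed 𝓕 (mv δ x)) ∧ τ a (mv δ x))
      b₂ x δ = not (mixed 𝓕 x) ∧ (mixed 𝓕 (mv δ x) ∧ τ a (mv δ x))
      E₁ = ∑ Z (λ x → count (b₁ x) (dirs d))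
      Z-true : ∀ {x} → x ∈ Z → x ∈ Λ × mixed 𝓕 x ≡ true × τ a x ≡ true
      Z-true {x} m = let (x∈ , h) = sel⁻ inZ Λ m in x∈ , ∧-true h
      both : ∀ x δ → ind (b₁ x δ) + ind (b₂ x δ) ≤ ind (τ a (mv δ x))
      both x δ with mixed 𝓕 x | mixed 𝓕 (mv δ x) | τ a (mv δ x)
      ... | true  | true  | t     = z≤n
      ... | true  | false | true  = ≤-refl
      ... | true  | false | false = z≤n
      ... | false | true  | t     = ≤-refl
      ... | false | false | t     = z≤n
      forced : ∀ x δ → mixed 𝓕 x ≡ true → mixed 𝓕 (mv δ x) ≡ false → τ a (mv δ x) ≡ true
      forced x δ mx my = let (_ , (b , b∈ , bx)) = mixed⁻ mx in trans (unmixed⇒equal my a∈ b∈) (independent b x δ bx)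
      many : ∀ {x} → x ∈ Z → 2 * d ∸ s ≤ count (b₁ x) (dirs d)
      many {x} m = begin
        2 * d ∸ s                              ≤⟨ ∸-monoʳ-≤ (2 * d) (sparse x (proj₁ (proj₂ (Z-true m)))) ⟩
        2 * d ∸ degree (mixed 𝓕) x             ≡⟨ cong (_∸ degree (mixed 𝓕) x) (trans (sym (length-dirs d)) (sym (count-complement (λ δ → mixed 𝓕 (mv δ x)) (dirs d)))) ⟩
        degree (mixed 𝓕) x + degree (not ∘ mixed 𝓕) x ∸ degree (mixed 𝓕) x ≡⟨ m+n∸m≡n (degree (mixed 𝓕) x) _ ⟩
        degree (not ∘ mixed 𝓕) x               ≤⟨ count-mono (dirs d) (λ {δ} _ e → ∧-true⁺ (proj₁ (proj₂ (Z-true m))) (∧-true⁺ e (forced x δ (proj₁ (proj₂ (Z-true m))) (not-true e)))) ⟩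
        count (b₁ x) (dirs d)                  ∎
      out : E₁ ≤ ∑ X (λ x → count (b₁ x) (dirs d))
      out = subset-sum b₁ b₁ (sel-unique inZ Λ-unique) (λ δ m e → let (x∈ , mx , ax) = Z-true m in
        sel⁺ (τ a) Λ⁺ (∈-deduplicate⁺ _≟ᴾ_ (⊆thicken x∈)) ax , e)
      inn : E₁ ≤ ∑ X (λ x → count (b₂ x) (dirs d))
      inn = double-count b₁ b₂ (sel-unique inZ Λ-unique) (λ {x} δ m e → let
          (x∈ , mx , ax) = Z-true m
          (ny , ay) = ∧-true {not (mixed 𝓕 (mv δ x))} (proj₂ (∧-true {mixed 𝓕 x} e))
        in sel⁺ (τ a) Λ⁺ (∈-deduplicate⁺ _≟ᴾ_ (mv∈thicken δ x∈)) ay ,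
        ∧-true⁺ ny (∧-true⁺ (trans (cong (mixed 𝓕) (mv-opp δ x)) mx) (trans (cong (τ a) (mv-opp δ x)) ax)))

    module Labelling (H : List (Point d))
      (away : ∀ {a} → a ∈ 𝓐 → ∀ x δ → x ∉ H → mv δ x ∉ H → τ a (mv δ x) ≡ not (τ a x)) where

      inH good : Point d → Bool
      inH x = x ∈ᵇ H
      -- Off H, with enough neighbours in its own component for `isoperimetry` to apply to that
      -- component.
      good x = not (inH x) ∧ does (d ≤? degree (not ∘ inH) x)

      -- Counts the edges from H to mixed vertices, a resource that each decided component depletes.
      Φ : List A → ℕ
      Φ 𝓕 = ∑ H (degree (mixed 𝓕))

      Labelled : List A → Set
      Labelled 𝓕 = ∀ x → mixed 𝓕 x ≡ true → good x ≡ false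

      mixed-away⁺ : ∀ {𝓕} → 𝓕 ⊑ 𝓐 → ∀ x δ → inH x ≡ false → inH (mv δ x) ≡ false → mixed 𝓕 x ≡ true → mixed 𝓕 (mv δ x) ≡ true
      mixed-away⁺ sub x δ p q e = let ((_ , a∈ , ax) , (_ , b∈ , bx)) = mixed⁻ e in
        mixed⁺ b∈ a∈ (trans (away (sub b∈) x δ (∉ᵇ⁻ p) (∉ᵇ⁻ q)) (cong not bx)) (trans (away (sub a∈) x δ (∉ᵇ⁻ p) (∉ᵇ⁻ q)) (cong not ax))

      mixed-away : ∀ {𝓕} → 𝓕 ⊑ 𝓐 → ∀ x δ → inH x ≡ false → inH (mv δ x) ≡ false → mixed 𝓕 x ≡ mixed 𝓕 (mv δ x)
      mixed-away {𝓕} sub x δ p q = Bool-ext (mixed-away⁺ sub x δ p q) λ e →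
        trans (cong (mixed 𝓕) (sym (mv-opp δ x))) (mixed-away⁺ sub (mv δ x) (opp δ) q (trans (cong inH (mv-opp δ x)) p) e)

      -- Deciding the label of x decides a whole component of the complement of H, whose edge boundary is at least d²
      -- and consists of edges leaving H.
      potential-drop : ∀ {𝓖 𝓕} x → 𝓕 ⊑ 𝓐 → 𝓖 ⊑ 𝓕 → good x ≡ true → mixed 𝓕 x ≡ true → mixed 𝓖 x ≡ false → Φ 𝓖 + d * d ≤ Φ 𝓕
      potential-drop {𝓖} {𝓕} x sub sub' gx mx nx = begin
        Φ 𝓖 + d * d ≤⟨ +-monoʳ-≤ (Φ 𝓖) (R.isoperimetry x d≥2 many) ⟩
        Φ 𝓖 + R.boundary ≤⟨ +-mono-≤ (∑-mono H (λ {h} _ → count-mono (dirs d) (λ {δ} _ e → ∧-true⁺ (mixed-mono _ sub' e) e))) exits ⟩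
        ∑ H (λ h → count (λ δ → mixed 𝓕 (mv δ h) ∧ mixed 𝓖 (mv δ h)) (dirs d)) + ∑ H (λ h → count (λ δ → mixed 𝓕 (mv δ h) ∧ not (mixed 𝓖 (mv δ h))) (dirs d))
          ≡⟨ sym (∑-+ H _ _) ⟩
        ∑ H (λ h → count (λ δ → mixed 𝓕 (mv δ h) ∧ mixed 𝓖 (mv δ h)) (dirs d) + count (λ δ → mixed 𝓕 (mv δ h) ∧ not (mixed 𝓖 (mv δ h))) (dirs d))
          ≡⟨ ∑-cong H (λ h → sym (count-split (λ δ → mixed 𝓕 (mv δ h)) (λ δ → mixed 𝓖 (mv δ h)) (dirs d))) ⟩
        Φ 𝓕 ∎
        where
        open ≤-Reasoning
        -- The region newly decided. Mixedness is constant along edges off H for both families, so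
        -- the region is a union of components there and all its boundary edges end in H.
        p : Point d → Bool
        p y = not (inH y) ∧ (mixed 𝓕 y ∧ not (mixed 𝓖 y))
        p⇒Λ : ∀ {y} → p y ≡ true → y ∈ sel p Λ
        p⇒Λ {y} e = sel⁺ p Λ (mixed∈Λ y sub (proj₁ (∧-true (proj₂ (∧-true {not (inH y)} e))))) e
        module R = Region p (sel p Λ) p⇒Λ
        x∉H : inH x ≡ false
        x∉H = not-true (proj₁ (∧-true gx))
        many : d ≤ degree p x
        many = ≤-trans (does-true (d ≤? _) (proj₂ (∧-true {not (inH x)} gx))) (count-mono (dirs d) (λ {δ} _ e →
          ∧-true⁺ e (∧-true⁺ (trans (sym (mixed-away sub x δ x∉H (not-true e))) mx)
                             (cong not (trans (sym (mixed-away (sub ∘ sub') x δ x∉H (not-true e))) nx)))))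
        exits : R.boundary ≤ ∑ H (λ h → count (λ δ → mixed 𝓕 (mv δ h) ∧ not (mixed 𝓖 (mv δ h))) (dirs d))
        exits = double-count (λ y δ → p y ∧ not (p (mv δ y))) (λ h δ → mixed 𝓕 (mv δ h) ∧ not (mixed 𝓖 (mv δ h))) (sel-unique p Λ-unique)
          (λ {y} δ _ e → let
              (py , npy') = ∧-true {p y} e
              (ny , my) = ∧-true {not (inH y)} py
            in ∈ᵇ⁻ (hit y δ py (not-true npy')) , trans (cong (λ z → mixed 𝓕 z ∧ not (mixed 𝓖 z)) (mv-opp δ y)) my)
          where
          hit : ∀ y δ → p y ≡ true → p (mv δ y) ≡ false → inH (mv δ y) ≡ true
          hit y δ py npy' with inH (mv δ y) in q
          ... | true  = refl
          ... | false = true≢false (trans (cong₂ (λ u v → u ∧ not v) (sym (mixed-away sub y δ yH q)) (sym (mixed-away (sub ∘ sub') y δ yH q))) (proj₂ (∧-true {not (inH y)} py))) npy'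
            where
            yH : inH y ≡ false
            yH = not-true (proj₁ (∧-true py))

      -- Either value of τ at x unmixes x, so both branches lower Φ by d² and the depth is at most
      -- k.
      label : ∀ M k 𝓕 → 𝓕 ⊑ 𝓐 → Distinct 𝓕 → Φ 𝓕 ≤ k * (d * d) →
        (∀ 𝓖 → 𝓖 ⊑ 𝓕 → Distinct 𝓖 → Labelled 𝓖 → length 𝓖 ≤ M) → length 𝓕 ≤ 2 ^ k * M
      label M k 𝓕 sub dist𝓕 Φ≤ done with any? (λ x → mixed 𝓕 x ∧ good x) Λ
      ... | inj₂ none = ≤-trans (done 𝓕 id dist𝓕 labelled) (≤-trans (≤-reflexive (sym (*-identityˡ M))) (*-monoˡ-≤ M (m^n>0 2 k)))
        where
        labelled : Labelled 𝓕
        labelled x mx = trans (sym (cong (_∧ good x) mx)) (none (mixed∈Λ x sub mx))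
      ... | inj₁ (x , x∈ , hx) = go k Φ≤
        where
        mx = proj₁ (∧-true hx)
        gx = proj₂ (∧-true {mixed 𝓕 x} hx)
        go : ∀ k → Φ 𝓕 ≤ k * (d * d) → length 𝓕 ≤ 2 ^ k * M
        go zero    Φ≤ = ⊥-elim (<-irrefl refl (≤-trans (*-mono-≤ (≤-trans (s≤s z≤n) d≥2) (≤-trans (s≤s z≤n) d≥2))
          (≤-trans (m≤n+m (d * d) (Φ (with-τ x 𝓕))) (≤-trans (potential-drop x sub (sel⊑ _ 𝓕) gx mx (with-τ-unmixed x 𝓕)) Φ≤))))
        go (suc k) Φ≤ = begin
          length 𝓕                                     ≡⟨ sym (length-halves x 𝓕) ⟩
          length (with-τ x 𝓕) + length (without-τ x 𝓕) ≤⟨ +-mono-≤ (half (λ a → τ a x) (with-τ-unmixed x 𝓕)) (half (λ a → not (τ a x)) (without-τ-unmixed x 𝓕)) ⟩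
          2 ^ k * M + 2 ^ k * M                        ≡⟨ solve 2 (λ p m → p :* m :+ p :* m := con 2 :* p :* m) refl (2 ^ k) M ⟩
          2 ^ suc k * M                                ∎
          where
          open ≤-Reasoning
          open +-*-Solver
          half : ∀ p → mixed (sel p 𝓕) x ≡ false → length (sel p 𝓕) ≤ 2 ^ k * M
          half p un = label M k (sel p 𝓕) (sub ∘ sel⊑ p 𝓕) (sel-distinct p dist𝓕)
            (+-cancelʳ-≤ (d * d) _ _ (≤-trans (potential-drop x sub (sel⊑ p 𝓕) gx mx un) (≤-trans Φ≤ (≤-reflexive (+-comm (d * d) (k * (d * d)))))))
            (λ 𝓖 sub' → done 𝓖 (sel⊑ p 𝓕 ∘ sub'))

      -- A mixed vertex off H is no longer good, so at least d of its 2d neighbours lie in H. Only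
      -- 2d |H| edges leave H, which leaves room for at most 2|H| such vertices.
      labelled-mixing : ∀ 𝓕 → 𝓕 ⊑ 𝓐 → Labelled 𝓕 → mixing 𝓕 ≤ 3 * length H
      labelled-mixing 𝓕 sub labelled = begin
        mixing 𝓕                                  ≤⟨ ≤-trans (∑-mono Λ (λ {x} _ → cases x)) (≤-reflexive (∑-+ Λ _ _)) ⟩
        count inH Λ + count bad Λ                 ≤⟨ +-mono-≤ H-count bad-count ⟩
        length H + 2 * length H                   ≡⟨⟩
        3 * length H                              ∎
        where
        open ≤-Reasoning
        bad : Point d → Bool
        bad x = does (d ≤? degree inH x)
        cases : ∀ x → ind (mixed 𝓕 x) ≤ ind (inH x) + ind (bad x)
        cases x with mixed 𝓕 x in mx | inH x in hx
        ... | false | _    = z≤n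
        ... | true  | true = s≤s z≤n
        ... | true  | false = ≤-reflexive (cong ind (sym (does-yes (d ≤? degree inH x) big)))
          where
          small : degree (not ∘ inH) x < d
          small = ≰⇒> (does-false (d ≤? _) (trans (cong (λ b → not b ∧ does (d ≤? degree (not ∘ inH) x)) (sym hx)) (labelled x mx)))
          big : d ≤ degree inH x
          big = +-cancelʳ-≤ d d (degree inH x) (begin
            d + d ≡⟨ cong (d +_) (sym (+-identityʳ d)) ⟩
            2 * d ≡⟨ sym (trans (count-complement (λ δ → inH (mv δ x)) (dirs d)) (length-dirs d)) ⟩
            degree inH x + degree (not ∘ inH) x ≤⟨ +-monoʳ-≤ (degree inH x) (<⇒≤ small) ⟩
            degree inH x + d ∎)
        H-count : count inH Λ ≤ length H
        H-count = ≤-trans (count-rel _≡_ {inH} {λ _ → true} Λ-unique (λ {x} _ e → x , ∈ᵇ⁻ e , refl , refl) (λ p q → trans p (sym q))) (≤-reflexive (count-true H))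
        bad-count : count bad Λ ≤ 2 * length H
        bad-count = *-cancelʳ-≤ (count bad Λ) (2 * length H) d {{>-nonZero (≤-trans (s≤s z≤n) d≥2)}} (begin
          count bad Λ * d              ≡⟨ cong (_* d) (sym (length-sel bad Λ)) ⟩
          length (sel bad Λ) * d       ≤⟨ ∑-≥-const (sel bad Λ) (λ {x} m → does-true (d ≤? _) (proj₂ (sel⁻ bad Λ m))) ⟩
          ∑ (sel bad Λ) (degree inH)   ≤⟨ double-count (λ x δ → inH (mv δ x)) (λ _ _ → true) (sel-unique bad Λ-unique) (λ δ _ e → ∈ᵇ⁻ e , refl) ⟩
          ∑ H (λ _ → count (λ _ → true) (dirs d)) ≡⟨ ∑-const H _ ⟩
          length H * count (λ _ → true) (dirs d)  ≡⟨ cong (length H *_) (trans (count-true (dirs d)) (length-dirs d)) ⟩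
          length H * (2 * d)           ≡⟨ trans (sym (*-assoc (length H) 2 d)) (cong (_* d) (*-comm (length H) 2)) ⟩
          2 * length H * d             ∎)

      Φ-bound : ∀ 𝓕 → Φ 𝓕 ≤ length H * (2 * d)
      Φ-bound 𝓕 = ∑-≤-const H (λ {h} _ → ≤-trans (count≤length _ (dirs d)) (≤-reflexive (length-dirs d)))

-- Encoding one cutset

length-filter-does : {A : Set} {P : A → Set} (P? : Decidable P) (xs : List A) → length (filter P? xs) ≡ count (does ∘ P?) xs
length-filter-does P? []       = refl
length-filter-does P? (x ∷ xs) with does (P? x)
... | true  = cong suc (length-filter-does P? xs)
... | false = length-filter-does P? xs

sum-map : {A : Set} (f : A → ℕ) (xs : List A) → sum (map f xs) ≡ ∑ xs f
sum-map f []       = refl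
sum-map f (x ∷ xs) = cong (f x +_) (sum-map f xs)

boundarySize-∑ : ∀ {d} (S : FinSet d) → boundarySize S ≡ ∑ S (degree (λ y → not (y ∈ᵇ S)))
boundarySize-∑ {d} S = trans (sum-map (λ x → length (filter out? (neighbours x))) S) (∑-cong S λ x →
  trans (length-filter-does out? (neighbours x))
  (trans (∑-cong (neighbours x) (λ y → cong (ind ∘ not) (sym (∈ᵇ-does y S))))
  (trans (cong (count (λ y → not (y ∈ᵇ S))) (neighbours-dirs x)) (∑-map (λ δ → mv δ x) (dirs d) (λ y → ind (not (y ∈ᵇ S)))))))
  where
  out? : Decidable (λ (y : Point d) → y ∉ S)
  out? y = ¬? (_∈?ᵍ_ (Vec-≡-dec ℤ._≟_) y S)

PathIn-map : ∀ {d r} {P Q : Point d → Set} → (∀ {x} → P x → Q x) → ∀ {x y} → PathIn r P x y → PathIn r Q x y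
PathIn-map h (stay p)      = stay (h p)
PathIn-map h (jump p le w) = jump (h p) le (PathIn-map h w)

halo : ∀ {d} → Point d → List (Dir d) → List (Point d)
halo {d} p w = cartesianProductWith mv (dirs d) (visits p w)

-- τ marks the odd points of S and the even points outside S: a vertex cover of ℤ^d whose internal edges are the boundary edges of S.
cover : ∀ {d} → FinSet d → Point d → Bool
cover S x = not ((x ∈ᵇ S) xor par x)

module Member {d n r : ℕ} (d≥2 : 2 ≤ d) (S : FinSet d) (S∈C : InC d n r S) where

  σ τ : Point d → Bool
  σ = _∈ᵇ S
  τ = cover S

  odd-boundary : ∀ x δ → σ x ≡ true → σ (mv δ x) ≡ false → par x ≡ true
  odd-boundary x δ p q = odd⇒par x (proj₁ S∈C x (∈ᵇ⁻ p) (mv δ x , dist-mv δ x , ∉ᵇ⁻ q))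

  τ-same : ∀ x δ → σ (mv δ x) ≡ σ x → τ (mv δ x) ≡ not (τ x)
  τ-same x δ e = cong not (trans (cong₂ _xor_ e (par-mv δ x)) (sym (Bool.not-distribʳ-xor (σ x) (par x))))

  τ-differ : ∀ x δ → σ (mv δ x) ≢ σ x → τ (mv δ x) ≡ τ x
  τ-differ x δ ne = cong not (trans (cong₂ _xor_ (Bool.¬-not ne) (par-mv δ x)) (Bool.xor-annihilates-not (σ x) (par x)))

  -- Off the cover lie the even points of S and the odd points of its complement. Neither meets a
  -- boundary edge, whose endpoint in S is odd and whose other endpoint is even.
  τ-false : ∀ x δ → τ x ≡ false → σ (mv δ x) ≡ σ x
  τ-false x δ e with σ x in p | par x in q | σ (mv δ x) in s
  ... | true  | false | true  = refl
  ... | true  | false | false = true≢false (odd-boundary x δ p s) q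
  ... | false | true  | false = refl
  ... | false | true  | true  = true≢false (odd-boundary (mv δ x) (opp δ) s (trans (cong σ (mv-opp δ x)) p)) (trans (par-mv δ x) (cong not q))

  regular : ∀ x → ∃ λ δ → σ (mv δ x) ≡ σ x
  regular x with σ x in p | proj₁ (proj₂ (proj₁ (proj₂ S∈C)))
  ... | true  | inside , _ with inside x (∈ᵇ⁻ p)
  ... | y , a , y∈ with adj⇒mv x y a
  ... | δ , refl = δ , ∈ᵇ⁺ y∈
  regular x | false | _ , outside with outside x (∉ᵇ⁻ p)
  ... | y , a , y∉ with adj⇒mv x y a
  ... | δ , refl = δ , Bool.¬-not (λ e → y∉ (∈ᵇ⁻ e))

  edge⇒differ : ∀ x δ → τ x ≡ true → τ (mv δ x) ≡ true → σ x ≢ σ (mv δ x)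
  edge⇒differ x δ p q e = true≢false q (trans (τ-same x δ (sym e)) (cong not p))

  differ⇒edge : ∀ x δ → σ x ≢ σ (mv δ x) → τ x ≡ true × τ (mv δ x) ≡ true
  differ⇒edge x δ ne with τ x in e
  ... | false = ⊥-elim (ne (sym (τ-false x δ e)))
  ... | true  = refl , trans (τ-differ x δ (ne ∘ sym)) e

  boundary≡n : ∑ S (degree (not ∘ σ)) ≡ n
  boundary≡n = trans (sym (boundarySize-∑ S)) (proj₁ (proj₂ (proj₂ S∈C)))

  -- Edges inside the cover are boundary edges of S; those leaving S and those entering it
  -- contribute at most n each.
  τ-edge-sum : ∀ X → Unique X → (∀ {x} → x ∈ X → τ x ≡ true) → ∑ X (degree τ) ≤ 2 * n
  τ-edge-sum X uX X-true = begin
    ∑ X (degree τ)                        ≤⟨ ∑-mono X split ⟩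
    ∑ X (λ x → count (out x) (dirs d) + count (inn x) (dirs d)) ≡⟨ ∑-+ X _ _ ⟩
    ∑ X (λ x → count (out x) (dirs d)) + ∑ X (λ x → count (inn x) (dirs d)) ≤⟨ +-mono-≤ inside outside ⟩
    ∑ S (degree (not ∘ σ)) + ∑ S (degree (not ∘ σ)) ≡⟨ cong₂ _+_ boundary≡n (trans boundary≡n (sym (+-identityʳ n))) ⟩
    2 * n ∎
    where
    open ≤-Reasoning
    out inn : Point d → Dir d → Bool
    out x δ = σ x ∧ not (σ (mv δ x))
    inn x δ = not (σ x) ∧ σ (mv δ x)
    split : ∀ {x} → x ∈ X → degree τ x ≤ count (out x) (dirs d) + count (inn x) (dirs d)
    split {x} x∈ = ≤-trans (∑-mono (dirs d) (λ {δ} _ → one δ)) (≤-reflexive (∑-+ (dirs d) _ _))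
      where
      one : ∀ δ → ind (τ (mv δ x)) ≤ ind (out x δ) + ind (inn x δ)
      one δ with τ (mv δ x) in e
      ... | false = z≤n
      ... | true with σ x | σ (mv δ x) | edge⇒differ x δ (X-true x∈) e
      ... | true  | true  | ne = ⊥-elim (ne refl)
      ... | true  | false | _  = s≤s z≤n
      ... | false | true  | _  = s≤s z≤n
      ... | false | false | ne = ⊥-elim (ne refl)
    inside : ∑ X (λ x → count (out x) (dirs d)) ≤ ∑ S (degree (not ∘ σ))
    inside = subset-sum out (λ x δ → not (σ (mv δ x))) uX
      (λ {x} δ _ h → let (a , b) = ∧-true {σ x} h in ∈ᵇ⁻ a , b)
    outside : ∑ X (λ x → count (inn x) (dirs d)) ≤ ∑ S (degree (not ∘ σ))
    outside = double-count inn (λ y δ → not (σ (mv δ y))) uX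
      (λ {x} δ _ h → let (a , b) = ∧-true {not (σ x)} h in ∈ᵇ⁻ b , trans (cong (not ∘ σ) (mv-opp δ x)) a)

  minimalCover : MinimalCover d n
  minimalCover = record
    { τ = τ
    ; independent = λ x δ e → trans (τ-same x δ (τ-false x δ e)) (cong not e)
    -- This is what regularity provides: a neighbour on the same side of S has the opposite value of
    -- τ.
    ; minimal = λ x e → let (δ , h) = regular x in δ , trans (τ-same x δ h) (cong not e)
    ; edge-sum = τ-edge-sum
    }

  open MinimalCover minimalCover using (independent; minimal; Edge)

  module R = Region σ S ∈ᵇ⁻

  boundary≤n : R.boundary ≤ n
  boundary≤n = ≤-trans (∑-mono S (λ {y} _ → count-mono (dirs d) (λ {δ} _ h → proj₂ (∧-true {σ y} h)))) (≤-reflexive boundary≡n)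

  x₀ : Point d
  x₀ = proj₁ (proj₂ (proj₂ (proj₂ S∈C)))

  x₀∈S : σ x₀ ≡ true
  x₀∈S = ∈ᵇ⁺ (proj₁ (proj₂ (proj₂ (proj₂ (proj₂ S∈C)))))

  -- Either x₀ or, by regularity, a neighbour of it in S is an even point, and all neighbours of an
  -- even point of S lie in S. The bound later absorbs the terms of the exponent that do not grow
  -- with n.
  d²≤n : d * d ≤ n
  d²≤n = ≤-trans (go (τ x₀) refl) boundary≤n
    where
    centre : ∀ x → σ x ≡ true → τ x ≡ false → d * d ≤ R.boundary
    centre x p e = R.isoperimetry x d≥2 (begin
      d ≤⟨ m≤m+n d _ ⟩
      2 * d ≡⟨ sym (trans (count-true (dirs d)) (length-dirs d)) ⟩
      count (λ _ → true) (dirs d) ≤⟨ count-mono (dirs d) (λ {δ} _ _ → trans (τ-false x δ e) p) ⟩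
      count (λ δ → σ (mv δ x)) (dirs d) ∎)
      where open ≤-Reasoning
    go : ∀ b → τ x₀ ≡ b → d * d ≤ R.boundary
    go false e = centre x₀ x₀∈S e
    go true  e = let (δ , h) = regular x₀ in centre (mv δ x₀) (trans h x₀∈S) (trans (τ-same x₀ δ h) (cong not e))

  -- One thickening reaches the endpoints of all boundary edges, the second their neighbours.
  Λ : List (Point d)
  Λ = deduplicate _≟ᴾ_ (thicken (thicken S))

  Λ-near : ∀ x δ → Edge x δ → x ∈ Λ × (∀ ε → mv ε x ∈ Λ)
  Λ-near x δ (p , q) = ∈-deduplicate⁺ _≟ᴾ_ (⊆thicken x∈) , λ ε → ∈-deduplicate⁺ _≟ᴾ_ (mv∈thicken ε x∈)
    where
    x∈ : x ∈ thicken S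
    x∈ with σ x in a | σ (mv δ x) in b | edge⇒differ x δ p q
    ... | true  | _     | _  = ⊆thicken (∈ᵇ⁻ a)
    ... | false | true  | _  = subst (_∈ thicken S) (mv-opp δ x) (mv∈thicken (opp δ) (∈ᵇ⁻ b))
    ... | false | false | ne = ⊥-elim (ne refl)

  connected : ∀ s x y → σ x ≡ s → σ y ≡ s → PathIn r (λ z → σ z ≡ s) x y
  connected true  x y p q = PathIn-map ∈ᵇ⁺ (proj₁ (proj₂ (proj₂ (proj₁ (proj₂ S∈C)))) x y (∈ᵇ⁻ p) (∈ᵇ⁻ q))
  connected false x y p q = PathIn-map (λ h → Bool.¬-not (h ∘ ∈ᵇ⁻)) (proj₂ (proj₂ (proj₂ (proj₁ (proj₂ S∈C)))) x y (∉ᵇ⁻ p) (∉ᵇ⁻ q))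

  e₀ : Dir d
  e₀ = fromℕ< (≤-trans (s≤s z≤n) d≥2) , true

  module Encode (t J M z : ℕ) (t≥1 : 1 ≤ t) (t≤d : t ≤ d) (d≤2^J : d ≤ 2 ^ J)
    (≤M : ∀ a b → a * d * t ≤ suc J * (8 * n) → b * d * d ≤ 4 * n * t → a + b ≤ M)
    (≤z : ∀ D → suc D * d ≤ n → D ≤ z) where

    radius : ℕ
    radius = (2 + suc r) + (suc r + 2)

    -- The tour has to start near U, but only a point of S near the origin is at hand. The straight
    -- run from that point to the boundary is recorded by its length, at most z.
    Code : Set
    Code = ∃ λ p → ∃ λ w → p ∈ cartesianProductWith (λ x D → shift D e₀ x) (ball d r) (upTo (suc z))
      × length w ≡ M * (2 * radius)
      × (∀ x δ → σ x ≢ σ (mv δ x) → x ∈ halo p w ⊎ mv δ x ∈ halo p w)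

    encode : ∀ U → (∀ {u} → u ∈ U → ∃ λ b → dist u b ≤ 1 × ∃ (Edge b)) →
      (∀ x δ → Edge x δ → ∃ λ u → u ∈ U × (dist u x ≡ 1 ⊎ dist u (mv δ x) ≡ 1)) → length U ≤ M →
      ∀ D → (∀ {i} → i ≤ D → σ (shift i e₀ x₀) ≡ true) → σ (mv e₀ (shift D e₀ x₀)) ≡ false → Code
    encode U close dominated |U|≤M D run exit = p , proj₁ padded , p∈ , proj₁ (proj₂ padded) , separates
      where
      p = shift D e₀ x₀
      p∈ : p ∈ cartesianProductWith (λ x D → shift D e₀ x) (ball d r) (upTo (suc z))
      p∈ = ∈-cartesianProductWith⁺ (λ x D → shift D e₀ x)
        (∈-ball r x₀ (proj₂ (proj₂ (proj₂ (proj₂ (proj₂ S∈C))))))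
        -- A run of D + 1 points in S forces (D + 1) d boundary edges.
        (∈-upTo⁺ (s≤s (≤z D (≤-trans (R.straight-run _ _ x₀ D d≥2 run) boundary≤n))))
      near : ∀ a δ → σ a ≢ σ (mv δ a) → ∃ λ u → u ∈ U × dist u a ≤ 2
      near a δ ne with dominated a δ (differ⇒edge a δ ne)
      ... | u , u∈ , inj₁ e = u , u∈ , ≤-trans (≤-reflexive e) (s≤s z≤n)
      ... | u , u∈ , inj₂ e = u , u∈ , ≤-trans (dist-triangle u (mv δ a) a) (≤-reflexive (cong₂ _+_ e (trans (dist-sym (mv δ a) a) (dist-mv δ a))))
      close′ : ∀ {u} → u ∈ U → ∃ λ b → dist u b ≤ 1 × ∃ λ δ → σ b ≢ σ (mv δ b)
      close′ u∈ = let (b , le , δ , τb , τmv) = close u∈ in b , le , δ , edge⇒differ b δ τb τmv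
      first : ∃ λ u → u ∈ U × dist u p ≤ 2
      first = near p e₀ (λ e → true≢false (trans (sym e) (run ≤-refl)) exit)
      tour : ∃ λ w → length w ≤ length U * (2 * radius) × (∀ {u} → u ∈ U → u ∈ visits p w)
      tour = Tour.tour U radius (Contour.cut σ S ∈ᵇ⁻ e₀ r connected U near close′) p (proj₁ (proj₂ first))
        (≤-trans (≤-trans (≤-reflexive (dist-sym p _)) (proj₂ (proj₂ first))) (≤-trans (m≤m+n 2 (suc r)) (m≤m+n (2 + suc r) (suc r + 2))))
      padded : ∃ λ w → length w ≡ M * (2 * radius) × (∀ {y} → y ∈ visits p (proj₁ tour) → y ∈ visits p w)
      padded = pad e₀ p (proj₁ tour) (≤-trans (proj₁ (proj₂ tour)) (*-monoˡ-≤ (2 * radius) |U|≤M))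
      in-halo : ∀ {u} x → u ∈ U → dist u x ≡ 1 → x ∈ halo p (proj₁ padded)
      in-halo {u} x u∈ e with adj⇒mv u x e
      ... | δ , refl = ∈-cartesianProductWith⁺ mv (∈-dirs δ) (proj₂ (proj₂ padded) (proj₂ (proj₂ tour) u∈))
      separates : ∀ x δ → σ x ≢ σ (mv δ x) → x ∈ halo p (proj₁ padded) ⊎ mv δ x ∈ halo p (proj₁ padded)
      separates x δ ne with dominated x δ (differ⇒edge x δ ne)
      ... | u , u∈ , inj₁ e = inj₁ (in-halo x u∈ e)
      ... | u , u∈ , inj₂ e = inj₂ (in-halo (mv δ x) u∈ e)

    code : Code
    code = let (U , close , dominated , a , b , |U| , a≤ , b≤) =
                 Separation.separator minimalCover Λ (deduplicate-! _≟ᴾ_ _) Λ-near t J t≥1 t≤d d≤2^J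
               (D , run , exit) = R.leave e₀ x₀ x₀∈S
           in encode U close dominated (≤-trans (≤-reflexive |U|) (≤M a b a≤ b≤)) D run exit

-- Numerical estimates

quotient : ∀ n D → 1 ≤ D → ∃ λ k → k * D ≤ n × n < suc k * D
quotient n D@(suc _) (s≤s z≤n) = n / D , m/n*n≤m n D , (begin-strict
  n                     ≡⟨ m≡m%n+[m/n]*n n D ⟩
  n % D + (n / D) * D   <⟨ +-monoˡ-< _ (m%n<n n D) ⟩
  D + (n / D) * D       ∎)
  where open ≤-Reasoning

quotient-max : ∀ {k n D j} → n < suc k * D → j * D ≤ n → j ≤ k
quotient-max {k} {n} {D} {j} lt le = ≤-pred (*-cancelʳ-< D j (suc k) (≤-<-trans le lt))

-- `isqrt` counts the positive k with k² ≤ d. These form an initial segment, so the count among 1,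
-- ..., m is either m or already the root; `Bound` is this invariant.
isqrt-spec : ∀ m → isqrt m * isqrt m ≤ m × m < suc (isqrt m) * suc (isqrt m)
isqrt-spec d = finish (isqrt d) (subst Inv c≡isqrt (inv d))
  where
  p : ℕ → Bool
  p k = does (k * k ≤? d)
  c : ℕ → ℕ
  c m = count p (map suc (upTo m))
  c≡isqrt : c d ≡ isqrt d
  c≡isqrt = sym (length-filter-does (λ k → k * k ≤? d) (map suc (upTo d)))
  Bound : ℕ → ℕ → Set
  Bound m k = k ≤ m × k * k ≤ d × (k < m → d < suc k * suc k)
  Inv : ℕ → Set
  Inv k = Bound d k
  c-suc : ∀ m → c (suc m) ≡ c m + ind (p (suc m))
  c-suc m = trans (cong (λ xs → count p (map suc xs)) (sym (upTo-∷ʳ m)))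
    (trans (cong (count p) (map-++ suc (upTo m) (m ∷ [])))
    (trans (count-++ p (map suc (upTo m)) (suc m ∷ [])) (cong (c m +_) (+-identityʳ (ind (p (suc m)))))))
  next : ∀ m → Bound m (c m) → Bound (suc m) (c m + ind (p (suc m)))
  next m (le , sq , up) with p (suc m) in eq
  ... | false = subst (Bound (suc m)) (sym (+-identityʳ (c m))) (≤-trans le (n≤1+n m) , sq , up')
    where
    up' : c m < suc m → d < suc (c m) * suc (c m)
    up' (s≤s lt) with m≤n⇒m<n∨m≡n lt
    ... | inj₁ c<m = up c<m
    ... | inj₂ c≡m = subst (λ k → d < suc k * suc k) (sym c≡m) (≰⇒> (does-false (suc m * suc m ≤? d) eq))
  ... | true with does-true (suc m * suc m ≤? d) eq | m≤n⇒m<n∨m≡n le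
  ... | h | inj₁ c<m = ⊥-elim (<-irrefl refl (≤-trans (up c<m) (≤-trans (*-mono-≤ (≤-trans c<m (n≤1+n m)) (≤-trans c<m (n≤1+n m))) h)))
  ... | h | inj₂ c≡m = subst (Bound (suc m)) (trans (cong suc (sym c≡m)) (sym (+-comm (c m) 1)))
                     (≤-refl , h , λ lt → ⊥-elim (<-irrefl refl lt))
  inv : ∀ m → Bound m (c m)
  inv zero    = z≤n , z≤n , λ ()
  inv (suc m) = subst (Bound (suc m)) (sym (c-suc m)) (next m (inv m))
  finish : ∀ k → Inv k → k * k ≤ d × d < suc k * suc k
  finish k (le , sq , up) with m≤n⇒m<n∨m≡n le
  ... | inj₁ lt   = sq , up lt
  ... | inj₂ refl = sq , ≤-trans (m≤m+n (suc k) (k * suc k)) ≤-refl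

isqrt≥1 : ∀ {m} → 1 ≤ m → 1 ≤ isqrt m
isqrt≥1 {m} m≥1 = positive (isqrt m) (proj₂ (isqrt-spec m))
  where
  positive : ∀ k → m < suc k * suc k → 1 ≤ k
  positive zero    lt = ⊥-elim (<-irrefl refl (≤-trans lt m≥1))
  positive (suc k) lt = s≤s z≤n

m<2^m : ∀ m → m < 2 ^ m
m<2^m zero    = s≤s z≤n
m<2^m (suc m) = ≤-trans (+-mono-≤ (m^n>0 2 m) (m<2^m m)) (≤-reflexive (cong (2 ^ m +_) (sym (+-identityʳ (2 ^ m)))))

n<2^[1+log] : ∀ m → m < 2 ^ suc ⌊log₂ m ⌋
n<2^[1+log] m = ≰⇒> λ le → <-irrefl refl (≤-trans (≤-reflexive (sym (⌊log₂[2^n]⌋≡n (suc ⌊log₂ m ⌋)))) (⌊log₂⌋-mono-≤ le))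

log≤ : ∀ m → ⌊log₂ m ⌋ ≤ m
log≤ m = ≤-trans (⌊log₂⌋-mono-≤ (<⇒≤ (m<2^m m))) (≤-reflexive (⌊log₂[2^n]⌋≡n m))

power-above : ∀ m → ∃ λ k → suc m ≤ 2 ^ k × 2 ^ k ≤ 2 * suc m
power-above zero = 0 , s≤s z≤n , s≤s z≤n
power-above (suc m) with power-above m
... | k , lo , hi with suc (suc m) ≤? 2 ^ k
... | yes h = k , h , ≤-trans hi (*-monoʳ-≤ 2 (n≤1+n (suc m)))
... | no h  = suc k , ≤-trans (s≤s (m≤n+m (suc m) m)) (≤-trans (≤-reflexive (cong (suc m +_) (sym (+-identityʳ (suc m))))) (*-monoʳ-≤ 2 lo)) , *-monoʳ-≤ 2 (≤-pred (≤-trans (≰⇒> h) (n≤1+n _)))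

k²≤2*2^k : ∀ k → k * k ≤ 2 * 2 ^ k
k²≤2*2^k zero    = z≤n
k²≤2*2^k (suc k) = begin
  suc k * suc k            ≡⟨ solve 1 (λ k → (con 1 :+ k) :* (con 1 :+ k) := k :* k :+ (k :+ (con 1 :+ k))) refl k ⟩
  k * k + (k + suc k)      ≤⟨ +-mono-≤ (k²≤2*2^k k) (+-mono-≤ (<⇒≤ (m<2^m k)) (m<2^m k)) ⟩
  2 * 2 ^ k + (2 ^ k + 2 ^ k)  ≡⟨ solve 1 (λ p → con 2 :* p :+ (p :+ p) := con 2 :* (con 2 :* p)) refl (2 ^ k) ⟩
  2 * 2 ^ suc k            ∎
  where open ≤-Reasoning
        open +-*-Solver

2mk≤m²+k² : ∀ m k → 2 * (m * k) ≤ m * m + k * k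
2mk≤m²+k² m k with ≤-total m k
... | inj₁ le with m≤n⇒∃[o]m+o≡n le
... | j , refl = ≤-trans (m≤m+n _ (j * j)) (≤-reflexive (solve 2 (λ m j → con 2 :* (m :* (m :+ j)) :+ j :* j := m :* m :+ (m :+ j) :* (m :+ j)) refl m j))
  where open +-*-Solver
2mk≤m²+k² m k | inj₂ le with m≤n⇒∃[o]m+o≡n le
... | j , refl = ≤-trans (m≤m+n _ (j * j)) (≤-reflexive (solve 2 (λ k j → con 2 :* ((k :+ j) :* k) :+ j :* j := (k :+ j) :* (k :+ j) :+ k :* k) refl k j))
  where open +-*-Solver

-- Bernoulli: (1 + 1/D)^j ≤ (1 - j/(D+1))⁻¹, which is at most 2 for j ≤ (D+1)/2; squaring gives (1 + 1/D)^D ≤ 4.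
bernoulli : ∀ D j k → j + k ≡ suc D → suc D ^ j * k ≤ D ^ j * suc D
bernoulli D zero    k e = ≤-reflexive (cong (1 *_) e)
bernoulli D (suc j) k e = begin
  suc D * suc D ^ j * k        ≡⟨ solve 3 (λ e p k → e :* p :* k := p :* (e :* k)) refl (suc D) (suc D ^ j) k ⟩
  suc D ^ j * (suc D * k)      ≤⟨ *-monoʳ-≤ (suc D ^ j) small ⟩
  suc D ^ j * (D * suc k)      ≡⟨ solve 3 (λ p w k → p :* (w :* k) := w :* (p :* k)) refl (suc D ^ j) D (suc k) ⟩
  D * (suc D ^ j * suc k)      ≤⟨ *-monoʳ-≤ D (bernoulli D j (suc k) (trans (+-suc j k) e)) ⟩
  D * (D ^ j * suc D)          ≡⟨ sym (*-assoc D (D ^ j) (suc D)) ⟩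
  D * D ^ j * suc D            ∎
  where
  open ≤-Reasoning
  open +-*-Solver
  small : suc D * k ≤ D * suc k
  small = ≤-trans (+-monoˡ-≤ (D * k) (≤-trans (m≤n+m k j) (≤-reflexive (suc-injective e)))) (≤-reflexive (sym (*-suc D k)))

half-power : ∀ D j → 1 ≤ D → 2 * j ≤ suc D → suc D ^ j ≤ 2 * D ^ j
half-power D j D≥1 2j≤ with m≤n⇒∃[o]m+o≡n (≤-trans (m≤m+n j (j + 0)) 2j≤)
... | k , e = *-cancelʳ-≤ (suc D ^ j) (2 * D ^ j) (suc D) (begin
  suc D ^ j * suc D        ≤⟨ *-monoʳ-≤ (suc D ^ j) big ⟩
  suc D ^ j * (2 * k)      ≡⟨ solve 2 (λ p k → p :* (con 2 :* k) := con 2 :* (p :* k)) refl (suc D ^ j) k ⟩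
  2 * (suc D ^ j * k)      ≤⟨ *-monoʳ-≤ 2 (bernoulli D j k e) ⟩
  2 * (D ^ j * suc D)      ≡⟨ sym (*-assoc 2 (D ^ j) (suc D)) ⟩
  2 * D ^ j * suc D        ∎)
  where
  open ≤-Reasoning
  open +-*-Solver
  big : suc D ≤ 2 * k
  big = +-cancelˡ-≤ (suc D) (suc D) (2 * k) (begin
    suc D + suc D  ≡⟨ cong (λ x → x + x) (sym e) ⟩
    (j + k) + (j + k) ≡⟨ solve 2 (λ j k → (j :+ k) :+ (j :+ k) := con 2 :* j :+ con 2 :* k) refl j k ⟩
    2 * j + 2 * k  ≤⟨ +-monoˡ-≤ (2 * k) 2j≤ ⟩
    suc D + 2 * k  ∎)

power≤4 : ∀ D → 1 ≤ D → suc D ^ D ≤ 4 * D ^ D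
power≤4 D D≥1 = begin
  suc D ^ D                                    ≡⟨ cong (suc D ^_) (sym (⌊n/2⌋+⌈n/2⌉≡n D)) ⟩
  suc D ^ (⌊ D /2⌋ + ⌈ D /2⌉)                  ≡⟨ ^-distribˡ-+-* (suc D) ⌊ D /2⌋ ⌈ D /2⌉ ⟩
  suc D ^ ⌊ D /2⌋ * suc D ^ ⌈ D /2⌉            ≤⟨ *-mono-≤ (half-power D ⌊ D /2⌋ D≥1 (≤-trans (*-monoʳ-≤ 2 (⌊n/2⌋≤⌈n/2⌉ D)) ceil)) (half-power D ⌈ D /2⌉ D≥1 ceil) ⟩
  2 * D ^ ⌊ D /2⌋ * (2 * D ^ ⌈ D /2⌉)          ≡⟨ solve 2 (λ a b → con 2 :* a :* (con 2 :* b) := con 4 :* (a :* b)) refl (D ^ ⌊ D /2⌋) (D ^ ⌈ D /2⌉) ⟩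
  4 * (D ^ ⌊ D /2⌋ * D ^ ⌈ D /2⌉)              ≡⟨ cong (4 *_) (trans (sym (^-distribˡ-+-* D ⌊ D /2⌋ ⌈ D /2⌉)) (cong (D ^_) (⌊n/2⌋+⌈n/2⌉≡n D))) ⟩
  4 * D ^ D                                    ∎
  where
  open ≤-Reasoning
  open +-*-Solver
  ceil : 2 * ⌈ D /2⌉ ≤ suc D
  ceil = begin
    2 * ⌈ D /2⌉                  ≡⟨ cong (⌈ D /2⌉ +_) (+-identityʳ ⌈ D /2⌉) ⟩
    ⌊ suc D /2⌋ + ⌊ suc D /2⌋    ≤⟨ +-monoʳ-≤ ⌊ suc D /2⌋ (⌊n/2⌋≤⌈n/2⌉ (suc D)) ⟩
    ⌊ suc D /2⌋ + ⌈ suc D /2⌉    ≡⟨ ⌊n/2⌋+⌈n/2⌉≡n (suc D) ⟩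
    suc D                        ∎

^-distribʳ-* : ∀ k a b → (a * b) ^ k ≡ a ^ k * b ^ k
^-distribʳ-* zero    a b = refl
^-distribʳ-* (suc k) a b = trans (cong (a * b *_) (^-distribʳ-* k a b))
  (solve 4 (λ a b x y → a :* b :* (x :* y) := a :* x :* (b :* y)) refl a b (a ^ k) (b ^ k))
  where open +-*-Solver

-- Division by D^N leaves (1 + 1/D)^(K D) ≤ 4^K, which makes the N positive answers of `reveal`
-- cheap.
cancel-powers : ∀ D K b {N x M} → 1 ≤ D → N ≡ K * D → x * D ^ N ≤ suc D ^ (N + b) * M → x ≤ 4 ^ K * (suc D ^ b * M)
cancel-powers D K b {N} {x} {M} D≥1 refl h = *-cancelʳ-≤ x (4 ^ K * (suc D ^ b * M)) (D ^ (K * D)) {{m^n≢0 D (K * D) {{>-nonZero D≥1}}}} (begin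
  x * D ^ (K * D)                           ≤⟨ h ⟩
  suc D ^ (K * D + b) * M                   ≡⟨ cong (_* M) (^-distribˡ-+-* (suc D) (K * D) b) ⟩
  suc D ^ (K * D) * suc D ^ b * M           ≤⟨ *-monoˡ-≤ M (*-monoˡ-≤ (suc D ^ b) powers) ⟩
  4 ^ K * D ^ (K * D) * suc D ^ b * M       ≡⟨ solve 4 (λ f p s m → f :* p :* s :* m := f :* (s :* m) :* p) refl (4 ^ K) (D ^ (K * D)) (suc D ^ b) M ⟩
  4 ^ K * (suc D ^ b * M) * D ^ (K * D)     ∎)
  where
  open ≤-Reasoning
  open +-*-Solver
  powers : suc D ^ (K * D) ≤ 4 ^ K * D ^ (K * D)
  powers = begin
    suc D ^ (K * D)     ≡⟨ trans (cong (suc D ^_) (*-comm K D)) (sym (^-*-assoc (suc D) D K)) ⟩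
    (suc D ^ D) ^ K     ≤⟨ ^-monoˡ-≤ K (power≤4 D D≥1) ⟩
    (4 * D ^ D) ^ K     ≡⟨ ^-distribʳ-* K 4 (D ^ D) ⟩
    4 ^ K * (D ^ D) ^ K ≡⟨ cong (4 ^ K *_) (trans (^-*-assoc D D K) (cong (D ^_) (*-comm D K))) ⟩
    4 ^ K * D ^ (K * D) ∎

-- The count

count-by-code : {A Code : Set} (_≟ᶜ_ : DecidableEquality Code) (code : A → Code) (codes : List Code) (𝓐 : List A) (N : ℕ) →
  (∀ a → code a ∈ codes) → (∀ c → length (sel (λ a → does (code a ≟ᶜ c)) 𝓐) ≤ N) → length 𝓐 ≤ length codes * N
count-by-code _≟ᶜ_ code codes 𝓐 N total few = begin
  length 𝓐                                                        ≡⟨ sym (count-true 𝓐) ⟩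
  count (λ _ → true) 𝓐                                            ≤⟨ ∑-mono 𝓐 (λ {a} _ → ∃⇒count (λ c → does (code a ≟ᶜ c)) (total a) (does-yes (code a ≟ᶜ code a) refl)) ⟩
  ∑ 𝓐 (λ a → count (λ c → does (code a ≟ᶜ c)) codes)              ≡⟨ ∑-swap 𝓐 codes (λ a c → ind (does (code a ≟ᶜ c))) ⟩
  ∑ codes (λ c → count (λ a → does (code a ≟ᶜ c)) 𝓐)              ≤⟨ ∑-≤-const codes (λ {c} _ → ≤-trans (≤-reflexive (sym (length-sel (λ a → does (code a ≟ᶜ c)) 𝓐))) (few c)) ⟩
  length codes * N                                                ∎
  where open ≤-Reasoning

module ClassBound {d n : ℕ} (d≥2 : 2 ≤ d) {A : Set} (C : A → MinimalCover d n) where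
  open Family d≥2 C

  -- The factors, from the left: the labels; revealing at threshold d with K negative answers;
  -- revealing at threshold q with b of them; the final covers. K = 6 (L + 1) because the number of
  -- mixed vertices is at most N = 3|H| = K d.
  class-bound : ∀ Λ → Unique Λ → ∀ 𝓕 → (∀ x → mixed 𝓕 x ≡ true → x ∈ Λ) → Distinct 𝓕 →
    ∀ H L → length H ≡ 2 * d * suc L →
    (∀ {a} → a ∈ 𝓕 → ∀ x δ → x ∉ H → mv δ x ∉ H → τ a (mv δ x) ≡ not (τ a x)) →
    ∀ q b β → (∀ {c} → c * d ≤ n → c ≤ b * q) → (∀ {c} → c * (2 * d ∸ q) ≤ n → c ≤ β) →
    length 𝓕 ≤ 2 ^ (4 * suc L) * (4 ^ (6 * suc L) * (suc d ^ (6 * suc L) * (4 ^ (6 * suc L) * (suc d ^ b * 2 ^ β))))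
  class-bound Λ uΛ 𝓕 in-Λ dist𝓕 H L |H| away q b β ≤b ≤β =
    label _ (4 * suc L) 𝓕 id dist𝓕 potential stage₁
    where
    open Branching Λ uΛ 𝓕 in-Λ
    open Labelling H away
    open +-*-Solver
    K N : ℕ
    K = 6 * suc L
    N = 3 * length H
    d≥1 : 1 ≤ d
    d≥1 = ≤-trans (s≤s z≤n) d≥2
    N≡ : N ≡ K * d
    N≡ = trans (cong (3 *_) |H|) (solve 2 (λ d l → con 3 :* (con 2 :* d :* l) := con 6 :* l :* d) refl d (suc L))
    potential : Φ 𝓕 ≤ 4 * suc L * (d * d)
    potential = ≤-trans (Φ-bound 𝓕) (≤-reflexive (trans (cong (_* (2 * d)) |H|)
      (solve 2 (λ d l → con 2 :* d :* l :* (con 2 :* d) := con 4 :* l :* (d :* d)) refl d (suc L))))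
    stage₃ : ∀ 𝓖 → 𝓖 ⊑ 𝓕 → Distinct 𝓖 → Sparse q 𝓖 → length 𝓖 ≤ 2 ^ β
    stage₃ 𝓖 sub dist𝓖 sparse = minimal-covers β 𝓖 sub dist𝓖 (λ m → ≤β (sparse-cost q sub m sparse))
    stage₂ : ∀ 𝓖 → 𝓖 ⊑ 𝓕 → mixing 𝓖 ≤ N → Distinct 𝓖 → Sparse d 𝓖 → length 𝓖 ≤ 4 ^ K * (suc d ^ b * 2 ^ β)
    stage₂ 𝓖 sub few dist𝓖 sparse = cancel-powers d K b d≥1 N≡ (reveal q (2 ^ β) d N b 𝓖 sub dist𝓖 few
      (λ {a} m → ≤b (subst (λ k → cost 𝓖 a * k ≤ n) (trans (cong (_∸ d) (cong (d +_) (+-identityʳ d))) (m+n∸m≡n d d)) (sparse-cost d sub m sparse)))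
      (λ 𝓗 sub' → stage₃ 𝓗 (sub ∘ sub')))
    stage₁ : ∀ 𝓖 → 𝓖 ⊑ 𝓕 → Distinct 𝓖 → Labelled 𝓖 → length 𝓖 ≤ 4 ^ K * (suc d ^ K * (4 ^ K * (suc d ^ b * 2 ^ β)))
    stage₁ 𝓖 sub dist𝓖 labelled = cancel-powers d K K d≥1 N≡ (reveal d _ d N K 𝓖 sub dist𝓖 few
      (λ {a} m → ≤-trans (cost≤mixing 𝓖 a) (≤-trans few (≤-reflexive N≡)))
      (λ 𝓗 sub' → stage₂ 𝓗 (sub ∘ sub') (≤-trans (count-mono Λ (λ {x} _ → mixed-mono x sub')) few)))
      where
      few : mixing 𝓖 ≤ N
      few = labelled-mixing 𝓖 sub labelled

power-of-2 : ∀ {m} g k → m ≤ 2 ^ g → m ^ k ≤ 2 ^ (g * k)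
power-of-2 g k h = ≤-trans (^-monoˡ-≤ k h) (≤-reflexive (^-*-assoc 2 g k))

product-of-2 : ∀ {x y} e f → x ≤ 2 ^ e → y ≤ 2 ^ f → x * y ≤ 2 ^ (e + f)
product-of-2 e f h k = ≤-trans (*-mono-≤ h k) (≤-reflexive (sym (^-distribˡ-+-* 2 e f)))

-- 24 = 3 · 2 + 9 + 2 · 4 + 1 collects the ball, the initial run, the second revealing and the
-- excess of the cover term. The walk contributes 3 · 32c, and 40 = 28 + 12 multiplies the bound 2 +
-- 32c for the L + 1 visited points; 32 comes from R ≤ 8r.
constant : ℕ → ℕ
constant c = 24 + 3 * (32 * c) + 40 * (2 + 32 * c)

-- Multiplication by 2dq clears all denominators. Every term but the last is then at most a constant
-- times W = n r lg l; only β contributes the main term n q.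
final-exponent : ∀ c {d n r q lg l M R κ z b β} →
  q ≤ d → q * q ≤ d → d * d ≤ n → 1 ≤ r → 1 ≤ lg → 1 ≤ l → 1 ≤ z →
  M * (d * q) ≤ n * l * c → R ≤ 8 * r → 2 ^ κ ≤ 2 * suc z → z * d ≤ n → b * (d * q) ≤ 2 * n → β * (2 * d ∸ q) ≤ n →
  let L' = suc (M * (2 * R)) ; K = 6 * L' in
  ((3 * lg * r + κ) + 3 * lg * (M * (2 * R)) + (4 * L' + (2 * K + (2 * lg * K + (2 * K + (2 * lg * b + β)))))) * (2 * d * q)
    ≤ n * q + n * constant c * r * lg * l
final-exponent c {d} {n} {r} {q} {lg} {l} {M} {R} {κ} {z} {b} {β} q≤d q²≤d d²≤n r≥1 lg≥1 l≥1 z≥1 M≤ R≤ κ≤ z≤ b≤ β≤ = begin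
  ((3 * lg * r + κ) + 3 * lg * L + (4 * L' + (2 * (6 * L') + (2 * lg * (6 * L') + (2 * (6 * L') + (2 * lg * b + β)))))) * X
    ≡⟨ solve 8 (λ lg r κ L l' b β x →
         ((con 3 :* lg :* r :+ κ) :+ con 3 :* lg :* L :+ (con 4 :* l' :+ (con 2 :* (con 6 :* l') :+ (con 2 :* lg :* (con 6 :* l') :+ (con 2 :* (con 6 :* l') :+ (con 2 :* lg :* b :+ β)))))) :* x
         := con 3 :* (lg :* r :* x) :+ κ :* x :+ con 3 :* (lg :* (L :* x)) :+ con 28 :* (l' :* x) :+ con 12 :* (lg :* (l' :* x)) :+ con 2 :* (lg :* (b :* x)) :+ β :* x)
       refl lg r κ L L' b β X ⟩
  3 * (lg * r * X) + κ * X + 3 * (lg * (L * X)) + 28 * (L' * X) + 12 * (lg * (L' * X)) + 2 * (lg * (b * X)) + β * X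
    ≤⟨ +-mono-≤ (+-mono-≤ (+-mono-≤ (+-mono-≤ (+-mono-≤ (+-mono-≤ (*-monoʳ-≤ 3 ball-term) start-term) (*-monoʳ-≤ 3 walk-term)) (*-monoʳ-≤ 28 label-term)) (*-monoʳ-≤ 12 reveal-term)) (*-monoʳ-≤ 2 second-term)) cover-term ⟩
  3 * (W * 2) + W * 9 + 3 * (W * (32 * c)) + 28 * (W * (2 + 32 * c)) + 12 * (W * (2 + 32 * c)) + 2 * (W * 4) + (n * q + W * 1)
    ≡⟨ solve 7 (λ n r lg l q w c →
         con 3 :* (n :* r :* lg :* l :* con 2) :+ n :* r :* lg :* l :* con 9 :+ con 3 :* (n :* r :* lg :* l :* (con 32 :* c)) :+ con 28 :* (n :* r :* lg :* l :* (con 2 :+ con 32 :* c)) :+ con 12 :* (n :* r :* lg :* l :* (con 2 :+ con 32 :* c)) :+ con 2 :* (n :* r :* lg :* l :* con 4) :+ (n :* q :+ n :* r :* lg :* l :* con 1)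
         := n :* q :+ n :* (con 24 :+ con 3 :* (con 32 :* c) :+ con 40 :* (con 2 :+ con 32 :* c)) :* r :* lg :* l) refl n r lg l q W c ⟩
  n * q + n * constant c * r * lg * l ∎
  where
  open ≤-Reasoning
  open +-*-Solver
  L L' X W : ℕ
  L = M * (2 * R)
  L' = suc L
  X = 2 * d * q
  W = n * r * lg * l
  dq≤n : d * q ≤ n
  dq≤n = ≤-trans (*-monoʳ-≤ d q≤d) d²≤n
  X≤ : X ≤ n * 2
  X≤ = ≤-trans (≤-reflexive (solve 2 (λ d q → con 2 :* d :* q := d :* q :* con 2) refl d q)) (*-monoˡ-≤ 2 dq≤n)
  up : ∀ x {y} → 1 ≤ y → x ≤ x * y
  up x h = ≤-trans (≤-reflexive (sym (*-identityʳ x))) (*-monoʳ-≤ x h)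
  n≤W : n ≤ W
  n≤W = ≤-trans (up n r≥1) (≤-trans (up (n * r) lg≥1) (up (n * r * lg) l≥1))
  nr≤ : n ≤ n * r * l
  nr≤ = ≤-trans (up n r≥1) (up (n * r) l≥1)
  nrl≤W : n * r * l ≤ W
  nrl≤W = *-monoˡ-≤ l (up (n * r) lg≥1)
  lg-nrl : ∀ k → lg * (n * r * l * k) ≡ W * k
  lg-nrl k = solve 5 (λ n r lg l k → lg :* (n :* r :* l :* k) := n :* r :* lg :* l :* k) refl n r lg l k
  ball-term : lg * r * X ≤ W * 2
  ball-term = begin
    lg * r * X            ≤⟨ *-monoʳ-≤ (lg * r) X≤ ⟩
    lg * r * (n * 2)      ≡⟨ solve 3 (λ lg r n → lg :* r :* (n :* con 2) := n :* r :* lg :* con 2) refl lg r n ⟩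
    n * r * lg * 2        ≤⟨ *-monoˡ-≤ 2 (up (n * r * lg) l≥1) ⟩
    W * 2                 ∎
  -- The κ bits of the run length are balanced against q by 2qκ ≤ q² + κ², where q² ≤ d and κ² ≤ 2 ·
  -- 2^κ = O(z), while z d ≤ n.
  start-term : κ * X ≤ W * 9
  start-term = begin
    κ * X                     ≡⟨ solve 3 (λ k d q → k :* (con 2 :* d :* q) := d :* (con 2 :* (q :* k))) refl κ d q ⟩
    d * (2 * (q * κ))         ≤⟨ *-monoʳ-≤ d (2mk≤m²+k² q κ) ⟩
    d * (q * q + κ * κ)       ≤⟨ *-monoʳ-≤ d (+-mono-≤ q²≤d (≤-trans (k²≤2*2^k κ) (*-monoʳ-≤ 2 κ≤))) ⟩
    d * (d + 2 * (2 * suc z)) ≤⟨ *-monoʳ-≤ d (+-monoʳ-≤ d (*-monoʳ-≤ 2 (*-monoʳ-≤ 2 (+-monoˡ-≤ z z≥1)))) ⟩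
    d * (d + 2 * (2 * (z + z))) ≡⟨ solve 2 (λ d z → d :* (d :+ con 2 :* (con 2 :* (z :+ z))) := d :* d :+ z :* d :* con 8) refl d z ⟩
    d * d + z * d * 8         ≤⟨ +-mono-≤ d²≤n (*-monoˡ-≤ 8 z≤) ⟩
    n + n * 8                 ≡⟨ solve 1 (λ n → n :+ n :* con 8 := n :* con 9) refl n ⟩
    n * 9                     ≤⟨ *-monoˡ-≤ 9 n≤W ⟩
    W * 9                     ∎
  LX : L * X ≤ n * r * l * (32 * c)
  LX = begin
    L * X                     ≡⟨ solve 4 (λ m w d q → m :* (con 2 :* w) :* (con 2 :* d :* q) := m :* (d :* q) :* (con 4 :* w)) refl M R d q ⟩
    M * (d * q) * (4 * R)     ≤⟨ *-mono-≤ M≤ (*-monoʳ-≤ 4 R≤) ⟩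
    n * l * c * (4 * (8 * r)) ≡⟨ solve 4 (λ n l c r → n :* l :* c :* (con 4 :* (con 8 :* r)) := n :* r :* l :* (con 32 :* c)) refl n l c r ⟩
    n * r * l * (32 * c)      ∎
  L'X : L' * X ≤ n * r * l * (2 + 32 * c)
  L'X = begin
    X + L * X                                  ≤⟨ +-mono-≤ (≤-trans X≤ (*-monoˡ-≤ 2 nr≤)) LX ⟩
    n * r * l * 2 + n * r * l * (32 * c)       ≡⟨ sym (*-distribˡ-+ (n * r * l) 2 (32 * c)) ⟩
    n * r * l * (2 + 32 * c)                   ∎
  walk-term : lg * (L * X) ≤ W * (32 * c)
  walk-term = ≤-trans (*-monoʳ-≤ lg LX) (≤-reflexive (lg-nrl (32 * c)))
  label-term : L' * X ≤ W * (2 + 32 * c)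
  label-term = ≤-trans L'X (*-monoˡ-≤ (2 + 32 * c) nrl≤W)
  reveal-term : lg * (L' * X) ≤ W * (2 + 32 * c)
  reveal-term = ≤-trans (*-monoʳ-≤ lg L'X) (≤-reflexive (lg-nrl (2 + 32 * c)))
  second-term : lg * (b * X) ≤ W * 4
  second-term = begin
    lg * (b * X)              ≡⟨ solve 4 (λ lg b d q → lg :* (b :* (con 2 :* d :* q)) := lg :* (con 2 :* (b :* (d :* q)))) refl lg b d q ⟩
    lg * (2 * (b * (d * q)))  ≤⟨ *-monoʳ-≤ lg (*-monoʳ-≤ 2 b≤) ⟩
    lg * (2 * (2 * n))        ≡⟨ solve 2 (λ lg n → lg :* (con 2 :* (con 2 :* n)) := lg :* (n :* con 4)) refl lg n ⟩
    lg * (n * 4)              ≤⟨ *-monoʳ-≤ lg (*-monoˡ-≤ 4 nr≤) ⟩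
    lg * (n * r * l * 4)      ≡⟨ lg-nrl 4 ⟩
    W * 4                     ∎
  -- Split 2d = (2d - q) + q. The first part gives n q, the second β q² ≤ β d ≤ β (2d - q) ≤ n.
  cover-term : β * X ≤ n * q + W * 1
  cover-term = begin
    β * X                       ≡⟨ solve 3 (λ b d q → b :* (con 2 :* d :* q) := b :* (con 2 :* d) :* q) refl β d q ⟩
    β * (2 * d) * q             ≡⟨ cong (λ k → β * k * q) (sym (m∸n+n≡m (≤-trans q≤d (m≤m+n d (d + 0))))) ⟩
    β * (2 * d ∸ q + q) * q     ≡⟨ solve 3 (λ b k q → b :* (k :+ q) :* q := b :* k :* q :+ b :* (q :* q)) refl β (2 * d ∸ q) q ⟩
    β * (2 * d ∸ q) * q + β * (q * q)     ≤⟨ +-mono-≤ (*-monoˡ-≤ q β≤) (*-monoʳ-≤ β (≤-trans q²≤d d≤)) ⟩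
    n * q + β * (2 * d ∸ q)     ≤⟨ +-monoʳ-≤ (n * q) (≤-trans β≤ (≤-trans n≤W (≤-reflexive (sym (*-identityʳ W))))) ⟩
    n * q + W * 1               ∎
    where
    d≤ : d ≤ 2 * d ∸ q
    d≤ = ≤-trans (≤-reflexive (sym (trans (cong (_∸ d) (cong (d +_) (+-identityʳ d))) (m+n∸m≡n d d)))) (∸-monoʳ-≤ (2 * d) q≤d)

-- With t = q l and J = lg + 1, the factor lg + 2 is at most 3 lg ≤ 12 l², whence 96 = 8 · 12. The
-- hubs add 4, because q² ≤ d.
separator-size : ∀ {d n q lg l} a b → q * q ≤ d → 1 ≤ q → 1 ≤ lg → 1 ≤ l → lg < suc l * suc l →
  a * d * (q * l) ≤ suc (suc lg) * (8 * n) → b * d * d ≤ 4 * n * (q * l) → (a + b) * (d * q) ≤ n * l * 100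
separator-size {d} {n} {q} {lg} {l} a b q²≤d q≥1 lg≥1 l≥1 lg< a≤ b≤ = begin
  (a + b) * (d * q)             ≡⟨ *-distribʳ-+ (d * q) a b ⟩
  a * (d * q) + b * (d * q)     ≤⟨ +-mono-≤ a-bound b-bound ⟩
  n * l * 96 + n * l * 4        ≡⟨ sym (*-distribˡ-+ (n * l) 96 4) ⟩
  n * l * 100                   ∎
  where
  open ≤-Reasoning
  open +-*-Solver
  lg≤ : lg ≤ 4 * (l * l)
  lg≤ = ≤-trans (<⇒≤ lg<) (≤-trans (*-mono-≤ (+-monoˡ-≤ l l≥1) (+-monoˡ-≤ l l≥1)) (≤-reflexive (solve 1 (λ l → (l :+ l) :* (l :+ l) := con 4 :* (l :* l)) refl l)))
  a-bound : a * (d * q) ≤ n * l * 96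
  a-bound = *-cancelʳ-≤ (a * (d * q)) (n * l * 96) l {{>-nonZero l≥1}} (begin
    a * (d * q) * l               ≡⟨ solve 4 (λ a d q l → a :* (d :* q) :* l := a :* d :* (q :* l)) refl a d q l ⟩
    a * d * (q * l)               ≤⟨ a≤ ⟩
    suc (suc lg) * (8 * n)        ≤⟨ *-monoˡ-≤ (8 * n) (+-mono-≤ lg≥1 (+-monoˡ-≤ lg lg≥1)) ⟩
    (lg + (lg + lg)) * (8 * n)    ≤⟨ *-monoˡ-≤ (8 * n) (+-mono-≤ lg≤ (+-mono-≤ lg≤ lg≤)) ⟩
    (4 * (l * l) + (4 * (l * l) + 4 * (l * l))) * (8 * n)
      ≡⟨ solve 2 (λ l n → (con 4 :* (l :* l) :+ (con 4 :* (l :* l) :+ con 4 :* (l :* l))) :* (con 8 :* n) := n :* l :* con 96 :* l) refl l n ⟩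
    n * l * 96 * l                ∎)
  b-bound : b * (d * q) ≤ n * l * 4
  b-bound = *-cancelʳ-≤ (b * (d * q)) (n * l * 4) q {{>-nonZero q≥1}} (begin
    b * (d * q) * q               ≡⟨ solve 3 (λ b d q → b :* (d :* q) :* q := b :* d :* (q :* q)) refl b d q ⟩
    b * d * (q * q)               ≤⟨ *-monoʳ-≤ (b * d) q²≤d ⟩
    b * d * d                     ≤⟨ b≤ ⟩
    4 * n * (q * l)               ≡⟨ solve 3 (λ n q l → con 4 :* n :* (q :* l) := n :* l :* con 4 :* q) refl n q l ⟩
    n * l * 4 * q                 ∎)

cover-cong : ∀ {d} (S T : FinSet d) x → (x ∈ᵇ S) ≡ (x ∈ᵇ T) → cover S x ≡ cover T x
cover-cong S T x = cong (λ s → not (s xor par x))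

-- M bounds the separating set, z the straight run from the ball of radius r to the boundary, k + 1 the number of vertices
-- revealed in the second stage, and β the size of the final vertex cover; κ is the bit length of z.
record Scales (d n q lg l : ℕ) : Set where
  field
    q≥1   : 1 ≤ q
    lg≥1  : 1 ≤ lg
    l≥1   : 1 ≤ l
    q²≤d  : q * q ≤ d
    l≤q   : l ≤ q
    lg<   : lg < suc l * suc l
    d<    : d < 2 ^ suc lg
    M z k β κ : ℕ
    M≤    : M * (d * q) ≤ n * l * 100
    M-max : n * l * 100 < suc M * (d * q)
    z≤    : z * d ≤ n
    z-max : n < suc z * d
    k≤    : k * (d * q) ≤ n
    k-max : n < suc k * (d * q)
    β≤    : β * (2 * d ∸ q) ≤ n
    β-max : n < suc β * (2 * d ∸ q)
    z<    : suc z ≤ 2 ^ κ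
    κ≤    : 2 ^ κ ≤ 2 * suc z

scales : ∀ d n → 2 ≤ d → Scales d n (isqrt d) ⌊log₂ d ⌋ (isqrt ⌊log₂ d ⌋)
scales d n d≥2 = record
  { q≥1 = q≥1 ; lg≥1 = lg≥1 ; l≥1 = isqrt≥1 lg≥1 ; q²≤d = q²≤d ; l≤q = l≤q ; lg< = proj₂ (isqrt-spec lg) ; d< = n<2^[1+log] d
  ; M = proj₁ walkers ; z = proj₁ starts ; k = proj₁ revealed ; β = proj₁ covered ; κ = proj₁ (power-above (proj₁ starts))
  ; M≤ = proj₁ (proj₂ walkers) ; M-max = proj₂ (proj₂ walkers)
  ; z≤ = proj₁ (proj₂ starts) ; z-max = proj₂ (proj₂ starts)
  ; k≤ = proj₁ (proj₂ revealed) ; k-max = proj₂ (proj₂ revealed)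
  ; β≤ = proj₁ (proj₂ covered) ; β-max = proj₂ (proj₂ covered)
  ; z< = proj₁ (proj₂ (power-above (proj₁ starts))) ; κ≤ = proj₂ (proj₂ (power-above (proj₁ starts)))
  }
  where
  q lg l : ℕ
  q  = isqrt d
  lg = ⌊log₂ d ⌋
  l  = isqrt lg
  d≥1 : 1 ≤ d
  d≥1 = ≤-trans (s≤s z≤n) d≥2
  lg≥1 : 1 ≤ lg
  lg≥1 = ⌊log₂⌋-mono-≤ d≥2
  q≥1 : 1 ≤ q
  q≥1 = isqrt≥1 d≥1
  q²≤d : q * q ≤ d
  q²≤d = proj₁ (isqrt-spec d)
  l≤q : l ≤ q
  l≤q = ≮⇒≥ λ q<l → <-irrefl refl (≤-trans (proj₂ (isqrt-spec d)) (≤-trans (*-mono-≤ q<l q<l) (≤-trans (proj₁ (isqrt-spec lg)) (log≤ d))))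
  dq≥1 : 1 ≤ d * q
  dq≥1 = *-mono-≤ d≥1 q≥1
  q≤d : q ≤ d
  q≤d = ≤-trans (≤-trans (≤-reflexive (sym (*-identityʳ q))) (*-monoʳ-≤ q q≥1)) q²≤d
  d≤2d∸q : d ≤ 2 * d ∸ q
  d≤2d∸q = ≤-trans (≤-reflexive (sym (trans (cong (_∸ d) (cong (d +_) (+-identityʳ d))) (m+n∸m≡n d d)))) (∸-monoʳ-≤ (2 * d) q≤d)
  walkers : ∃ λ M → M * (d * q) ≤ n * l * 100 × n * l * 100 < suc M * (d * q)
  walkers = quotient (n * l * 100) (d * q) dq≥1
  starts : ∃ λ z → z * d ≤ n × n < suc z * d
  starts = quotient n d d≥1
  revealed : ∃ λ k → k * (d * q) ≤ n × n < suc k * (d * q)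
  revealed = quotient n (d * q) dq≥1
  covered : ∃ λ β → β * (2 * d ∸ q) ≤ n × n < suc β * (2 * d ∸ q)
  covered = quotient n (2 * d ∸ q) (≤-trans d≥1 d≤2d∸q)

module Counting {d n r q lg l : ℕ} (d≥2 : 2 ≤ d) (r≥1 : 1 ≤ r) (d²≤n : d * d ≤ n) (sc : Scales d n q lg l) where
  open Scales sc

  A : Set
  A = Σ (FinSet d) (InC d n r)

  cover-of : A → MinimalCover d n
  cover-of (S , S∈C) = Member.minimalCover d≥2 S S∈C

  open Family d≥2 cover-of using (Distinct; mixed; mixed⁻; sel-distinct)

  d≥1 : 1 ≤ d
  d≥1 = ≤-trans (s≤s z≤n) d≥2

  q≤d : q ≤ d
  q≤d = ≤-trans (≤-trans (≤-reflexive (sym (*-identityʳ q))) (*-monoʳ-≤ q q≥1)) q²≤d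

  ql≤d : q * l ≤ d
  ql≤d = ≤-trans (*-monoʳ-≤ q l≤q) q²≤d

  b R L : ℕ
  b = suc k
  R = (2 + suc r) + (suc r + 2)
  L = M * (2 * R)

  e₀ : Dir d
  e₀ = fromℕ< (≤-trans (s≤s z≤n) d≥2) , true

  Code : Set
  Code = Point d × List (Dir d)

  _≟ᶜ_ : DecidableEquality Code
  _≟ᶜ_ = Prod.≡-dec _≟ᴾ_ (≡-dec _≟ᴰ_)

  codes : List Code
  codes = cartesianProduct (cartesianProductWith (λ x D → shift D e₀ x) (ball d r) (upTo (suc z))) (words d L)

  abstract
    encoding : ∀ (a : A) → ∃ λ c → c ∈ codes × length (proj₂ c) ≡ L
      × (∀ x δ → (x ∈ᵇ proj₁ a) ≢ (mv δ x ∈ᵇ proj₁ a) → x ∈ halo (proj₁ c) (proj₂ c) ⊎ mv δ x ∈ halo (proj₁ c) (proj₂ c))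
    encoding (S , S∈C) = (proj₁ c , proj₁ (proj₂ c)) ,
      ∈-cartesianProduct⁺ (proj₁ (proj₂ (proj₂ c))) (subst (λ k → proj₁ (proj₂ c) ∈ words d k) |w| (∈-words (proj₁ (proj₂ c)))) ,
      |w| , proj₂ (proj₂ (proj₂ (proj₂ c)))
      where
      c : Member.Encode.Code d≥2 S S∈C (q * l) (suc lg) M z (*-mono-≤ q≥1 l≥1) ql≤d (<⇒≤ d<)
        (λ a b a≤ b≤ → quotient-max {M} {n * l * 100} {d * q} M-max (separator-size {d} {n} a b q²≤d q≥1 lg≥1 l≥1 lg< a≤ b≤))
        (λ D h → ≤-trans (n≤1+n D) (quotient-max {z} {n} {d} z-max h))
      c = Member.Encode.code d≥2 S S∈C (q * l) (suc lg) M z (*-mono-≤ q≥1 l≥1) ql≤d (<⇒≤ d<)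
        (λ a b a≤ b≤ → quotient-max {M} {n * l * 100} {d * q} M-max (separator-size {d} {n} a b q²≤d q≥1 lg≥1 l≥1 lg< a≤ b≤))
        (λ D h → ≤-trans (n≤1+n D) (quotient-max {z} {n} {d} z-max h))
      |w| : length (proj₁ (proj₂ c)) ≡ L
      |w| = proj₁ (proj₂ (proj₂ (proj₂ c)))

  code : A → Code
  code a = proj₁ (encoding a)

  sparse-classes : ℕ
  sparse-classes = 2 ^ (4 * suc L) * (4 ^ (6 * suc L) * (suc d ^ (6 * suc L) * (4 ^ (6 * suc L) * (suc d ^ b * 2 ^ β))))

  per-code : ∀ 𝓐 → Distinct 𝓐 → ∀ c → length (sel (λ a → does (code a ≟ᶜ c)) 𝓐) ≤ sparse-classes
  per-code 𝓐 dist𝓐 c = bound (sel has-code 𝓐) (sel-distinct has-code dist𝓐) (λ m → does-true (_ ≟ᶜ c) (proj₂ (sel⁻ has-code 𝓐 m)))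
    where
    has-code : A → Bool
    has-code a = does (code a ≟ᶜ c)
    H : List (Point d)
    H = halo (proj₁ c) (proj₂ c)
    bound : ∀ 𝓕 → Distinct 𝓕 → (∀ {a} → a ∈ 𝓕 → code a ≡ c) → length 𝓕 ≤ sparse-classes
    bound [] _ _ = z≤n
    bound 𝓕@(a₀ ∷ _) dist𝓕 same = ClassBound.class-bound d≥2 cover-of Λ (deduplicate-! _≟ᴾ_ _) 𝓕 in-Λ dist𝓕 H L |H| away q b β
      -- The bound variable `k` is a cost, distinct from the field used by `b` and `k-max`. A cost
      -- with cost · d ≤ n < b d q stays below b q.
      (λ {k} h → <⇒≤ (*-cancelʳ-< d k (b * q) (≤-<-trans h (≤-trans k-max (≤-reflexive (trans (cong (b *_) (*-comm d q)) (sym (*-assoc b q d))))))))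
      (quotient-max β-max)
      where
      Λ : List (Point d)
      Λ = deduplicate _≟ᴾ_ (concatMap proj₁ 𝓕)
      |H| : length H ≡ 2 * d * suc L
      |H| = trans (length-cartesianProductWith mv (dirs d) (visits (proj₁ c) (proj₂ c)))
        (cong₂ _*_ (length-dirs d) (trans (length-visits (proj₁ c) (proj₂ c))
          (cong suc (subst (λ e → length (proj₂ e) ≡ L) (same (here refl)) (proj₁ (proj₂ (proj₂ (encoding a₀))))))))
      in-some : ∀ {x a} → a ∈ 𝓕 → (x ∈ᵇ proj₁ a) ≡ true → x ∈ Λ
      in-some {x} a∈ e = ∈-deduplicate⁺ _≟ᴾ_ (∈-concatMap⁺ proj₁ (Any.map (λ { refl → ∈ᵇ⁻ e }) a∈))
      -- Off all sets of the class the covers see nothing but the parity, and so they agree.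
      in-Λ : ∀ x → mixed 𝓕 x ≡ true → x ∈ Λ
      in-Λ x mx = let ((a , a∈ , ax) , (a' , a'∈ , a'x)) = mixed⁻ mx in pick a a' a∈ a'∈ ax a'x _ _ refl refl
        where
        pick : ∀ a a' → a ∈ 𝓕 → a' ∈ 𝓕 → cover (proj₁ a) x ≡ true → cover (proj₁ a') x ≡ false →
          ∀ s s' → (x ∈ᵇ proj₁ a) ≡ s → (x ∈ᵇ proj₁ a') ≡ s' → x ∈ Λ
        pick a a' a∈ a'∈ ax a'x true  s'    p p' = in-some a∈ p
        pick a a' a∈ a'∈ ax a'x false true  p p' = in-some a'∈ p'
        pick a a' a∈ a'∈ ax a'x false false p p' = true≢false ax (trans (cover-cong (proj₁ a) (proj₁ a') x (trans p (sym p'))) a'x)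
      away : ∀ {a} → a ∈ 𝓕 → ∀ x δ → x ∉ H → mv δ x ∉ H → cover (proj₁ a) (mv δ x) ≡ not (cover (proj₁ a) x)
      away {a} a∈ x δ nx ny with (x ∈ᵇ proj₁ a) ≟ᵇ (mv δ x ∈ᵇ proj₁ a)
      ... | yes e = Member.τ-same d≥2 (proj₁ a) (proj₂ a) x δ (sym e)
      ... | no ne with proj₂ (proj₂ (proj₂ (encoding a))) x δ ne
      ... | inj₁ m = ⊥-elim (nx (subst (λ e → x ∈ halo (proj₁ e) (proj₂ e)) (same a∈) m))
      ... | inj₂ m = ⊥-elim (ny (subst (λ e → mv δ x ∈ halo (proj₁ e) (proj₂ e)) (same a∈) m))

  length-codes : length codes ≡ suc (2 * d) ^ r * suc z * (2 * d) ^ L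
  length-codes = trans (length-cartesianProductWith _,_ (cartesianProductWith (λ x D → shift D e₀ x) (ball d r) (upTo (suc z))) (words d L))
    (cong₂ _*_ (trans (length-cartesianProductWith (λ x D → shift D e₀ x) (ball d r) (upTo (suc z)))
      (cong₂ _*_ (length-ball d r) (length-upTo (suc z)))) (length-words d L))

  suc-d≤ : suc d ≤ 2 ^ (2 * lg)
  suc-d≤ = ≤-trans d< (^-monoʳ-≤ 2 (+-mono-≤ lg≥1 (≤-reflexive (sym (+-identityʳ lg)))))

  1+2d≤ : suc (2 * d) ≤ 2 ^ (3 * lg)
  1+2d≤ = begin
    suc (2 * d)            ≤⟨ s≤s (n≤1+n (2 * d)) ⟩
    2 + 2 * d              ≡⟨ sym (*-suc 2 d) ⟩
    2 * suc d              ≤⟨ *-monoʳ-≤ 2 d< ⟩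
    2 ^ suc (suc lg)       ≤⟨ ^-monoʳ-≤ 2 (+-mono-≤ lg≥1 (+-mono-≤ lg≥1 (≤-reflexive (sym (+-identityʳ lg))))) ⟩
    2 ^ (3 * lg)           ∎
    where open ≤-Reasoning

  exponent : ℕ
  exponent = (3 * lg * r + κ) + 3 * lg * L + (4 * suc L + (2 * (6 * suc L) + (2 * lg * (6 * suc L) + (2 * (6 * suc L) + (2 * lg * b + β)))))

  total : ∀ 𝓐 → Distinct 𝓐 → length 𝓐 ≤ 2 ^ exponent
  total 𝓐 dist𝓐 = begin
    length 𝓐 ≤⟨ count-by-code _≟ᶜ_ code codes 𝓐 sparse-classes (λ a → proj₁ (proj₂ (encoding a))) (per-code 𝓐 dist𝓐) ⟩
    length codes * sparse-classes ≡⟨ cong (_* sparse-classes) length-codes ⟩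
    suc (2 * d) ^ r * suc z * (2 * d) ^ L * sparse-classes
      ≤⟨ product-of-2 (3 * lg * r + κ + 3 * lg * L) _
           (product-of-2 (3 * lg * r + κ) (3 * lg * L)
             (product-of-2 (3 * lg * r) κ (power-of-2 (3 * lg) r 1+2d≤) z<)
             (power-of-2 (3 * lg) L (≤-trans (n≤1+n (2 * d)) 1+2d≤)))
           (product-of-2 (4 * suc L) _ ≤-refl
             (product-of-2 (2 * (6 * suc L)) _ (power-of-2 {4} 2 (6 * suc L) ≤-refl)
               (product-of-2 (2 * lg * (6 * suc L)) _ (power-of-2 (2 * lg) (6 * suc L) suc-d≤)
                 (product-of-2 (2 * (6 * suc L)) _ (power-of-2 {4} 2 (6 * suc L) ≤-refl)
                   (product-of-2 (2 * lg * b) β (power-of-2 (2 * lg) b suc-d≤) ≤-refl))))) ⟩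
    2 ^ exponent ∎
    where open ≤-Reasoning

  R≤ : R ≤ 8 * r
  R≤ = begin
    (2 + suc r) + (suc r + 2)     ≡⟨ solve 1 (λ r → (con 2 :+ (con 1 :+ r)) :+ ((con 1 :+ r) :+ con 2) := con 6 :* con 1 :+ con 2 :* r) refl r ⟩
    6 * 1 + 2 * r                 ≤⟨ +-monoˡ-≤ (2 * r) (*-monoʳ-≤ 6 r≥1) ⟩
    6 * r + 2 * r                 ≡⟨ sym (*-distribʳ-+ r 6 2) ⟩
    8 * r                         ∎
    where open ≤-Reasoning
          open +-*-Solver

  z≥1 : 1 ≤ z
  z≥1 = quotient-max {j = 1} z-max (≤-trans (≤-reflexive (*-identityˡ d)) (≤-trans (≤-trans (≤-reflexive (sym (*-identityʳ d))) (*-monoʳ-≤ d d≥1)) d²≤n))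

  b≤ : b * (d * q) ≤ 2 * n
  b≤ = +-mono-≤ (≤-trans (*-monoʳ-≤ d q≤d) d²≤n) (≤-trans k≤ (≤-reflexive (sym (+-identityʳ n))))

  total-power : ∀ 𝓐 → Distinct 𝓐 → length 𝓐 ^ (2 * d * q) ≤ 2 ^ (n * q + n * constant 100 * r * lg * l)
  total-power 𝓐 dist𝓐 = begin
    length 𝓐 ^ (2 * d * q)          ≤⟨ power-of-2 exponent (2 * d * q) (total 𝓐 dist𝓐) ⟩
    2 ^ (exponent * (2 * d * q))     ≤⟨ ^-monoʳ-≤ 2 (final-exponent 100 {M = M} {R = R} {κ = κ} {z = z} {b = b} {β = β} q≤d q²≤d d²≤n r≥1 lg≥1 l≥1 z≥1
                                          M≤ R≤ κ≤ z≤ b≤ β≤) ⟩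
    2 ^ (n * q + n * constant 100 * r * lg * l) ∎
    where open ≤-Reasoning

cover-injective : ∀ {d} (S T : FinSet d) → (∀ x → cover S x ≡ cover T x) → S ≈S T
cover-injective S T h x = mk⇔ (λ m → ∈ᵇ⁻ (trans (sym (same x)) (∈ᵇ⁺ m))) (λ m → ∈ᵇ⁻ (trans (same x) (∈ᵇ⁺ m)))
  where
  cancel : ∀ a b c → not (a xor c) ≡ not (b xor c) → a ≡ b
  cancel true  true  c     e = refl
  cancel false false c     e = refl
  cancel true  false true  ()
  cancel true  false false ()
  cancel false true  true  ()
  cancel false true  false ()
  same : ∀ x → (x ∈ᵇ S) ≡ (x ∈ᵇ T)
  same x = cancel (x ∈ᵇ S) (x ∈ᵇ T) (par x) (h x)

AllPairs-toList : {A : Set} {P : A → Set} {R : A → A → Set} {Q : ∃ P → ∃ P → Set} → (∀ {a b} → R (proj₁ a) (proj₁ b) → Q a b) →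
  ∀ {xs} (ps : All P xs) → AllPairs R xs → AllPairs Q (All.toList ps)
AllPairs-toList h []       []       = []
AllPairs-toList {A} {P} {R} {Q} h (p ∷ ps) (r ∷ rs) = go ps r ∷ AllPairs-toList h ps rs
  where
  go : ∀ {xs} (ps : All P xs) → All (R _) xs → All (Q (_ , p)) (All.toList ps)
  go []       []       = []
  go (_ ∷ ps) (r ∷ rs) = h r ∷ go ps rs

length-toList : {A : Set} {P : A → Set} {xs : List A} (ps : All P xs) → length (All.toList ps) ≡ length xs
length-toList []       = refl
length-toList (p ∷ ps) = cong suc (length-toList ps)

-- Raising to the power 2d √d turns the bound into one between natural numbers. For d ≥ 2 the
-- integer parts of the roots and the logarithm cost at most a constant factor, absorbed by C. A
-- list of pairwise different cutsets of arbitrary length stands for the collection, so the bound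
-- includes its finiteness.
theorem4p1 : Σ ℕ λ C → C ≥ 1 ×
    ((d n r : ℕ) → d ≥ 2 → n ≥ 1 → r ≥ 1 →
    (Ss : List (FinSet d)) → All (InC d n r) Ss → AllPairs (λ S T → ¬ (S ≈S T)) Ss →
    length Ss ^ (2 * d * isqrt d)
    ≤ 2 ^ (n * isqrt d + n * C * r * ⌊log₂ d ⌋ * isqrt ⌊log₂ d ⌋))
theorem4p1 = constant 100 , s≤s z≤n , bound
  where
  0^≤1 : ∀ k → 0 ^ k ≤ 1
  0^≤1 zero    = ≤-refl
  0^≤1 (suc k) = z≤n
  bound : (d n r : ℕ) → d ≥ 2 → n ≥ 1 → r ≥ 1 → (Ss : List (FinSet d)) → All (InC d n r) Ss → AllPairs (λ S T → ¬ (S ≈S T)) Ss →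
    length Ss ^ (2 * d * isqrt d) ≤ 2 ^ (n * isqrt d + n * constant 100 * r * ⌊log₂ d ⌋ * isqrt ⌊log₂ d ⌋)
  -- The empty list is treated apart, since d² ≤ n is derived from a member.
  bound d n r d≥2 _ r≥1 []       _ _ = ≤-trans (0^≤1 (2 * d * isqrt d)) (m^n>0 2 (n * isqrt d + n * constant 100 * r * ⌊log₂ d ⌋ * isqrt ⌊log₂ d ⌋))
  bound d n r d≥2 _ r≥1 Ss@(S ∷ _) all@(S∈C ∷ _) distinct =
    subst (λ k → k ^ (2 * d * isqrt d) ≤ 2 ^ (n * isqrt d + n * constant 100 * r * ⌊log₂ d ⌋ * isqrt ⌊log₂ d ⌋)) (length-toList all)
      (Counting.total-power d≥2 r≥1 (Member.d²≤n d≥2 S S∈C) (scales d n d≥2) (All.toList all)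
        (AllPairs-toList (λ {a} {b} ne h → ne (cover-injective (proj₁ a) (proj₁ b) h)) all distinct))
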